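{- Let $K\subset\mathbb{R}$ be a real number field of degree $d=s+2t\geq 2$, with $s\ge 1$ real embeddings and $2t\ge 0$ non-real embeddings into $\mathbb{C}$, labelled $\sigma_1,\dots,\sigma_d$ as in the context. Let $(x_2,\dots,x_{s+t})$ be an element of $\mathbb{R}^{s-1}\times\mathbb{C}^{t}$ (with $x_2,\dots,x_s$ real and $x_{s+1},\dots,x_{s+t}$ complex) all of whose components are of modulus less than $1$, and let $\varepsilon>0$ be sufficiently small that all real intervals $[x_j-\varepsilon,x_j+\varepsilon]$, $2\le j\le s$, and all complex discs $\{z\in\mathbb{C}: |z-x_{s+j}|\le\varepsilon\}$, $1\le j\le t$, are contained in the open unit disc $\{z\in\mathbb{C}: |z|<1\}$. Then there is a positive constant $c=c(K,\varepsilon)$, depending only on $K$ and $\varepsilon$, such that for every $x_1\in\mathbb{R}$ the interval $[x_1-c,x_1+c]$ contains an algebraic integer $\theta\in K$ such that $|x_j-\sigma_j(\theta)|\le\varepsilon$ for every $j\in\{2,\dots,s+t\}$.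
   Context: A real number field $K$ is a subfield of $\mathbb{R}$ of finite degree over $\mathbb{Q}$. It has $s\ge1$ real embeddings and $2t\ge 0$ non-real embeddings into $\mathbb{C}$, with $d=s+2t=[K:\mathbb{Q}]$. The distinct embeddings $\sigma_1,\dots,\sigma_d$ of $K$ into $\mathbb{C}$ are labelled so that $\sigma_1$ is the identity (inclusion) of $K$, $\sigma_j$ is real if and only if $j\le s$, and for $j\in\{1,\dots,t\}$ the embedding $\sigma_{s+t+j}$ is the composition of complex conjugation with $\sigma_{s+j}$. -}

module Defs where

open import Algebra.Bundles.Raw using (RawRing)
import Algebra.Definitions.RawMonoid as RawMonoidDefinitions
import Algebra.Definitions.RawSemiring as RawSemiringDefinitions
open import Algebra.Morphism.Structures using (module RingMorphisms)
open import Data.Empty using (⊥-elim)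
open import Data.Fin.Base using (Fin; zero; suc; toℕ; _↑ˡ_; _↑ʳ_)
open import Data.Integer.Base as ℤ using (ℤ; +_)
import Data.Integer.Properties as ℤ
open import Data.Nat.Base as ℕ using (ℕ; zero; suc; _⊔_)
import Data.Nat.Properties as ℕ
open import Data.Product.Base using (Σ-syntax; ∃-syntax; _×_; _,_; proj₁; proj₂)
open import Data.Rational.Base as ℚ using (ℚ; 0ℚ; 1ℚ; ½; mkℚ; ↥_; 1/_)
open import Data.Rational.Literals using (fromℤ)
import Data.Rational.Properties as ℚ
open import Data.Rational.Solver using (module +-*-Solver)
open import Data.Sum.Base using (_⊎_; inj₁; inj₂; map₁)
open import Data.Vec.Functional using (Vector)
open import Function.Base using (_∘_)
open import Function.Bundles using (_⇔_)
open import Level using (Level; 0ℓ) renaming (suc to lsuc)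
open import Relation.Binary.PropositionalEquality
  using (_≡_; _≢_; refl; sym; trans; cong; cong₂; subst; subst₂)
open import Relation.Nullary using (¬_; yes; no)
open import Relation.Unary using (Pred; Decidable)

------------------------------------------------------------------------
-- Rational estimates

module Estimates where

  open +-*-Solver
  open import Data.Rational.Base using (_+_; _*_; _-_; -_; ∣_∣; _<_; _≤_)

  +-pos : ∀ {p q} → 0ℚ < p → 0ℚ < q → 0ℚ < p + q
  +-pos = ℚ.+-mono-<

  *-pos : ∀ {p q} → 0ℚ < p → 0ℚ < q → 0ℚ < p * q
  *-pos {p} {q} 0<p 0<q = subst (_< p * q) (ℚ.*-zeroʳ p)
    (ℚ.*-monoʳ-<-pos p {{ℚ.positive 0<p}} 0<q)

  *-nonNeg : ∀ {p q} → 0ℚ ≤ p → 0ℚ ≤ q → 0ℚ ≤ p * q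
  *-nonNeg {p} {q} 0≤p 0≤q = subst (_≤ p * q) (ℚ.*-zeroʳ p)
    (ℚ.*-monoˡ-≤-nonNeg p {{ℚ.nonNegative 0≤p}} 0≤q)

  *-mono-≤ : ∀ {p p′ q q′} → 0ℚ ≤ p → 0ℚ ≤ q′ → p ≤ p′ → q ≤ q′ → p * q ≤ p′ * q′
  *-mono-≤ {p} {p′} {q} {q′} 0≤p 0≤q′ p≤p′ q≤q′ = ℚ.≤-trans
    (ℚ.*-monoˡ-≤-nonNeg p {{ℚ.nonNegative 0≤p}} q≤q′)
    (ℚ.*-monoʳ-≤-nonNeg q′ {{ℚ.nonNegative 0≤q′}} p≤p′)

  p≤p+q : ∀ {p q} → 0ℚ ≤ q → p ≤ p + q
  p≤p+q {p} {q} 0≤q = subst (_≤ p + q) (ℚ.+-identityʳ p) (ℚ.+-monoʳ-≤ p 0≤q)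

  0<½* : ∀ {ε} → 0ℚ < ε → 0ℚ < ½ * ε
  0<½* = *-pos (ℚ.positive⁻¹ ½)

  ½+½ : ∀ ε → ½ * ε + ½ * ε ≡ ε
  ½+½ = solve 1 (λ e → con ½ :* e :+ con ½ :* e := e) refl

  0≤1 : 0ℚ ≤ 1ℚ
  0≤1 = ℚ.nonNegative⁻¹ 1ℚ

  p≤∣p∣ : ∀ p → p ≤ ∣ p ∣
  p≤∣p∣ p with ℚ.≤-total 0ℚ p
  ... | inj₁ 0≤p = ℚ.≤-reflexive (sym (ℚ.0≤p⇒∣p∣≡p 0≤p))
  ... | inj₂ p≤0 = ℚ.≤-trans p≤0 (ℚ.0≤∣p∣ p)

  ∣∣<-intro : ∀ {p q} → p < q → - p < q → ∣ p ∣ < q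
  ∣∣<-intro {p} {q} p<q -p<q with ℚ.∣p∣≡p∨∣p∣≡-p p
  ... | inj₁ eq = subst (_< q) (sym eq) p<q
  ... | inj₂ eq = subst (_< q) (sym eq) -p<q

  -- A positive number δ with b δ ≤ ε.
  scale : ∀ b ε → 0ℚ < b → ℚ
  scale b ε 0<b = ε * (1/ b) {{ℚ.>-nonZero 0<b}}

  scale-pos : ∀ {b ε} (0<b : 0ℚ < b) → 0ℚ < ε → 0ℚ < scale b ε 0<b
  scale-pos {b} 0<b 0<ε =
    *-pos 0<ε (ℚ.positive⁻¹ _ {{ℚ.1/pos⇒pos b {{ℚ.positive 0<b}}}})

  scale-* : ∀ {b ε} (0<b : 0ℚ < b) → b * scale b ε 0<b ≡ ε
  scale-* {b} {ε} 0<b = trans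
    (solve 3 (λ b e i → b :* (e :* i) := e :* (b :* i)) refl b ε ((1/ b) {{nz}}))
    (trans (cong (ε *_) (ℚ.*-inverseʳ b {{nz}})) (ℚ.*-identityʳ ε))
    where nz = ℚ.>-nonZero 0<b

  ι : ℕ → ℚ
  ι k = fromℤ (+ k)

  0≤ι : ∀ k → 0ℚ ≤ ι k
  0≤ι k = ℚ.nonNegative⁻¹ (ι k)

  ι-suc : ∀ k → ι (suc k) ≡ 1ℚ + ι k
  ι-suc k = sym (trans
    (cong (λ n → (+ 1 ℤ.+ n) ℚ./ 1) (ℤ.*-identityʳ (+ k)))
    (ℚ.↥p/↧p≡p (ι (suc k))))

  ι-mono-≤ : ∀ {j k} → j ℕ.≤ k → ι j ≤ ι k
  ι-mono-≤ j≤k = ℚ.*≤* (ℤ.*-monoʳ-≤-nonNeg (+ 1) (ℤ.+≤+ j≤k))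

  archimedean : ∀ p → p < ι (suc ℤ.∣ ↥ p ∣)
  archimedean p@(mkℚ n d-1 _) = ℚ.*<* (subst (ℤ._< + suc ℤ.∣ n ∣ ℤ.* + suc d-1)
    (sym (ℤ.*-identityʳ n)) (ℤ.<-≤-trans (n<1+∣n∣ n) (bound ℤ.∣ n ∣)))
    where
    n<1+∣n∣ : ∀ n → n ℤ.< + suc ℤ.∣ n ∣
    n<1+∣n∣ (+ n)       = ℤ.+<+ (ℕ.n<1+n n)
    n<1+∣n∣ ℤ.-[1+ n ]  = ℤ.-<+
    bound : ∀ m → + suc m ℤ.≤ + suc m ℤ.* + suc d-1
    bound m = ℤ.+≤+ (ℕ.m≤m*n (suc m) (suc d-1))

  mesh : ℕ → ℚ
  mesh n = scale (ι (suc n)) 1ℚ (ℚ.positive⁻¹ (ι (suc n)))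

  0<mesh : ∀ n → 0ℚ < mesh n
  0<mesh n = scale-pos {ε = 1ℚ} (ℚ.positive⁻¹ (ι (suc n))) (ℚ.positive⁻¹ 1ℚ)

  ι*mesh : ∀ n → ι (suc n) * mesh n ≡ 1ℚ
  ι*mesh n = scale-* {ε = 1ℚ} (ℚ.positive⁻¹ (ι (suc n)))

  mesh-small : ∀ ε → 0ℚ < ε → ∃[ N ] ∀ n → N ℕ.≤ n → mesh n < ε
  mesh-small ε 0<ε = N , small where
    ε⁻¹ = scale ε 1ℚ 0<ε
    N = ℤ.∣ ↥ ε⁻¹ ∣
    small : ∀ n → N ℕ.≤ n → mesh n < ε
    small n N≤n = ℚ.*-cancelˡ-<-nonNeg (ι (suc n)) {mesh n} {ε}
      (subst₂ _<_ (trans (scale-* {ε = 1ℚ} 0<ε) (sym (ι*mesh n))) (ℚ.*-comm ε (ι (suc n)))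
        (ℚ.*-monoʳ-<-pos ε {{ℚ.positive 0<ε}}
          (ℚ.<-≤-trans (archimedean ε⁻¹) (ι-mono-≤ (ℕ.s≤s N≤n)))))

open Estimates

------------------------------------------------------------------------
-- Real numbers: Cauchy sequences of rationals

record ℝ : Set where
  constructor mkℝ
  field
    seq    : ℕ → ℚ
    cauchy : ∀ ε → 0ℚ ℚ.< ε →
             ∃[ N ] ∀ m n → N ℕ.≤ m → N ℕ.≤ n → ℚ.∣ seq m ℚ.- seq n ∣ ℚ.< ε

open ℝ public

infix 4 _≃_ _<_ _≤_

_≃_ : ℝ → ℝ → Set
x ≃ y = ∀ ε → 0ℚ ℚ.< ε → ∃[ N ] ∀ n → N ℕ.≤ n → ℚ.∣ seq x n ℚ.- seq y n ∣ ℚ.< ε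

_<_ : ℝ → ℝ → Set
x < y = ∃[ ε ] 0ℚ ℚ.< ε × ∃[ N ] ∀ n → N ℕ.≤ n → seq x n ℚ.+ ε ℚ.< seq y n

_≤_ : ℝ → ℝ → Set
x ≤ y = ∀ ε → 0ℚ ℚ.< ε → ∃[ N ] ∀ n → N ℕ.≤ n → seq x n ℚ.< seq y n ℚ.+ ε

infixl 6 _+_ _-_
infixl 7 _*_
infix  8 -_

fromℚ : ℚ → ℝ
fromℚ q .seq _        = q
fromℚ q .cauchy ε 0<ε = 0 , λ _ _ _ _ → subst (λ p → ℚ.∣ p ∣ ℚ.< ε) (sym (ℚ.+-inverseʳ q)) 0<ε

0ℝ 1ℝ : ℝ
0ℝ = fromℚ 0ℚ
1ℝ = fromℚ 1ℚ

_+_ : ℝ → ℝ → ℝ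
(x + y) .seq n = seq x n ℚ.+ seq y n
(x + y) .cauchy ε 0<ε with cauchy x (½ ℚ.* ε) (0<½* 0<ε) | cauchy y (½ ℚ.* ε) (0<½* 0<ε)
... | N₁ , p₁ | N₂ , p₂ = N₁ ⊔ N₂ , λ m n N≤m N≤n →
  estimate (seq x m) (seq y m) (seq x n) (seq y n)
    (p₁ m n (ℕ.m⊔n≤o⇒m≤o N₁ N₂ N≤m) (ℕ.m⊔n≤o⇒m≤o N₁ N₂ N≤n))
    (p₂ m n (ℕ.m⊔n≤o⇒n≤o N₁ N₂ N≤m) (ℕ.m⊔n≤o⇒n≤o N₁ N₂ N≤n))
  where
  open +-*-Solver
  regroup : ∀ a b c d → (a ℚ.- c) ℚ.+ (b ℚ.- d) ≡ (a ℚ.+ b) ℚ.- (c ℚ.+ d)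
  regroup = solve 4 (λ a b c d → (a :- c) :+ (b :- d) := (a :+ b) :- (c :+ d)) refl
  estimate : ∀ a b c d → ℚ.∣ a ℚ.- c ∣ ℚ.< ½ ℚ.* ε → ℚ.∣ b ℚ.- d ∣ ℚ.< ½ ℚ.* ε →
             ℚ.∣ (a ℚ.+ b) ℚ.- (c ℚ.+ d) ∣ ℚ.< ε
  estimate a b c d p q = subst₂ ℚ._<_ (cong ℚ.∣_∣ (regroup a b c d)) (½+½ ε)
    (ℚ.≤-<-trans (ℚ.∣p+q∣≤∣p∣+∣q∣ (a ℚ.- c) (b ℚ.- d)) (ℚ.+-mono-< p q))

-_ : ℝ → ℝ
(- x) .seq n = ℚ.- seq x n
(- x) .cauchy ε 0<ε with cauchy x ε 0<ε
... | N , p = N , λ m n N≤m N≤n →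
  subst (ℚ._< ε) (trans (sym (ℚ.∣-p∣≡∣p∣ (seq x m ℚ.- seq x n)))
    (cong ℚ.∣_∣ (ℚ.neg-distrib-+ (seq x m) (ℚ.- seq x n)))) (p m n N≤m N≤n)

_-_ : ℝ → ℝ → ℝ
x - y = x + - y

eventually-bounded : ∀ x → ∃[ b ] 0ℚ ℚ.< b × ∃[ N ] ∀ n → N ℕ.≤ n → ℚ.∣ seq x n ∣ ℚ.≤ b
eventually-bounded x with cauchy x 1ℚ (ℚ.positive⁻¹ 1ℚ)
... | N , p = 1ℚ ℚ.+ a , ℚ.<-≤-trans (ℚ.positive⁻¹ 1ℚ) (p≤p+q {1ℚ} {a} (ℚ.0≤∣p∣ (seq x N)))
            , N , λ n N≤n → bound (seq x n) (ℚ.<⇒≤ (p n N N≤n ℕ.≤-refl))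
  where
  open +-*-Solver
  a = ℚ.∣ seq x N ∣
  bound : ∀ q → ℚ.∣ q ℚ.- seq x N ∣ ℚ.≤ 1ℚ → ℚ.∣ q ∣ ℚ.≤ 1ℚ ℚ.+ a
  bound q le = subst (λ q → ℚ.∣ q ∣ ℚ.≤ 1ℚ ℚ.+ a)
    (solve 2 (λ c d → (c :- d) :+ d := c) refl q (seq x N))
    (ℚ.≤-trans (ℚ.∣p+q∣≤∣p∣+∣q∣ (q ℚ.- seq x N) (seq x N)) (ℚ.+-monoˡ-≤ a le))

_*_ : ℝ → ℝ → ℝ
(x * y) .seq n = seq x n ℚ.* seq y n
(x * y) .cauchy ε 0<ε =
  let a , 0<a , A , xb = eventually-bounded x
      b , 0<b , B , yb = eventually-bounded y
      M , yc = cauchy y (scale a (½ ℚ.* ε) 0<a) (scale-pos {a} {½ ℚ.* ε} 0<a (0<½* 0<ε))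
      N , xc = cauchy x (scale b (½ ℚ.* ε) 0<b) (scale-pos {b} {½ ℚ.* ε} 0<b (0<½* 0<ε))
  in (A ⊔ B) ⊔ (M ⊔ N) , λ m n le le′ →
    let A≤m = ℕ.m⊔n≤o⇒m≤o A B (ℕ.m⊔n≤o⇒m≤o (A ⊔ B) (M ⊔ N) le)
        B≤n = ℕ.m⊔n≤o⇒n≤o A B (ℕ.m⊔n≤o⇒m≤o (A ⊔ B) (M ⊔ N) le′)
        M≤m = ℕ.m⊔n≤o⇒m≤o M N (ℕ.m⊔n≤o⇒n≤o (A ⊔ B) (M ⊔ N) le)
        N≤m = ℕ.m⊔n≤o⇒n≤o M N (ℕ.m⊔n≤o⇒n≤o (A ⊔ B) (M ⊔ N) le)
        M≤n = ℕ.m⊔n≤o⇒m≤o M N (ℕ.m⊔n≤o⇒n≤o (A ⊔ B) (M ⊔ N) le′)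
        N≤n = ℕ.m⊔n≤o⇒n≤o M N (ℕ.m⊔n≤o⇒n≤o (A ⊔ B) (M ⊔ N) le′)
    in estimate (seq x m) (seq y m) (seq x n) (seq y n) a b 0<a 0<b
         (xb m A≤m) (yb n B≤n) (yc m n M≤m M≤n) (xc m n N≤m N≤n)
  where
  open +-*-Solver
  telescope : ∀ p q r s → p ℚ.* (q ℚ.- s) ℚ.+ s ℚ.* (p ℚ.- r) ≡ p ℚ.* q ℚ.- r ℚ.* s
  telescope = solve 4 (λ p q r s → p :* (q :- s) :+ s :* (p :- r) := p :* q :- r :* s) refl
  product : ∀ u v c e → 0ℚ ℚ.< c → ℚ.∣ u ∣ ℚ.≤ c → ℚ.∣ v ∣ ℚ.< e → ℚ.∣ u ℚ.* v ∣ ℚ.< c ℚ.* e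
  product u v c e 0<c u≤c v<e = subst (ℚ._< c ℚ.* e) (sym (ℚ.∣p*q∣≡∣p∣*∣q∣ u v))
    (ℚ.≤-<-trans (ℚ.*-monoʳ-≤-nonNeg ℚ.∣ v ∣ {{ℚ.∣-∣-nonNeg v}} u≤c)
                 (ℚ.*-monoʳ-<-pos c {{ℚ.positive 0<c}} v<e))
  estimate : ∀ p q r s a b (0<a : 0ℚ ℚ.< a) (0<b : 0ℚ ℚ.< b) → ℚ.∣ p ∣ ℚ.≤ a → ℚ.∣ s ∣ ℚ.≤ b →
             ℚ.∣ q ℚ.- s ∣ ℚ.< scale a (½ ℚ.* ε) 0<a → ℚ.∣ p ℚ.- r ∣ ℚ.< scale b (½ ℚ.* ε) 0<b →
             ℚ.∣ p ℚ.* q ℚ.- r ℚ.* s ∣ ℚ.< ε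
  estimate p q r s a b 0<a 0<b p≤a s≤b q-s<δ p-r<η =
    subst₂ ℚ._<_ (cong ℚ.∣_∣ (telescope p q r s))
      (trans (cong₂ ℚ._+_ (scale-* {a} {½ ℚ.* ε} 0<a) (scale-* {b} {½ ℚ.* ε} 0<b)) (½+½ ε))
      (ℚ.≤-<-trans (ℚ.∣p+q∣≤∣p∣+∣q∣ (p ℚ.* (q ℚ.- s)) (s ℚ.* (p ℚ.- r)))
        (ℚ.+-mono-< (product p (q ℚ.- s) a (scale a (½ ℚ.* ε) 0<a) 0<a p≤a q-s<δ)
                    (product s (p ℚ.- r) b (scale b (½ ℚ.* ε) 0<b) 0<b s≤b p-r<η)))

------------------------------------------------------------------------
-- Square roots

-- The largest k ≤ m satisfying P, or 0 if there is none.
greatest : {P : Pred ℕ 0ℓ} → Decidable P → ℕ → ℕ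
greatest P? zero    = 0
greatest P? (suc m) with P? (suc m)
... | yes _ = suc m
... | no  _ = greatest P? m

greatest-holds : {P : Pred ℕ 0ℓ} (P? : Decidable P) (m : ℕ) →
                 greatest P? m ≡ 0 ⊎ P (greatest P? m)
greatest-holds P? zero    = inj₁ refl
greatest-holds P? (suc m) with P? (suc m)
... | yes p = inj₂ p
... | no  _ = greatest-holds P? m

greatest-maximal : {P : Pred ℕ 0ℓ} (P? : Decidable P) (m : ℕ) → ¬ P (suc m) →
                   ¬ P (suc (greatest P? m))
greatest-maximal P? zero    ¬p = ¬p
greatest-maximal P? (suc m) ¬p with P? (suc m)
... | yes _  = ¬p
... | no ¬p′ = greatest-maximal P? m ¬p′

-- rootℚ q n is the largest multiple r of 1/(n+1) with r² ≤ q, and 0 if q < 0.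
module _ (q : ℚ) (n : ℕ) where

  private
    grid : ℕ → ℚ
    grid k = ι k ℚ.* mesh n

    SquareBelow : Pred ℕ 0ℓ
    SquareBelow k = grid k ℚ.* grid k ℚ.≤ q

    squareBelow? : Decidable SquareBelow
    squareBelow? k = grid k ℚ.* grid k ℚ.≤? q

    b : ℚ
    b = 1ℚ ℚ.+ ℚ.∣ q ∣

    limit : ℕ
    limit = ℤ.∣ ↥ (ι (suc n) ℚ.* b) ∣

    1≤b : 1ℚ ℚ.≤ b
    1≤b = p≤p+q {1ℚ} {ℚ.∣ q ∣} (ℚ.0≤∣p∣ q)

    0≤b : 0ℚ ℚ.≤ b
    0≤b = ℚ.≤-trans 0≤1 1≤b

    b≤grid : b ℚ.≤ grid (suc limit)
    b≤grid = subst (ℚ._≤ grid (suc limit))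
      (trans (solve 3 (λ i b m → i :* b :* m := b :* (i :* m)) refl (ι (suc n)) b (mesh n))
        (trans (cong (b ℚ.*_) (ι*mesh n)) (ℚ.*-identityʳ b)))
      (ℚ.*-monoʳ-≤-nonNeg (mesh n) {{ℚ.nonNegative (ℚ.<⇒≤ (0<mesh n))}}
        (ℚ.<⇒≤ (archimedean (ι (suc n) ℚ.* b))))
      where open +-*-Solver

    q<b*b : q ℚ.< b ℚ.* b
    q<b*b = ℚ.≤-<-trans (p≤∣p∣ q) (ℚ.<-≤-trans
      (subst (ℚ._< b) (ℚ.+-identityˡ ℚ.∣ q ∣) (ℚ.+-monoˡ-< ℚ.∣ q ∣ (ℚ.positive⁻¹ 1ℚ)))
      (subst (ℚ._≤ b ℚ.* b) (ℚ.*-identityʳ b)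
        (*-mono-≤ {b} {b} {1ℚ} {b} 0≤b 0≤b ℚ.≤-refl 1≤b)))

    ¬limit : ¬ SquareBelow (suc limit)
    ¬limit le = ℚ.<-irrefl refl (ℚ.<-≤-trans q<b*b (ℚ.≤-trans
      (*-mono-≤ {b} {grid (suc limit)} {b} {grid (suc limit)}
        0≤b (ℚ.≤-trans 0≤b b≤grid) b≤grid b≤grid) le))

  rootℚ : ℚ
  rootℚ = grid (greatest squareBelow? limit)

  0≤rootℚ : 0ℚ ℚ.≤ rootℚ
  0≤rootℚ = *-nonNeg {ι (greatest squareBelow? limit)} {mesh n} (0≤ι (greatest squareBelow? limit)) (ℚ.<⇒≤ (0<mesh n))

  rootℚ-lower : rootℚ ≡ 0ℚ ⊎ rootℚ ℚ.* rootℚ ℚ.≤ q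
  rootℚ-lower = map₁ (λ eq → trans (cong grid eq) (ℚ.*-zeroˡ (mesh n)))
                     (greatest-holds squareBelow? limit)

  rootℚ-upper : q ℚ.< (rootℚ ℚ.+ mesh n) ℚ.* (rootℚ ℚ.+ mesh n)
  rootℚ-upper = subst (λ r → q ℚ.< r ℚ.* r) next
    (ℚ.≰⇒> (greatest-maximal squareBelow? limit ¬limit))
    where
    open +-*-Solver
    k = greatest squareBelow? limit
    next : grid (suc k) ≡ grid k ℚ.+ mesh n
    next = trans (cong (ℚ._* mesh n) (ι-suc k))
      (solve 2 (λ i m → (con 1ℚ :+ i) :* m := i :* m :+ m) refl (ι k) (mesh n))

root-continuous : ∀ {q q′ r r′ μ h} →
  r ≡ 0ℚ ⊎ r ℚ.* r ℚ.≤ q → q′ ℚ.< (r′ ℚ.+ μ) ℚ.* (r′ ℚ.+ μ) →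
  0ℚ ℚ.≤ r → 0ℚ ℚ.≤ r′ → 0ℚ ℚ.< μ → μ ℚ.< h → q ℚ.- q′ ℚ.< h ℚ.* h →
  r ℚ.- r′ ℚ.< h ℚ.+ h
root-continuous {q} {q′} {r} {r′} {μ} {h} lower upper 0≤r 0≤r′ 0<μ μ<h q-q′< =
  ℚ.≰⇒> λ le → ℚ.<-irrefl refl (ℚ.<-≤-trans
    (ℚ.+-monoˡ-< (h ℚ.* h) q′<)
    (ℚ.≤-trans (p≤p+q {(r′ ℚ.+ h) ℚ.* (r′ ℚ.+ h) ℚ.+ h ℚ.* h} {rest} 0≤rest)
      (ℚ.≤-trans (ℚ.≤-reflexive (expand r′ h)) (ℚ.≤-trans (far²≤ le lower) (ℚ.<⇒≤ q<)))))
  where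
  open +-*-Solver
  0<h = ℚ.<-trans 0<μ μ<h
  0≤h = ℚ.<⇒≤ 0<h
  far = r′ ℚ.+ (h ℚ.+ h)
  rest = r′ ℚ.* h ℚ.+ r′ ℚ.* h ℚ.+ (h ℚ.* h ℚ.+ h ℚ.* h)
  0≤r′h = *-nonNeg {r′} {h} 0≤r′ 0≤h
  0≤hh = *-nonNeg {h} {h} 0≤h 0≤h
  0≤rest : 0ℚ ℚ.≤ rest
  0≤rest = ℚ.+-mono-≤ (ℚ.+-mono-≤ 0≤r′h 0≤r′h) (ℚ.+-mono-≤ 0≤hh 0≤hh)
  expand : ∀ r h →
    (r ℚ.+ h) ℚ.* (r ℚ.+ h) ℚ.+ h ℚ.* h ℚ.+ (r ℚ.* h ℚ.+ r ℚ.* h ℚ.+ (h ℚ.* h ℚ.+ h ℚ.* h))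
    ≡ (r ℚ.+ (h ℚ.+ h)) ℚ.* (r ℚ.+ (h ℚ.+ h))
  expand = solve 2 (λ r h →
    (r :+ h) :* (r :+ h) :+ h :* h :+ (r :* h :+ r :* h :+ (h :* h :+ h :* h))
    := (r :+ (h :+ h)) :* (r :+ (h :+ h))) refl
  cancel : ∀ a b → b ℚ.+ (a ℚ.- b) ≡ a
  cancel = solve 2 (λ a b → b :+ (a :- b) := a) refl
  μ≤h : r′ ℚ.+ μ ℚ.≤ r′ ℚ.+ h
  μ≤h = ℚ.+-monoʳ-≤ r′ (ℚ.<⇒≤ μ<h)
  q′< : q′ ℚ.< (r′ ℚ.+ h) ℚ.* (r′ ℚ.+ h)
  q′< = ℚ.<-≤-trans upper (*-mono-≤ {r′ ℚ.+ μ} {r′ ℚ.+ h} {r′ ℚ.+ μ} {r′ ℚ.+ h}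
    (ℚ.+-mono-≤ 0≤r′ (ℚ.<⇒≤ 0<μ)) (ℚ.+-mono-≤ 0≤r′ 0≤h) μ≤h μ≤h)
  q< : q ℚ.< q′ ℚ.+ h ℚ.* h
  q< = subst (ℚ._< q′ ℚ.+ h ℚ.* h) (cancel q q′) (ℚ.+-monoʳ-< q′ q-q′<)
  0<far : 0ℚ ℚ.< far
  0<far = ℚ.+-mono-≤-< 0≤r′ (+-pos 0<h 0<h)
  far≤r : h ℚ.+ h ℚ.≤ r ℚ.- r′ → far ℚ.≤ r
  far≤r le = subst (far ℚ.≤_) (cancel r r′) (ℚ.+-monoʳ-≤ r′ le)
  far²≤ : h ℚ.+ h ℚ.≤ r ℚ.- r′ → r ≡ 0ℚ ⊎ r ℚ.* r ℚ.≤ q → far ℚ.* far ℚ.≤ q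
  far²≤ le (inj₁ eq) = ⊥-elim (ℚ.<-irrefl refl
    (ℚ.<-≤-trans 0<far (subst (far ℚ.≤_) eq (far≤r le))))
  far²≤ le (inj₂ r²≤q) = ℚ.≤-trans
    (*-mono-≤ {far} {r} {far} {r} (ℚ.<⇒≤ 0<far) 0≤r (far≤r le) (far≤r le)) r²≤q

-- The square root of max(x, 0).
√ : ℝ → ℝ
√ x .seq n = rootℚ (seq x n) n
√ x .cauchy ε 0<ε =
  let M , xc   = cauchy x (h ℚ.* h) (*-pos 0<h 0<h)
      N , fine = mesh-small h 0<h
  in M ⊔ N , λ m n le le′ →
    let M≤m = ℕ.m⊔n≤o⇒m≤o M N le
        N≤m = ℕ.m⊔n≤o⇒n≤o M N le
        M≤n = ℕ.m⊔n≤o⇒m≤o M N le′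
        N≤n = ℕ.m⊔n≤o⇒n≤o M N le′
    in ∣∣<-intro
         (difference m n (fine n N≤n) (xc m n M≤m M≤n))
         (subst (ℚ._< ε) (swap (√x m) (√x n))
           (difference n m (fine m N≤m) (xc n m M≤n M≤m)))
  where
  open +-*-Solver
  h = ½ ℚ.* ε
  0<h : 0ℚ ℚ.< h
  0<h = 0<½* 0<ε
  √x : ℕ → ℚ
  √x n = rootℚ (seq x n) n
  swap : ∀ p q → q ℚ.- p ≡ ℚ.- (p ℚ.- q)
  swap = solve 2 (λ p q → q :- p := :- (p :- q)) refl
  difference : ∀ m n → mesh n ℚ.< h → ℚ.∣ seq x m ℚ.- seq x n ∣ ℚ.< h ℚ.* h →
               √x m ℚ.- √x n ℚ.< ε
  difference m n fine close = subst (√x m ℚ.- √x n ℚ.<_) (½+½ ε)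
    (root-continuous {seq x m} {seq x n} {√x m} {√x n} {mesh n} {h}
      (rootℚ-lower (seq x m) m) (rootℚ-upper (seq x n) n)
      (0≤rootℚ (seq x m) m) (0≤rootℚ (seq x n) n) (0<mesh n) fine
      (ℚ.≤-<-trans (p≤∣p∣ (seq x m ℚ.- seq x n)) close))

ℝ-rawRing : RawRing 0ℓ 0ℓ
ℝ-rawRing = record
  { Carrier = ℝ ; _≈_ = _≃_ ; _+_ = _+_ ; _*_ = _*_ ; -_ = -_ ; 0# = 0ℝ ; 1# = 1ℝ }

open RawMonoidDefinitions (RawRing.+-rawMonoid ℝ-rawRing) public using (sum)
open RawSemiringDefinitions (RawRing.rawSemiring ℝ-rawRing) public using (_^_)

fromInt : ℤ → ℝ
fromInt = fromℚ ∘ fromℤ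

------------------------------------------------------------------------
-- Complex numbers

infix 4 _≃ᶜ_
infixl 6 _-ᶜ_

record ℂ : Set where
  constructor _+i_
  field
    re im : ℝ

open ℂ public

_≃ᶜ_ : ℂ → ℂ → Set
z ≃ᶜ w = re z ≃ re w × im z ≃ im w

ℂ-rawRing : RawRing 0ℓ 0ℓ
ℂ-rawRing = record
  { Carrier = ℂ
  ; _≈_     = _≃ᶜ_
  ; _+_     = λ z w → (re z + re w) +i (im z + im w)
  ; _*_     = λ z w → (re z * re w - im z * im w) +i (re z * im w + im z * re w)
  ; -_      = λ z → (- re z) +i (- im z)
  ; 0#      = 0ℝ +i 0ℝ
  ; 1#      = 1ℝ +i 0ℝ
  }

_-ᶜ_ : ℂ → ℂ → ℂ
z -ᶜ w = (re z - re w) +i (im z - im w)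

fromℝ : ℝ → ℂ
fromℝ x = x +i 0ℝ

conjugate : ℂ → ℂ
conjugate z = re z +i (- im z)

∣_∣ : ℂ → ℝ
∣ z ∣ = √ (re z * re z + im z * im z)

------------------------------------------------------------------------
-- Real number fields

record Subfield (ℓ : Level) : Set (lsuc ℓ) where
  field
    _∈K        : Pred ℝ ℓ
    respects   : ∀ {x y} → x ≃ y → x ∈K → y ∈K
    0∈K        : 0ℝ ∈K
    1∈K        : 1ℝ ∈K
    +-closed   : ∀ {x y} → x ∈K → y ∈K → (x + y) ∈K
    *-closed   : ∀ {x y} → x ∈K → y ∈K → (x * y) ∈K
    neg-closed : ∀ {x} → x ∈K → (- x) ∈K
    inverse    : ∀ {x} → x ∈K → ¬ x ≃ 0ℝ → ∃[ y ] y ∈K × x * y ≃ 1ℝ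

  Element : Set ℓ
  Element = Σ[ x ∈ ℝ ] x ∈K

  rawRing : RawRing ℓ 0ℓ
  rawRing = record
    { Carrier = Element
    ; _≈_     = λ x y → proj₁ x ≃ proj₁ y
    ; _+_     = λ x y → proj₁ x + proj₁ y , +-closed (proj₂ x) (proj₂ y)
    ; _*_     = λ x y → proj₁ x * proj₁ y , *-closed (proj₂ x) (proj₂ y)
    ; -_      = λ x → - proj₁ x , neg-closed (proj₂ x)
    ; 0#      = 0ℝ , 0∈K
    ; 1#      = 1ℝ , 1∈K
    }

-- A subfield of ℝ of degree d over ℚ, witnessed by a ℚ-basis.
record RealNumberField (ℓ : Level) (d : ℕ) : Set (lsuc ℓ) where
  field
    subfield : Subfield ℓ

  open Subfield subfield public

  combination : Vector ℚ d → Vector Element d → ℝ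
  combination q b = sum λ i → fromℚ (q i) * proj₁ (b i)

  field
    basis       : Vector Element d
    spanning    : ∀ (x : Element) → ∃[ q ] proj₁ x ≃ combination q basis
    independent : ∀ q → combination q basis ≃ 0ℝ → ∀ i → q i ≡ 0ℚ

-- A root of the monic polynomial Xⁿ + aₙ₋₁Xⁿ⁻¹ + … + a₀ with integer coefficients.
IsAlgebraicInteger : ℝ → Set
IsAlgebraicInteger θ =
  ∃[ n ] Σ[ a ∈ Vector ℤ n ] (θ ^ n + sum λ i → fromInt (a i) * θ ^ toℕ i) ≃ 0ℝ

-- Injectivity is automatic, since K is a field and 1 ≄ 0 in ℂ.
record Embedding {ℓ d} (K : RealNumberField ℓ d) : Set ℓ where
  open RealNumberField K using (Element; rawRing)
  open RingMorphisms rawRing ℂ-rawRing using (IsRingHomomorphism)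
  field
    ⟦_⟧            : Element → ℂ
    isHomomorphism : IsRingHomomorphism ⟦_⟧

open Embedding public using (⟦_⟧)

module _ {ℓ d} {K : RealNumberField ℓ d} where

  infix 4 _≗_

  _≗_ : Embedding K → Embedding K → Set ℓ
  σ ≗ τ = ∀ x → ⟦ σ ⟧ x ≃ᶜ ⟦ τ ⟧ x

  IsReal : Embedding K → Set ℓ
  IsReal σ = ∀ x → im (⟦ σ ⟧ x) ≃ 0ℝ

-- The embeddings σ₁, …, σ_d, with s = r + 1 real ones and d = s + 2t. Indices
-- start at zero: σ₁ is σ zero, and s = suc r builds in that there is at least
-- one real embedding.
record Labelling {ℓ} (r t : ℕ) (K : RealNumberField ℓ (suc r ℕ.+ (t ℕ.+ t))) : Set ℓ where
  field
    σ        : Fin (suc r ℕ.+ (t ℕ.+ t)) → Embedding K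
    distinct : ∀ i j → i ≢ j → ¬ σ i ≗ σ j
    complete : ∀ τ → ∃[ j ] τ ≗ σ j

  -- σ₂, …, σₛ
  σ-real : Fin r → Embedding K
  σ-real j = σ (suc j ↑ˡ (t ℕ.+ t))

  -- σₛ₊₁, …, σₛ₊ₜ
  σ-complex : Fin t → Embedding K
  σ-complex k = σ (suc r ↑ʳ (k ↑ˡ t))

  -- σₛ₊ₜ₊₁, …, σₛ₊₂ₜ
  σ-complex′ : Fin t → Embedding K
  σ-complex′ k = σ (suc r ↑ʳ (t ↑ʳ k))

  field
    inclusion  : ∀ x → ⟦ σ zero ⟧ x ≃ᶜ fromℝ (proj₁ x)
    real       : ∀ j → IsReal (σ j) ⇔ toℕ j ℕ.< suc r
    conjugates : ∀ k x → ⟦ σ-complex′ k ⟧ x ≃ᶜ conjugate (⟦ σ-complex k ⟧ x)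

{-# OPTIONS --safe #-}
module Submission where

-- Let (bₖ) be a basis of K over ℚ and (bₖ*) its dual basis for the trace form, which is nondegenerate
-- because Tr(z⁻¹ z) = d ≠ 0. The image e of Σ bₖ ⊗ bₖ* under σ ⊗ τ satisfies e² = e and
-- (σ(x) − τ(x)) e = 0, so Σ σ(bₖ) τ(bₖ*) = 0 for distinct embeddings σ and τ, while Σ σ(bₖ) σ(bₖ*) = 1.
-- Hence every conjugation-symmetric y ∈ ℂᵈ is (Σ σᵢ(bₖ) tₖ)ᵢ with real tₖ, and rounding the tₖ to multiples
-- of a suitable integer D yields an algebraic integer θ ∈ K with all |yᵢ − σᵢ(θ)| ≤ C, where C depends
-- only on K. Applied to y = (kX, 0, …, 0) for k = 0, 1, 2, … with X > 2C, this yields distinct θₖ whose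
-- conjugates σᵢ(θₖ), i ≥ 2, are bounded; by the pigeonhole principle two of them differ by some α ≠ 0 with
-- all |σᵢ(α)|, i ≥ 2, as small as desired. If θ′ approximates (yᵢ / σᵢ(α))ᵢ up to C, then α θ′
-- approximates yᵢ up to |σᵢ(α)| C.

open import Algebra.Bundles using (CommutativeMonoid; CommutativeRing; RawRing; Semiring)
import Algebra.Definitions.RawMonoid as RawMonoidDefinitions
import Algebra.Definitions.RawSemiring as RawSemiringDefinitions
open import Algebra.Morphism.Construct.Composition using (isRingHomomorphism)
open import Algebra.Morphism.Structures using (module RingMorphisms)
import Algebra.Properties.CommutativeMonoid.Sum as CommutativeMonoidSum
import Algebra.Properties.CommutativeSemigroup as CommutativeSemigroupProperties
import Algebra.Properties.Ring as RingProperties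
import Algebra.Properties.Semiring.Exp as SemiringExp
import Algebra.Properties.Semiring.Sum as SemiringSum
import Algebra.Solver.Ring as RingSolver
open import Algebra.Solver.Ring.AlmostCommutativeRing using (fromCommutativeRing; _-Raw-AlmostCommutative⟶_)
open import Algebra.Structures using (IsCommutativeRing)
open import Data.Bool.Base using (if_then_else_)
open import Data.Empty using (⊥-elim)
open import Data.Fin.Base as Fin using (Fin; zero; suc; toℕ; fromℕ; punchIn; _↑ˡ_; _↑ʳ_)
import Data.Fin.Properties as Fin
open import Data.Integer.Base as ℤ using (ℤ; +_; 0ℤ; 1ℤ; -1ℤ)
import Data.Integer.DivMod as ℤ
import Data.Integer.Properties as ℤ
open import Data.Maybe.Base as Maybe using (Maybe)
open import Data.Nat.Base as ℕ using (ℕ; zero; suc)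
import Data.Nat.Properties as ℕ
open import Data.Product.Base using (Σ-syntax; ∃-syntax; _×_; _,_; proj₁; proj₂)
open import Data.Rational.Base as ℚ using (ℚ; 0ℚ; 1ℚ; ½; mkℚ; ↥_; 1/_)
open import Data.Rational.Literals using (fromℤ)
import Data.Rational.Properties as ℚ
open import Data.Rational.Solver using (module +-*-Solver)
import Data.Rational.Unnormalised.Base as ℚᵘ
import Data.Rational.Unnormalised.Properties as ℚᵘ
open import Data.Sum.Base using (_⊎_; inj₁; inj₂)
open import Data.Vec.Functional as Vector using (Vector; insertAt)
import Data.Vec.Functional.Properties as Vector
open import Function.Base using (_∘_)
open import Function.Bundles using (module Equivalence)
open import Level using (_⊔_; 0ℓ)
open import Relation.Binary.PropositionalEquality as ≡
  using (_≡_; _≢_; cong; cong₂; subst; subst₂; module ≡-Reasoning)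
import Relation.Binary.Reasoning.Setoid as SetoidReasoning
open import Relation.Binary.Structures using (IsEquivalence)
open import Relation.Nullary using (¬_; yes; no; does; ¬?; contradiction)
open import Relation.Nullary.Decidable using (decidable-stable; dec-true; dec-false; dec⇒maybe)

-- Equality of Cauchy reals is undecidable, and distinct embeddings are only known not to agree
-- everywhere: no element separating them is at hand and no complex determinant can be tested for
-- zero. Pivoting is therefore confined to `ℚ`, where the trace form lives. The passage to `ℂ` rests
-- on the idempotent e: an approximate comparison of its real part with 1/2 makes e or 1 - e
-- cancellable in e (1 - e) = 0, which decides between the values 0 and 1. Integrality is certified
-- by stability of a lattice: an element that maps the ℤ-span of the basis into itself is an
-- algebraic integer, and such elements visibly form a ring, so α θ′ needs no theory of conjugates.
-- The integer D is there to make every D bₖ such an element. The constant is uniform because α is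
-- fixed before the target: the first coordinate is missed by at most a bound for |σ₁(α)| times a
-- multiple of C, plus fixed slack, whatever the point approximated. Slack terms recur because
-- bounds are imposed on representing sequences, and replacing a real by an equal one costs an
-- arbitrarily small amount.

-- Linear algebra over ℚ

module RationalLinearAlgebra where

  open import Data.Rational.Base using (_+_; _*_; -_; _-_)
  open CommutativeRing ℚ.+-*-commutativeRing using (semiring)
  open SemiringSum semiring using (sum; sum-cong-≗; sum-remove; *-distribˡ-sum; ∑-distrib-+; sum-replicate-zero)

  infixl 7 _∙_

  _∙_ : ∀ {n} → Vector ℚ n → Vector ℚ n → ℚ
  u ∙ v = sum λ i → u i * v i

  ∙-scaleʳ : ∀ {n} a (u v : Vector ℚ n) → u ∙ (λ i → a * v i) ≡ a * (u ∙ v)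
  ∙-scaleʳ a u v = ≡.trans
    (sum-cong-≗ λ i → solve 3 (λ a u v → u :* (a :* v) := a :* (u :* v)) ≡.refl a (u i) (v i))
    (≡.sym (*-distribˡ-sum a (λ i → u i * v i)))
    where open +-*-Solver

  ∙-linearˡ : ∀ {n} a b (u u′ v : Vector ℚ n) →
              (λ i → a * u i - b * u′ i) ∙ v ≡ a * (u ∙ v) - b * (u′ ∙ v)
  ∙-linearˡ a b u u′ v = begin
    sum (λ i → (a * u i - b * u′ i) * v i)
      ≡⟨ sum-cong-≗ (λ i → solve 5 (λ a b u u′ v →
           (a :* u :- b :* u′) :* v := a :* (u :* v) :+ (:- b) :* (u′ :* v)) ≡.refl a b (u i) (u′ i) (v i)) ⟩
    sum (λ i → a * (u i * v i) + - b * (u′ i * v i))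
      ≡⟨ ∑-distrib-+ (λ i → a * (u i * v i)) (λ i → - b * (u′ i * v i)) ⟩
    sum (λ i → a * (u i * v i)) + sum (λ i → - b * (u′ i * v i))
      ≡⟨ cong₂ _+_ (*-distribˡ-sum a (λ i → u i * v i)) (*-distribˡ-sum (- b) (λ i → u′ i * v i)) ⟨
    a * (u ∙ v) + - b * (u′ ∙ v)
      ≡⟨ cong (λ s → a * (u ∙ v) + s) (ℚ.neg-distribˡ-* b (u′ ∙ v)) ⟨
    a * (u ∙ v) - b * (u′ ∙ v) ∎
    where
    open +-*-Solver
    open ≡-Reasoning

  *-cancel-0 : ∀ {p q} → p ≢ 0ℚ → p * q ≡ 0ℚ → q ≡ 0ℚ
  *-cancel-0 {p} {q} p≢0 pq≡0 = begin
    q                 ≡⟨ ℚ.*-identityˡ q ⟨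
    1ℚ * q            ≡⟨ cong (_* q) (ℚ.*-inverseˡ p) ⟨
    1/ p * p * q      ≡⟨ ℚ.*-assoc (1/ p) p q ⟩
    1/ p * (p * q)    ≡⟨ cong (1/ p *_) pq≡0 ⟩
    1/ p * 0ℚ         ≡⟨ ℚ.*-zeroʳ (1/ p) ⟩
    0ℚ                ∎
    where
    open ≡-Reasoning
    instance p-nonZero = ℚ.≢-nonZero p≢0

  -- Fraction-free elimination of the column of a pivot in the first row.
  kernel : ∀ m (A : Fin m → Vector ℚ (suc m)) →
           ∃[ v ] (∃[ i ] v i ≢ 0ℚ) × (∀ j → A j ∙ v ≡ 0ℚ)
  kernel zero    A = (λ _ → 1ℚ) , (zero , λ ()) , λ ()
  kernel (suc m) A with Fin.any? (λ p → ¬? (A zero p ℚ.≟ 0ℚ))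
  ... | no ∄p =
    let v , (i , vᵢ≢0) , Av≡0 = kernel m (λ j i → A (suc j) (suc i))
        A₀≡0 p = decidable-stable (A zero p ℚ.≟ 0ℚ) λ ≢0 → ∄p (p , ≢0)
        solves = λ where
          zero    → ≡.trans (sum-cong-≗ λ i → ≡.trans
                      (cong (_* (0ℚ Vector.∷ v) i) (A₀≡0 i)) (ℚ.*-zeroˡ ((0ℚ Vector.∷ v) i))) (sum-replicate-zero (suc (suc m)))
          (suc j) → ≡.trans (cong₂ _+_ (ℚ.*-zeroʳ (A (suc j) zero)) (Av≡0 j)) ≡.refl
    in 0ℚ Vector.∷ v , (suc i , vᵢ≢0) , solves
  ... | yes (p , a≢0) =
    let B j i          = a * A (suc j) (punchIn p i) - A (suc j) p * A zero (punchIn p i)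
        v , (i , vᵢ≢0) , Bv≡0 = kernel m B
        s              = (A zero ∘ punchIn p) ∙ v
        -- Back substitution without division: scaling the other entries by the pivot `a` lets the
        -- pivot entry be `- s`, and the first row then gives `a * - s + a * s`.
        w              = insertAt (λ i → a * v i) p (- s)
        expand : ∀ u → u ∙ w ≡ u p * - s + a * ((u ∘ punchIn p) ∙ v)
        expand u = ≡.trans (sum-remove {i = p} (λ i → u i * w i)) (cong₂ _+_
          (cong (u p *_) (Vector.insertAt-lookup (λ i → a * v i) p (- s)))
          (≡.trans (sum-cong-≗ λ i → cong (u (punchIn p i) *_) (Vector.insertAt-punchIn (λ i → a * v i) p (- s) i))
                 (∙-scaleʳ a (u ∘ punchIn p) v)))
        solves = λ where
          zero    → ≡.trans (expand (A zero))
                      (solve 2 (λ a s → a :* (:- s) :+ a :* s := con 0ℚ) ≡.refl a s)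
          (suc j) → ≡.trans (expand (A (suc j))) (≡.trans
                      (solve 4 (λ c s a t → c :* (:- s) :+ a :* t := a :* t :- c :* s) ≡.refl
                        (A (suc j) p) s a ((A (suc j) ∘ punchIn p) ∙ v))
                      (≡.trans (≡.sym (∙-linearˡ a (A (suc j) p) (A (suc j) ∘ punchIn p) (A zero ∘ punchIn p) v)) (Bv≡0 j)))
        wᵢ≢0 = λ eq → vᵢ≢0 (*-cancel-0 a≢0 (≡.trans (≡.sym (Vector.insertAt-punchIn (λ i → a * v i) p (- s) i)) eq))
    in w , (punchIn p i , wᵢ≢0) , solves
    where
    open +-*-Solver
    a = A zero p

  -- The matrix with columns `- w` and `A` has one more column than rows, hence a nonzero kernel
  -- vector `v`. Its first entry `s` cannot vanish, since injectivity of `A` would then kill the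
  -- rest; dividing the rest by `s` solves the system.
  injective⇒surjective : ∀ {d} (A : Fin d → Vector ℚ d) →
    (∀ v → (∀ j → A j ∙ v ≡ 0ℚ) → ∀ i → v i ≡ 0ℚ) →
    ∀ (w : Vector ℚ d) → ∃[ v ] ∀ j → A j ∙ v ≡ w j
  injective⇒surjective {d} A injective w = u , Au≡w
    where
    open +-*-Solver
    B : Fin d → Vector ℚ (suc d)
    B j = - w j Vector.∷ A j
    v = proj₁ (kernel d B)
    Bv≡0 = proj₂ (proj₂ (kernel d B))
    s = v zero
    s≢0 : s ≢ 0ℚ
    s≢0 s≡0 = proj₂ (proj₁ (proj₂ (kernel d B))) (v≡0 (proj₁ (proj₁ (proj₂ (kernel d B)))))
      where
      v≡0 : ∀ i → v i ≡ 0ℚ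
      v≡0 zero    = s≡0
      v≡0 (suc i) = injective (v ∘ suc) (λ j → ≡.trans
        (≡.trans (≡.sym (ℚ.+-identityˡ (A j ∙ (v ∘ suc)))) (cong (_+ A j ∙ (v ∘ suc))
          {0ℚ} {(- w j) * s} (≡.sym (≡.trans (cong (- w j *_) s≡0) (ℚ.*-zeroʳ (- w j)))))) (Bv≡0 j)) i
    instance
      s-nonZero : ℚ.NonZero s
      s-nonZero = ℚ.≢-nonZero s≢0
    u : Vector ℚ d
    u i = 1/ s * v (suc i)
    Au≡w : ∀ j → A j ∙ u ≡ w j
    Au≡w j = begin
      A j ∙ u                                            ≡⟨ ∙-scaleʳ (1/ s) (A j) (v ∘ suc) ⟩
      1/ s * x                                           ≡⟨ solve 4 (λ r s x w → r :* x := r :* ((:- w) :* s :+ x) :+ (r :* s) :* w) ≡.refl (1/ s) s x (w j) ⟩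
      1/ s * (- w j * s + x) + 1/ s * s * w j            ≡⟨ cong₂ _+_ {1/ s * (- w j * s + x)} {0ℚ} {1/ s * s * w j} {w j}
                                                            (≡.trans (cong (1/ s *_) (Bv≡0 j)) (ℚ.*-zeroʳ (1/ s)))
                                                            (≡.trans (cong (_* w j) {1/ s * s} {1ℚ} (ℚ.*-inverseˡ s)) (ℚ.*-identityˡ (w j))) ⟩
      0ℚ + w j                                           ≡⟨ ℚ.+-identityˡ (w j) ⟩
      w j ∎
      where
      open ≡-Reasoning
      x = A j ∙ (v ∘ suc)

module ℚ-Sum = SemiringSum (CommutativeRing.semiring ℚ.+-*-commutativeRing)

module _ {c ℓ} (M : CommutativeMonoid c ℓ) where

  open CommutativeMonoid M
  open CommutativeMonoidSum M

  sum-single : ∀ {n} (t : Vector Carrier n) i → (∀ j → j ≢ i → t j ≈ ε) → sum t ≈ t i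
  sum-single {suc n} t i t≈ε = begin
    sum t                         ≈⟨ sum-remove {i = i} t ⟩
    t i ∙ sum (t ∘ punchIn i)     ≈⟨ ∙-congˡ (sum-cong-≋ λ j → t≈ε (punchIn i j) (Fin.punchInᵢ≢i i j)) ⟩
    t i ∙ sum (Vector.replicate n ε)  ≈⟨ ∙-congˡ (sum-replicate-zero n) ⟩
    t i ∙ ε                       ≈⟨ identityʳ (t i) ⟩
    t i                           ∎
    where open SetoidReasoning setoid

module _ {c ℓ} (S : CommutativeRing c ℓ) where

  open CommutativeRing S hiding (zero)
  open SemiringSum semiring

  -- Used with the matrix of the σᵢ(bₖ), for which the entries σⱼ(bₖ*) form a right inverse.
  right-inverse-apply : ∀ {m n} (M : Fin m → Fin n → Carrier) (N : Fin n → Fin m → Carrier) →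
    (∀ i → sum (λ k → M i k * N k i) ≈ 1#) → (∀ {i j} → i ≢ j → sum (λ k → M i k * N k j) ≈ 0#) →
    ∀ (y : Vector Carrier m) i → sum (λ k → M i k * sum (λ j → N k j * y j)) ≈ y i
  right-inverse-apply M N diagonal off y i = begin
    sum (λ k → M i k * sum (λ j → N k j * y j))
      ≈⟨ sum-cong-≋ (λ k → trans (*-distribˡ-sum (M i k) (λ j → N k j * y j))
           (sum-cong-≋ λ j → sym (*-assoc (M i k) (N k j) (y j)))) ⟩
    sum (λ k → sum λ j → M i k * N k j * y j)
      ≈⟨ ∑-comm (λ k j → M i k * N k j * y j) ⟩
    sum (λ j → sum λ k → M i k * N k j * y j)
      ≈⟨ sum-cong-≋ (λ j → *-distribʳ-sum (y j) (λ k → M i k * N k j)) ⟨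
    sum (λ j → sum (λ k → M i k * N k j) * y j)
      ≈⟨ sum-single +-commutativeMonoid (λ j → sum (λ k → M i k * N k j) * y j) i
           (λ j j≢i → trans (*-congʳ (off (j≢i ∘ ≡.sym))) (zeroˡ (y j))) ⟩
    sum (λ k → M i k * N k i) * y i
      ≈⟨ trans (*-congʳ (diagonal i)) (*-identityˡ (y i)) ⟩
    y i ∎
    where open SetoidReasoning setoid

-- Finite extensions of ℚ: trace form, dual basis, separability idempotent

δ : ∀ {n} → Fin n → Fin n → ℚ
δ i j = if does (i Fin.≟ j) then 1ℚ else 0ℚ

δ-diagonal : ∀ {n} (i : Fin n) → δ i i ≡ 1ℚ
δ-diagonal i = cong (if_then 1ℚ else 0ℚ) (dec-true (i Fin.≟ i) ≡.refl)

δ-off-diagonal : ∀ {n} {i j : Fin n} → i ≢ j → δ i j ≡ 0ℚ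
δ-off-diagonal {i = i} {j} i≢j = cong (if_then 1ℚ else 0ℚ) (dec-false (i Fin.≟ j) i≢j)

-- The basis has `suc d` elements so that the degree, which is the trace of 1, is positive;
-- nondegeneracy of the trace form depends on this.
record FiniteExtension {c ℓ} (K : CommutativeRing c ℓ) (d : ℕ) : Set (c ⊔ ℓ) where
  open CommutativeRing K hiding (zero)
  open RingMorphisms ℚ.+-*-rawRing rawRing using (IsRingHomomorphism)
  open SemiringSum semiring using (sum)
  field
    rat       : ℚ → Carrier
    rat-homo  : IsRingHomomorphism rat
    basis     : Vector Carrier (suc d)

  combination : Vector ℚ (suc d) → Carrier
  combination q = sum λ i → rat (q i) * basis i

  field
    spanning    : ∀ x → ∃[ q ] x ≈ combination q
    independent : ∀ q → combination q ≈ 0# → ∀ i → q i ≡ 0ℚ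
    inverse     : ∀ {x} → ¬ x ≈ 0# → ∃[ y ] x * y ≈ 1#

module TraceForm {c ℓ} {K : CommutativeRing c ℓ} {d : ℕ} (F : FiniteExtension K d) where

  open CommutativeRing K hiding (zero)
  open FiniteExtension F
  open RingMorphisms ℚ.+-*-rawRing rawRing using (module IsRingHomomorphism)
  open IsRingHomomorphism rat-homo using (+-homo; *-homo; 0#-homo; 1#-homo)
  open SemiringSum semiring
  open CommutativeSemigroupProperties *-commutativeSemigroup using (x∙yz≈y∙xz)
  open RationalLinearAlgebra using (_∙_; injective⇒surjective)
  open SetoidReasoning setoid

  rat-cong : ∀ {p q} → p ≡ q → rat p ≈ rat q
  rat-cong p≡q = reflexive (cong rat p≡q)

  combination-cong : ∀ {p q} → (∀ i → p i ≡ q i) → combination p ≈ combination q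
  combination-cong p≗q = sum-cong-≋ λ i → *-congʳ {basis i} (rat-cong (p≗q i))

  combination-+ : ∀ p q → combination (λ i → p i ℚ.+ q i) ≈ combination p + combination q
  combination-+ p q = begin
    sum (λ i → rat (p i ℚ.+ q i) * basis i)
      ≈⟨ sum-cong-≋ (λ i → trans (*-congʳ (+-homo (p i) (q i))) (distribʳ (basis i) (rat (p i)) (rat (q i)))) ⟩
    sum (λ i → rat (p i) * basis i + rat (q i) * basis i)
      ≈⟨ ∑-distrib-+ (λ i → rat (p i) * basis i) (λ i → rat (q i) * basis i) ⟩
    combination p + combination q ∎

  combination-scale : ∀ a q → combination (λ i → a ℚ.* q i) ≈ rat a * combination q
  combination-scale a q = begin
    sum (λ i → rat (a ℚ.* q i) * basis i)
      ≈⟨ sum-cong-≋ (λ i → trans (*-congʳ (*-homo a (q i))) (*-assoc (rat a) (rat (q i)) (basis i))) ⟩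
    sum (λ i → rat a * (rat (q i) * basis i))
      ≈⟨ *-distribˡ-sum (rat a) (λ i → rat (q i) * basis i) ⟨
    rat a * combination q ∎

  combination-0 : combination (λ _ → 0ℚ) ≈ 0#
  combination-0 = trans (combination-scale 0ℚ (λ _ → 0ℚ)) (trans (*-congʳ 0#-homo) (zeroˡ _))

  combination-δ : ∀ i → combination (δ i) ≈ basis i
  combination-δ i = begin
    combination (δ i)    ≈⟨ sum-single +-commutativeMonoid (λ j → rat (δ i j) * basis j) i (λ j j≢i →
                             trans (*-congʳ (trans (rat-cong (δ-off-diagonal (j≢i ∘ ≡.sym))) 0#-homo)) (zeroˡ (basis j))) ⟩
    rat (δ i i) * basis i ≈⟨ *-congʳ (trans (rat-cong (δ-diagonal i)) 1#-homo) ⟩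
    1# * basis i         ≈⟨ *-identityˡ (basis i) ⟩
    basis i              ∎

  basis≉0 : ∀ i → ¬ basis i ≈ 0#
  basis≉0 i bᵢ≈0 = ℚ.1≢0 (≡.trans (≡.sym (δ-diagonal i)) (independent (δ i) (trans (combination-δ i) bᵢ≈0) i))

  combination-injective : ∀ p q → combination p ≈ combination q → ∀ i → p i ≡ q i
  combination-injective p q eq i = ≡.trans
    (solve 2 (λ p q → p := (p :+ con (ℚ.- 1ℚ) :* q) :+ q) ≡.refl (p i) (q i))
    (≡.trans (cong (ℚ._+ q i) (independent (λ i → p i ℚ.+ (ℚ.- 1ℚ) ℚ.* q i) vanishes i)) (ℚ.+-identityˡ (q i)))
    where
    open +-*-Solver
    vanishes : combination (λ i → p i ℚ.+ (ℚ.- 1ℚ) ℚ.* q i) ≈ 0#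
    vanishes = begin
      combination (λ i → p i ℚ.+ (ℚ.- 1ℚ) ℚ.* q i)                   ≈⟨ combination-+ p (λ i → (ℚ.- 1ℚ) ℚ.* q i) ⟩
      combination p + combination (λ i → (ℚ.- 1ℚ) ℚ.* q i)           ≈⟨ +-congʳ eq ⟩
      combination q + combination (λ i → (ℚ.- 1ℚ) ℚ.* q i)           ≈⟨ combination-+ q (λ i → (ℚ.- 1ℚ) ℚ.* q i) ⟨
      combination (λ i → q i ℚ.+ (ℚ.- 1ℚ) ℚ.* q i)
        ≈⟨ combination-cong (λ i → solve 1 (λ q → q :+ con (ℚ.- 1ℚ) :* q := con 0ℚ) ≡.refl (q i)) ⟩
      combination (λ _ → 0ℚ)                                         ≈⟨ combination-0 ⟩
      0#                                                             ∎

  coordinate : Carrier → Vector ℚ (suc d)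
  coordinate x = proj₁ (spanning x)

  -- The vector supplied by `spanning` is a priori an arbitrary choice. Independence pins it down,
  -- and this makes `coordinate` invariant under `≈` and ℚ-linear.
  coordinate-unique : ∀ {x q} → x ≈ combination q → ∀ i → coordinate x i ≡ q i
  coordinate-unique {x} {q} eq =
    combination-injective (coordinate x) q (trans (sym (proj₂ (spanning x))) eq)

  coordinate-cong : ∀ {x y} → x ≈ y → ∀ i → coordinate x i ≡ coordinate y i
  coordinate-cong {x} {y} eq = coordinate-unique (trans eq (proj₂ (spanning y)))

  coordinate-+ : ∀ x y i → coordinate (x + y) i ≡ coordinate x i ℚ.+ coordinate y i
  coordinate-+ x y = coordinate-unique (trans (+-cong (proj₂ (spanning x)) (proj₂ (spanning y)))
    (sym (combination-+ (coordinate x) (coordinate y))))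

  coordinate-scale : ∀ a x i → coordinate (rat a * x) i ≡ a ℚ.* coordinate x i
  coordinate-scale a x = coordinate-unique
    (trans (*-congˡ (proj₂ (spanning x))) (sym (combination-scale a (coordinate x))))

  -- The matrix trace of multiplication by `x`. Defined through coordinates and not as a sum of
  -- conjugates, it takes values in `ℚ`, where equality is decidable.
  Tr : Carrier → ℚ
  Tr x = ℚ-Sum.sum λ i → coordinate (x * basis i) i

  Tr-cong : ∀ {x y} → x ≈ y → Tr x ≡ Tr y
  Tr-cong x≈y = ℚ-Sum.sum-cong-≗ λ i → coordinate-cong (*-congʳ {basis i} x≈y) i

  Tr-+ : ∀ x y → Tr (x + y) ≡ Tr x ℚ.+ Tr y
  Tr-+ x y = ≡.trans
    (ℚ-Sum.sum-cong-≗ λ i → ≡.trans (coordinate-cong (distribʳ (basis i) x y) i)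
                                    (coordinate-+ (x * basis i) (y * basis i) i))
    (ℚ-Sum.∑-distrib-+ (λ i → coordinate (x * basis i) i) (λ i → coordinate (y * basis i) i))

  Tr-scale : ∀ a x → Tr (rat a * x) ≡ a ℚ.* Tr x
  Tr-scale a x = ≡.trans
    (ℚ-Sum.sum-cong-≗ λ i → ≡.trans (coordinate-cong (*-assoc (rat a) x (basis i)) i)
                                    (coordinate-scale a (x * basis i) i))
    (≡.sym (ℚ-Sum.*-distribˡ-sum a (λ i → coordinate (x * basis i) i)))

  Tr-0 : Tr 0# ≡ 0ℚ
  Tr-0 = ≡.trans (Tr-cong (sym (zeroʳ (rat 0ℚ)))) (≡.trans (Tr-scale 0ℚ 0#) (ℚ.*-zeroˡ (Tr 0#)))

  Tr-1≢0 : Tr 1# ≢ 0ℚ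
  Tr-1≢0 eq = ℚ.<-irrefl (≡.trans (≡.sym eq) (ℚ-Sum.sum-cong-≗ diagonal)) (positive d)
    where
    diagonal : ∀ i → coordinate (1# * basis i) i ≡ 1ℚ
    diagonal i = ≡.trans (coordinate-unique {q = δ i} (trans (*-identityˡ (basis i)) (sym (combination-δ i))) i) (δ-diagonal i)
    positive : ∀ n → 0ℚ ℚ.< ℚ-Sum.sum {suc n} (λ _ → 1ℚ)
    positive zero    = ℚ.positive⁻¹ _
    positive (suc n) = ℚ.+-mono-< {0ℚ} {1ℚ} (ℚ.positive⁻¹ 1ℚ) (positive n)

  Tr-sum : ∀ {n} (x : Vector Carrier n) → Tr (sum x) ≡ ℚ-Sum.sum (Tr ∘ x)
  Tr-sum {zero}  x = Tr-0
  Tr-sum {suc n} x = ≡.trans (Tr-+ (x zero) (sum (x ∘ suc))) (cong (Tr (x zero) ℚ.+_) (Tr-sum (x ∘ suc)))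

  Tr-combination : ∀ {n} x (q : Vector ℚ n) (y : Vector Carrier n) →
    Tr (x * sum λ i → rat (q i) * y i) ≡ (λ i → Tr (x * y i)) ∙ q
  Tr-combination x q y = ≡.trans
    (Tr-cong (*-distribˡ-sum x (λ i → rat (q i) * y i)))
    (≡.trans (Tr-sum (λ i → x * (rat (q i) * y i)))
      (ℚ-Sum.sum-cong-≗ λ i → ≡.trans (Tr-cong (x∙yz≈y∙xz x (rat (q i)) (y i)))
        (≡.trans (Tr-scale (q i) (x * y i)) (ℚ.*-comm (q i) (Tr (x * y i))))))

  -- If z ≠ 0 then Tr(z⁻¹ z) = d ≠ 0.
  nondegenerate : ∀ {z} → (∀ i → Tr (basis i * z) ≡ 0ℚ) → z ≈ 0#
  -- `≈` is not assumed decidable, so the case distinction is made on the rational coordinates of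
  -- `z`.
  nondegenerate {z} Tr≡0 with Fin.all? (λ i → coordinate z i ℚ.≟ 0ℚ)
  ... | yes ≡0 = trans (proj₂ (spanning z)) (trans (combination-cong ≡0) combination-0)
  ... | no ≢0  = ⊥-elim (Tr-1≢0 (Tr-1≡0 (inverse z≉0)))
    where
    z≉0 : ¬ z ≈ 0#
    z≉0 z≈0 = ≢0 (coordinate-unique (trans z≈0 (sym combination-0)))
    Tr-1≡0 : ∃[ y ] z * y ≈ 1# → Tr 1# ≡ 0ℚ
    Tr-1≡0 (y , zy≈1) = ≡.trans (Tr-cong (trans (sym zy≈1) (*-congˡ (proj₂ (spanning y)))))
      (≡.trans (Tr-combination z (coordinate y) basis)
        (≡.trans (ℚ-Sum.sum-cong-≗ λ i → ≡.trans
            (cong (ℚ._* coordinate y i) (≡.trans (Tr-cong (*-comm z (basis i))) (Tr≡0 i)))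
            (ℚ.*-zeroˡ (coordinate y i)))
          (ℚ-Sum.sum-replicate-zero (suc d))))

  Tr-injective : ∀ {x y} → (∀ i → Tr (basis i * x) ≡ Tr (basis i * y)) → x ≈ y
  Tr-injective {x} {y} eq = begin
    x                    ≈⟨ +-identityʳ x ⟨
    x + 0#               ≈⟨ +-congˡ (-‿inverseˡ y) ⟨
    x + (- y + y)        ≈⟨ +-assoc x (- y) y ⟨
    x + - y + y          ≈⟨ +-congʳ (nondegenerate vanishes) ⟩
    0# + y               ≈⟨ +-identityˡ y ⟩
    y                    ∎
    where
    vanishes : ∀ i → Tr (basis i * (x + - y)) ≡ 0ℚ
    vanishes i = ≡.trans (Tr-cong (distribˡ (basis i) x (- y))) (≡.trans (Tr-+ (basis i * x) (basis i * - y))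
      (≡.trans (cong (ℚ._+ Tr (basis i * - y)) (eq i)) (≡.trans (≡.sym (Tr-+ (basis i * y) (basis i * - y)))
        (≡.trans (Tr-cong (trans (sym (distribˡ (basis i) y (- y))) (trans (*-congˡ (-‿inverseʳ y)) (zeroʳ (basis i))))) Tr-0))))

  private
    gram : Fin (suc d) → Vector ℚ (suc d)
    gram i j = Tr (basis i * basis j)

    -- A kernel vector of the Gram matrix is the coordinate vector of an element orthogonal to the
    -- whole basis.
    gram-injective : ∀ v → (∀ i → gram i ∙ v ≡ 0ℚ) → ∀ i → v i ≡ 0ℚ
    gram-injective v eq = independent v
      (nondegenerate λ i → ≡.trans (Tr-combination (basis i) v basis) (eq i))

    dual-coordinates : ∀ k → ∃[ v ] ∀ i → gram i ∙ v ≡ δ k i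
    dual-coordinates k = injective⇒surjective gram gram-injective (δ k)

  dual : Vector Carrier (suc d)
  dual k = combination (proj₁ (dual-coordinates k))

  Tr-dual : ∀ i k → Tr (basis i * dual k) ≡ δ k i
  Tr-dual i k = ≡.trans (Tr-combination (basis i) (proj₁ (dual-coordinates k)) basis)
                        (proj₂ (dual-coordinates k) i)

  private
    δ-select : ∀ {n} (q : Vector ℚ n) k → δ k ∙ q ≡ q k
    δ-select q k = ≡.trans
      (sum-single ℚ.+-0-commutativeMonoid (λ i → δ k i ℚ.* q i) k
        (λ i i≢k → ≡.trans (cong (ℚ._* q i) (δ-off-diagonal (i≢k ∘ ≡.sym))) (ℚ.*-zeroˡ (q i))))
      (≡.trans (cong (ℚ._* q k) (δ-diagonal k)) (ℚ.*-identityˡ (q k)))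

  coordinate-dual : ∀ x k → coordinate x k ≡ Tr (x * dual k)
  coordinate-dual x k = ≡.sym (≡.trans
    (Tr-cong (trans (*-comm x (dual k)) (*-congˡ (proj₂ (spanning x)))))
    (≡.trans (Tr-combination (dual k) (coordinate x) basis)
      (≡.trans (ℚ-Sum.sum-cong-≗ λ i → cong (ℚ._* coordinate x i)
          (≡.trans (Tr-cong (*-comm (dual k) (basis i))) (Tr-dual i k)))
        (δ-select (coordinate x) k))))

  basis-expansion : ∀ x → x ≈ sum λ k → rat (Tr (x * dual k)) * basis k
  basis-expansion x = trans (proj₂ (spanning x)) (combination-cong (coordinate-dual x))

  -- That the dual elements span is obtained here: both sides have the same trace against every
  -- basis element, and the form is nondegenerate.
  dual-expansion : ∀ x → x ≈ sum λ k → rat (Tr (x * basis k)) * dual k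
  dual-expansion x = Tr-injective λ i → ≡.trans (Tr-cong (*-comm (basis i) x)) (≡.sym
    (≡.trans (Tr-combination (basis i) (λ k → Tr (x * basis k)) dual)
      (≡.trans (ℚ-Sum.sum-cong-≗ λ k → cong (ℚ._* Tr (x * basis k)) (≡.trans (Tr-dual i k) (δ-sym k i)))
        (δ-select (λ k → Tr (x * basis k)) i))))
    where
    δ-sym : ∀ {n} (i j : Fin n) → δ i j ≡ δ j i
    δ-sym i j with i Fin.≟ j
    ... | yes ≡.refl = ≡.sym (δ-diagonal i)
    ... | no i≢j     = ≡.sym (δ-off-diagonal (i≢j ∘ ≡.sym))

  -- Tr(y Σ bₖ bₖ*) = Σ Tr((y bₖ) bₖ*) is the sum of the k-th coordinates of y bₖ, that is, Tr y.
  Σ-basis-dual : sum (λ k → basis k * dual k) ≈ 1#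
  Σ-basis-dual = Tr-injective λ i → ≡.trans
    (Tr-cong (*-distribˡ-sum (basis i) (λ k → basis k * dual k)))
    (≡.trans (Tr-sum (λ k → basis i * (basis k * dual k)))
      (≡.trans (ℚ-Sum.sum-cong-≗ λ k → ≡.trans (Tr-cong (sym (*-assoc (basis i) (basis k) (dual k))))
                                               (≡.sym (coordinate-dual (basis i * basis k) k)))
        (Tr-cong (sym (*-identityʳ (basis i))))))

-- The image of the separability idempotent Σ bₖ ⊗ bₖ* of K ⊗ K under f ⊗ g.
module Separability
  {c ℓ c′ ℓ′} {K : CommutativeRing c ℓ} {d : ℕ} (F : FiniteExtension K d) (S : CommutativeRing c′ ℓ′)
  where

  private module K = CommutativeRing K
  open CommutativeRing S hiding (zero)
  open FiniteExtension F using (rat; basis)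
  open TraceForm F
  open RingMorphisms K.rawRing rawRing using (IsRingHomomorphism)
  open SemiringSum semiring
  private module K-Sum = SemiringSum K.semiring
  open CommutativeSemigroupProperties *-commutativeSemigroup using (x∙yz≈y∙xz)
  open SetoidReasoning setoid

  homo-sum : ∀ {f} → IsRingHomomorphism f → ∀ {n} (x : Vector K.Carrier n) →
             f (K-Sum.sum x) ≈ sum (f ∘ x)
  homo-sum f-homo {zero}  x = IsRingHomomorphism.0#-homo f-homo
  homo-sum f-homo {suc n} x = trans (IsRingHomomorphism.+-homo f-homo (x zero) (K-Sum.sum (x ∘ suc)))
                                    (+-congˡ (homo-sum f-homo (x ∘ suc)))

  idempotent : (f g : K.Carrier → Carrier) → Carrier
  idempotent f g = sum λ k → f (basis k) * g (dual k)

  idempotent-diagonal : ∀ {f} → IsRingHomomorphism f → idempotent f f ≈ 1#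
  idempotent-diagonal {f} f-homo = begin
    idempotent f f                          ≈⟨ sum-cong-≋ (λ k → *-homo (basis k) (dual k)) ⟨
    sum (λ k → f (basis k K.* dual k))      ≈⟨ homo-sum f-homo (λ k → basis k K.* dual k) ⟨
    f (K-Sum.sum λ k → basis k K.* dual k)  ≈⟨ ⟦⟧-cong Σ-basis-dual ⟩
    f K.1#                                  ≈⟨ 1#-homo ⟩
    1#                                      ∎
    where open IsRingHomomorphism f-homo

  module _ {f g} (f-homo : IsRingHomomorphism f) (g-homo : IsRingHomomorphism g)
           (f≈g : ∀ q → f (rat q) ≈ g (rat q)) where

    private
      module f = IsRingHomomorphism f-homo
      module g = IsRingHomomorphism g-homo

    -- This is (x ⊗ 1) e = (1 ⊗ x) e. Expand x bₖ in the basis, with coefficients Tr(x bₖ bⱼ*).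
    -- Being rational, they may be carried from the `f` side to the `g` side, where they are also
    -- the coefficients Tr(x bⱼ* bₖ) of x bⱼ* in the dual basis.
    idempotent-intertwines : ∀ x → f x * idempotent f g ≈ g x * idempotent f g
    idempotent-intertwines x = begin
      f x * idempotent f g
        ≈⟨ *-distribˡ-sum (f x) (λ k → f (basis k) * g (dual k)) ⟩
      sum (λ k → f x * (f (basis k) * g (dual k)))
        ≈⟨ sum-cong-≋ (λ k → trans (sym (*-assoc (f x) (f (basis k)) (g (dual k)))) (trans (*-congʳ (expandᶠ k))
             (*-distribʳ-sum (g (dual k)) (λ j → f (rat (Tr (x K.* basis k K.* dual j))) * f (basis j))))) ⟩
      sum (λ k → sum λ j → f (rat (Tr (x K.* basis k K.* dual j))) * f (basis j) * g (dual k))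
        ≈⟨ ∑-comm (λ k j → f (rat (Tr (x K.* basis k K.* dual j))) * f (basis j) * g (dual k)) ⟩
      sum (λ j → sum λ k → f (rat (Tr (x K.* basis k K.* dual j))) * f (basis j) * g (dual k))
        ≈⟨ sum-cong-≋ (λ j → sum-cong-≋ λ k → *-congʳ {g (dual k)} (*-congʳ {f (basis j)} (trans (f≈g (Tr (x K.* basis k K.* dual j)))
             (g.⟦⟧-cong (rat-cong (Tr-cong (K-comm.xy∙z≈xz∙y x (basis k) (dual j)))))))) ⟩
      sum (λ j → sum λ k → g (rat (Tr (x K.* dual j K.* basis k))) * f (basis j) * g (dual k))
        ≈⟨ sum-cong-≋ (λ j → sum-cong-≋ λ k →
             trans (*-congʳ (*-comm (g (rat (Tr (x K.* dual j K.* basis k)))) (f (basis j))))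
                   (*-assoc (f (basis j)) (g (rat (Tr (x K.* dual j K.* basis k)))) (g (dual k)))) ⟩
      sum (λ j → sum λ k → f (basis j) * (g (rat (Tr (x K.* dual j K.* basis k))) * g (dual k)))
        ≈⟨ sum-cong-≋ (λ j → trans (sym (*-distribˡ-sum (f (basis j)) (λ k → g (rat (Tr (x K.* dual j K.* basis k))) * g (dual k))))
             (trans (*-congˡ (sym (expandᵍ j))) (x∙yz≈y∙xz (f (basis j)) (g x) (g (dual j))))) ⟩
      sum (λ j → g x * (f (basis j) * g (dual j)))
        ≈⟨ *-distribˡ-sum (g x) (λ j → f (basis j) * g (dual j)) ⟨
      g x * idempotent f g ∎
      where
      module K-comm = CommutativeSemigroupProperties K.*-commutativeSemigroup
      expandᶠ : ∀ k → f x * f (basis k) ≈ sum λ j → f (rat (Tr (x K.* basis k K.* dual j))) * f (basis j)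
      expandᶠ k = trans (sym (f.*-homo x (basis k))) (trans (f.⟦⟧-cong (basis-expansion (x K.* basis k)))
        (trans (homo-sum f-homo (λ j → rat (Tr (x K.* basis k K.* dual j)) K.* basis j))
          (sum-cong-≋ λ j → f.*-homo (rat (Tr (x K.* basis k K.* dual j))) (basis j))))
      expandᵍ : ∀ j → g x * g (dual j) ≈ sum λ k → g (rat (Tr (x K.* dual j K.* basis k))) * g (dual k)
      expandᵍ j = trans (sym (g.*-homo x (dual j))) (trans (g.⟦⟧-cong (dual-expansion (x K.* dual j)))
        (trans (homo-sum g-homo (λ k → rat (Tr (x K.* dual j K.* basis k)) K.* dual k))
          (sum-cong-≋ λ k → g.*-homo (rat (Tr (x K.* dual j K.* basis k))) (dual k))))

    -- In front of a factor e, each g(bₖ*) may be replaced by f(bₖ*); the sum of the f(bₖ) f(bₖ*) is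
    -- 1.
    idempotent-idem : idempotent f g * idempotent f g ≈ idempotent f g
    idempotent-idem = begin
      E * E
        ≈⟨ *-distribʳ-sum E (λ k → f (basis k) * g (dual k)) ⟩
      sum (λ k → f (basis k) * g (dual k) * E)
        ≈⟨ sum-cong-≋ (λ k → trans (*-assoc (f (basis k)) (g (dual k)) E)
             (trans (*-congˡ (sym (idempotent-intertwines (dual k)))) (sym (*-assoc (f (basis k)) (f (dual k)) E)))) ⟩
      sum (λ k → f (basis k) * f (dual k) * E)
        ≈⟨ *-distribʳ-sum E (λ k → f (basis k) * f (dual k)) ⟨
      idempotent f f * E
        ≈⟨ *-congʳ (idempotent-diagonal f-homo) ⟩
      1# * E
        ≈⟨ *-identityˡ E ⟩
      E ∎
      where E = idempotent f g

-- Integral elements and multipliers of a lattice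

module IntegerCoefficients {c ℓ} (R : CommutativeRing c ℓ) (int : ℤ → CommutativeRing.Carrier R)
  (int-homo : RingMorphisms.IsRingHomomorphism ℤ.+-*-rawRing (CommutativeRing.rawRing R) int)
  where

  open CommutativeRing R hiding (zero)
  open RingMorphisms.IsRingHomomorphism int-homo public
    using () renaming (+-homo to int-+; *-homo to int-*; -‿homo to int-neg; 0#-homo to int-0; 1#-homo to int-1)

  int-morphism : ℤ.+-*-rawRing -Raw-AlmostCommutative⟶ fromCommutativeRing R
  int-morphism = record
    { ⟦_⟧ = int ; +-homo = int-+ ; *-homo = int-* ; -‿homo = int-neg ; 0-homo = int-0 ; 1-homo = int-1 }

  int-≟ : ∀ i j → Maybe (int i ≈ int j)
  int-≟ i j = Maybe.map (λ i≡j → reflexive (cong int i≡j)) (dec⇒maybe (i ℤ.≟ j))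

  module Solver = RingSolver ℤ.+-*-rawRing (fromCommutativeRing R) int-morphism int-≟

-- Fraction-free elimination on (θ I − A) v = 0 with A an integer matrix. As polynomials in θ, the
-- diagonal entries are monic of degree m and the others have degree < m; one step doubles m.
module IntegralElements {c ℓ} (R : CommutativeRing c ℓ) (int : ℤ → CommutativeRing.Carrier R)
  (int-homo : RingMorphisms.IsRingHomomorphism ℤ.+-*-rawRing (CommutativeRing.rawRing R) int)
  (θ : CommutativeRing.Carrier R)
  where

  open CommutativeRing R hiding (zero)
  open IntegerCoefficients R int int-homo
  open RawSemiringDefinitions (Semiring.rawSemiring semiring) using (_^_)
  open SemiringExp semiring using (^-homo-*)
  open SemiringSum semiring
  open SetoidReasoning setoid

  -- Evidence that a value is an integer polynomial in `θ` of degree below the index, in Horner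
  -- form. Values are known up to `≈` only, so the polynomial is kept as a witness and never
  -- compared.
  data LowDegree : ℕ → Carrier → Set (c ⊔ ℓ) where
    nil  : ∀ {y} → y ≈ 0# → LowDegree zero y
    cons : ∀ {m y y′} a → LowDegree m y′ → y ≈ int a + θ * y′ → LowDegree (suc m) y

  low-cong : ∀ {m x y} → y ≈ x → LowDegree m x → LowDegree m y
  low-cong y≈x (nil eq)      = nil (trans y≈x eq)
  low-cong y≈x (cons a p eq) = cons a p (trans y≈x eq)

  low-shift : ∀ {m y} → LowDegree m y → LowDegree (suc m) (θ * y)
  low-shift {y = y} p = cons 0ℤ p (trans (sym (+-identityˡ (θ * y))) (+-congʳ (sym int-0)))

  low-0 : ∀ m → LowDegree m 0#
  low-0 zero    = nil refl
  low-0 (suc m) = low-cong (sym (zeroʳ θ)) (low-shift (low-0 m))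

  low-int : ∀ m a → LowDegree (suc m) (int a)
  low-int m a = cons a (low-0 m) (trans (sym (+-identityʳ (int a))) (+-congˡ (sym (zeroʳ θ))))

  low-suc : ∀ {m y} → LowDegree m y → LowDegree (suc m) y
  low-suc (nil eq)      = low-cong eq (low-0 1)
  low-suc (cons a p eq) = cons a (low-suc p) eq

  low-+ : ∀ {m x y} → LowDegree m x → LowDegree m y → LowDegree m (x + y)
  low-+ (nil eq) (nil eq′) = nil (trans (+-cong eq eq′) (+-identityˡ 0#))
  low-+ (cons {y′ = x′} a p eq) (cons {y′ = y′} b q eq′) = cons (a ℤ.+ b) (low-+ p q)
    (trans (+-cong eq eq′) (trans
      (solve 5 (λ a b t x y → (a :+ t :* x) :+ (b :+ t :* y) := (a :+ b) :+ t :* (x :+ y)) refl (int a) (int b) θ x′ y′)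
      (+-congʳ (sym (int-+ a b)))))
    where open Solver

  low-scale : ∀ {m y} z → LowDegree m y → LowDegree m (int z * y)
  low-scale z (nil eq) = nil (trans (*-congˡ eq) (zeroʳ (int z)))
  low-scale z (cons {y′ = y′} a p eq) = cons (z ℤ.* a) (low-scale z p)
    (trans (*-congˡ eq) (trans
      (solve 4 (λ z a t y → z :* (a :+ t :* y) := z :* a :+ t :* (z :* y)) refl (int z) (int a) θ y′)
      (+-congʳ (sym (int-* z a)))))
    where open Solver

  low-neg : ∀ {m y} → LowDegree m y → LowDegree m (- y)
  low-neg {y = y} p = low-cong (solve 1 (λ y → :- y := con -1ℤ :* y) refl y) (low-scale -1ℤ p)
    where open Solver

  -- The sharp index would be one less; `m + n` avoids truncated subtraction and is exactly what an
  -- elimination step asks for.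
  low-* : ∀ {m n x y} → LowDegree m x → LowDegree n y → LowDegree (m ℕ.+ n) (x * y)
  low-* {n = n} {y = y} (nil eq) q = low-cong (trans (*-congʳ eq) (zeroˡ y)) (low-0 n)
  low-* {suc m} {n} {y = y} (cons {y′ = x′} a p eq) q = low-cong
    (trans (*-congʳ eq) (solve 4 (λ a t x y → (a :+ t :* x) :* y := a :* y :+ t :* (x :* y)) refl (int a) θ x′ y))
    (low-+ (weaken (suc m) (low-scale a q)) (low-shift (low-* p q)))
    where
    open Solver
    weaken : ∀ k {n y} → LowDegree n y → LowDegree (k ℕ.+ n) y
    weaken zero    p = p
    weaken (suc k) p = low-suc (weaken k p)

  low-^* : ∀ k {m y} → LowDegree m y → LowDegree (k ℕ.+ m) (θ ^ k * y)
  low-^* zero    {y = y} p = low-cong (*-identityˡ y) p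
  low-^* (suc k) {y = y} p = low-cong (*-assoc θ (θ ^ k) y) (low-shift (low-^* k p))

  Monic : ℕ → Carrier → Set (c ⊔ ℓ)
  Monic m y = ∃[ u ] LowDegree m u × y ≈ θ ^ m + u

  monic-*-low : ∀ {m x y} → Monic m x → LowDegree m y → LowDegree (m ℕ.+ m) (x * y)
  monic-*-low {m} {y = y} (u , p , eq) q = low-cong (trans (*-congʳ eq) (distribʳ y (θ ^ m) u))
    (low-+ (low-^* m q) (low-* p q))

  monic-* : ∀ {m x y} → Monic m x → Monic m y → Monic (m ℕ.+ m) (x * y)
  monic-* {m} {x} {y} x-monic@(u , p , eq) (v , q , eq′) =
    x * v + θ ^ m * u , low-+ (monic-*-low x-monic q) (low-^* m p) , (begin
      x * y                            ≈⟨ trans (*-congˡ eq′) (distribˡ x (θ ^ m) v) ⟩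
      x * θ ^ m + x * v                ≈⟨ +-congʳ (trans (*-congʳ eq) (distribʳ (θ ^ m) (θ ^ m) u)) ⟩
      θ ^ m * θ ^ m + u * θ ^ m + x * v ≈⟨ solve 4 (λ s t u x → s :+ u :* t :+ x := s :+ (x :+ t :* u)) refl (θ ^ m * θ ^ m) (θ ^ m) u (x * v) ⟩
      θ ^ m * θ ^ m + (x * v + θ ^ m * u) ≈⟨ +-congʳ (^-homo-* θ m m) ⟨
      θ ^ (m ℕ.+ m) + (x * v + θ ^ m * u) ∎)
    where open Solver

  monic-+-low : ∀ {m x y} → Monic m x → LowDegree m y → Monic m (x + y)
  monic-+-low {m} {y = y} (u , p , eq) q =
    u + y , low-+ p q , trans (+-congʳ eq) (+-assoc (θ ^ m) u y)

  -- The degree pattern survives a step: a new diagonal entry is monic times monic minus low times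
  -- low, a new off-diagonal entry is monic times low minus low times low. Working from the first
  -- row downward leaves one equation for the last unknown, hence `fromℕ n`.
  eliminate : ∀ n m (B : Fin (suc n) → Fin (suc n) → Carrier) (v : Vector Carrier (suc n)) →
    (∀ i → Monic m (B i i)) → (∀ {i j} → i ≢ j → LowDegree m (B i j)) →
    (∀ i → sum (λ j → B i j * v j) ≈ 0#) →
    ∃[ k ] Σ[ p ∈ Carrier ] Monic k p × p * v (fromℕ n) ≈ 0#
  eliminate zero    m B v diagonal off Bv≈0 =
    m , B zero zero , diagonal zero , trans (sym (+-identityʳ (B zero zero * v zero))) (Bv≈0 zero)
  eliminate (suc n) m B v diagonal off Bv≈0 = eliminate n (m ℕ.+ m) B′ (v ∘ suc)
    (λ i → monic-+-low (monic-* (diagonal zero) (diagonal (suc i))) (correction i i))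
    (λ i≢j → low-+ (monic-*-low (diagonal zero) (off (i≢j ∘ Fin.suc-injective))) (correction _ _))
    B′v≈0
    where
    open Solver
    B′ : Fin (suc n) → Fin (suc n) → Carrier
    B′ i j = B zero zero * B (suc i) (suc j) + - (B (suc i) zero * B zero (suc j))
    correction : ∀ i j → LowDegree (m ℕ.+ m) (- (B (suc i) zero * B zero (suc j)))
    correction i j = low-neg (low-* (off λ ()) (off λ ()))
    rest : Fin (suc (suc n)) → Carrier
    rest i = sum λ j → B i (suc j) * v (suc j)
    B′v≈0 : ∀ i → sum (λ j → B′ i j * v (suc j)) ≈ 0#
    B′v≈0 i = begin
      sum (λ j → (a * B (suc i) (suc j) + - (b * B zero (suc j))) * v (suc j))
        ≈⟨ sum-cong-≋ (λ j → solve 5 (λ a x b y v → (a :* x :- b :* y) :* v := a :* (x :* v) :+ (:- b) :* (y :* v)) refl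
             a (B (suc i) (suc j)) b (B zero (suc j)) (v (suc j))) ⟩
      sum (λ j → a * (B (suc i) (suc j) * v (suc j)) + - b * (B zero (suc j) * v (suc j)))
        ≈⟨ ∑-distrib-+ (λ j → a * (B (suc i) (suc j) * v (suc j))) (λ j → - b * (B zero (suc j) * v (suc j))) ⟩
      sum (λ j → a * (B (suc i) (suc j) * v (suc j))) + sum (λ j → - b * (B zero (suc j) * v (suc j)))
        ≈⟨ +-cong (*-distribˡ-sum a (λ j → B (suc i) (suc j) * v (suc j))) (*-distribˡ-sum (- b) (λ j → B zero (suc j) * v (suc j))) ⟨
      a * rest (suc i) + - b * rest zero
        ≈⟨ solve 5 (λ a b s r v → a :* s :+ (:- b) :* r := a :* (b :* v :+ s) :+ (:- b) :* (a :* v :+ r)) refl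
             a b (rest (suc i)) (rest zero) (v zero) ⟩
      a * (b * v zero + rest (suc i)) + - b * (a * v zero + rest zero)
        ≈⟨ +-cong (*-congˡ (Bv≈0 (suc i))) (*-congˡ (Bv≈0 zero)) ⟩
      a * 0# + - b * 0#
        ≈⟨ trans (+-cong (zeroʳ a) (zeroʳ (- b))) (+-identityˡ 0#) ⟩
      0# ∎
      where
      a = B zero zero
      b = B (suc i) zero

  -- Takes the place of the characteristic polynomial. As each elimination step doubles the degree,
  -- the one reached is 2ⁿ.
  eigenvalue-integral : ∀ {n} (A : Fin (suc n) → Fin (suc n) → ℤ) (v : Vector Carrier (suc n)) →
    (∀ i → θ * v i ≈ sum (λ j → int (A i j) * v j)) →
    ∃[ k ] Σ[ p ∈ Carrier ] Monic k p × p * v (fromℕ n) ≈ 0#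
  eigenvalue-integral {n} A v θv≈Av = eliminate n 1 B v diagonal off Bv≈0
    where
    open Solver
    θI : Fin (suc n) → Fin (suc n) → Carrier
    θI i j with i Fin.≟ j
    ... | yes _ = θ
    ... | no  _ = 0#
    B : Fin (suc n) → Fin (suc n) → Carrier
    B i j = θI i j + - int (A i j)
    θI-diagonal : ∀ i → θI i i ≈ θ
    θI-diagonal i with i Fin.≟ i
    ... | yes _  = refl
    ... | no i≢i = contradiction ≡.refl i≢i
    θI-off : ∀ {i j} → i ≢ j → θI i j ≈ 0#
    θI-off {i} {j} i≢j with i Fin.≟ j
    ... | yes i≡j = contradiction i≡j i≢j
    ... | no _    = refl
    entry : ∀ i j → LowDegree 1 (- int (A i j))
    entry i j = low-neg (low-int 0 (A i j))
    diagonal : ∀ i → Monic 1 (B i i)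
    diagonal i = - int (A i i) , entry i i , +-congʳ (trans (θI-diagonal i) (sym (*-identityʳ θ)))
    off : ∀ {i j} → i ≢ j → LowDegree 1 (B i j)
    off {i} {j} i≢j = low-cong (trans (+-congʳ (θI-off i≢j)) (+-identityˡ (- int (A i j)))) (entry i j)
    Bv≈0 : ∀ i → sum (λ j → B i j * v j) ≈ 0#
    Bv≈0 i = begin
      sum (λ j → (θI i j + - int (A i j)) * v j)
        ≈⟨ sum-cong-≋ (λ j → solve 3 (λ t a v → (t :- a) :* v := t :* v :+ (con -1ℤ) :* (a :* v)) refl (θI i j) (int (A i j)) (v j)) ⟩
      sum (λ j → θI i j * v j + int -1ℤ * (int (A i j) * v j))
        ≈⟨ ∑-distrib-+ (λ j → θI i j * v j) (λ j → int -1ℤ * (int (A i j) * v j)) ⟩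
      sum (λ j → θI i j * v j) + sum (λ j → int -1ℤ * (int (A i j) * v j))
        ≈⟨ +-cong (sum-single +-commutativeMonoid (λ j → θI i j * v j) i
                    (λ j j≢i → trans (*-congʳ (θI-off (j≢i ∘ ≡.sym))) (zeroˡ (v j))))
                  (sym (*-distribˡ-sum (int -1ℤ) (λ j → int (A i j) * v j))) ⟩
      θI i i * v i + int -1ℤ * sum (λ j → int (A i j) * v j)
        ≈⟨ +-cong (*-congʳ (θI-diagonal i)) (*-congˡ (sym (θv≈Av i))) ⟩
      θ * v i + int -1ℤ * (θ * v i)
        ≈⟨ solve 1 (λ x → x :+ con -1ℤ :* x := con 0ℤ) refl (θ * v i) ⟩
      int 0ℤ
        ≈⟨ int-0 ⟩
      0# ∎

  low-coefficients : ∀ {m y} → LowDegree m y →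
    Σ[ a ∈ Vector ℤ m ] y ≈ sum λ i → int (a i) * θ ^ toℕ i
  low-coefficients (nil eq) = (λ ()) , eq
  low-coefficients (cons {m} {y} {y′} a p eq) with low-coefficients p
  ... | b , eq′ = a Vector.∷ b , (begin
    y                                                 ≈⟨ eq ⟩
    int a + θ * y′                                    ≈⟨ +-cong (sym (*-identityʳ (int a))) (*-congˡ eq′) ⟩
    int a * 1# + θ * sum (λ i → int (b i) * θ ^ toℕ i)   ≈⟨ +-congˡ (*-distribˡ-sum θ (λ i → int (b i) * θ ^ toℕ i)) ⟩
    int a * 1# + sum (λ i → θ * (int (b i) * θ ^ toℕ i)) ≈⟨ +-congˡ (sum-cong-≋ λ i →
      solve 3 (λ t b p → t :* (b :* p) := b :* (t :* p)) refl θ (int (b i)) (θ ^ toℕ i)) ⟩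
    int a * 1# + sum (λ i → int (b i) * (θ * θ ^ toℕ i)) ∎)
    where open Solver

  monic-root : ∀ {k p x y} → Monic k p → p * x ≈ 0# → x * y ≈ 1# →
    Σ[ a ∈ Vector ℤ k ] θ ^ k + sum (λ i → int (a i) * θ ^ toℕ i) ≈ 0#
  monic-root {k} {p} {x} {y} (u , u-low , p≈) px≈0 xy≈1 with low-coefficients u-low
  ... | a , u≈ = a , (begin
    θ ^ k + sum (λ i → int (a i) * θ ^ toℕ i)  ≈⟨ +-congˡ u≈ ⟨
    θ ^ k + u      ≈⟨ p≈ ⟨
    p              ≈⟨ *-identityʳ p ⟨
    p * 1#         ≈⟨ *-congˡ xy≈1 ⟨
    p * (x * y)    ≈⟨ *-assoc p x y ⟨
    p * x * y      ≈⟨ *-congʳ px≈0 ⟩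
    0# * y         ≈⟨ zeroˡ y ⟩
    0#             ∎)

common-multiple : ∀ {ℓ n} (P : Fin n → ℕ → Set ℓ) → (∀ i D E → P i D → P i (E ℕ.* D)) →
  (∀ i → ∃[ D ] P i (suc D)) → ∃[ D ] ∀ i → P i (suc D)
common-multiple {n = zero}  P multiple p = 0 , λ ()
common-multiple {n = suc n} P multiple p with p zero | common-multiple (P ∘ suc) (multiple ∘ suc) (p ∘ suc)
-- The successor of this witness unfolds to `suc E * suc D`, the product of the two positive
-- multiples.
... | D , p₀ | E , pₛ = D ℕ.+ E ℕ.* suc D , λ where
  zero    → multiple zero (suc D) (suc E) p₀
  (suc i) → subst (P (suc i)) (ℕ.*-comm (suc D) (suc E)) (multiple (suc i) (suc E) (suc D) (pₛ i))

-- Multipliers are the elements that map the ℤ-span of b to itself.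
module MultiplierRing {c ℓ} (R : CommutativeRing c ℓ) (int : ℤ → CommutativeRing.Carrier R)
  (int-homo : RingMorphisms.IsRingHomomorphism ℤ.+-*-rawRing (CommutativeRing.rawRing R) int)
  {d} (b : Vector (CommutativeRing.Carrier R) (suc d))
  where

  open CommutativeRing R hiding (zero)
  open IntegerCoefficients R int int-homo
  open SemiringSum semiring
  open SetoidReasoning setoid

  Span : Carrier → Set ℓ
  Span x = Σ[ n ∈ Vector ℤ (suc d) ] x ≈ sum λ i → int (n i) * b i

  span-cong : ∀ {x y} → x ≈ y → Span y → Span x
  span-cong x≈y (n , y≈) = n , trans x≈y y≈

  span-+ : ∀ {x y} → Span x → Span y → Span (x + y)
  span-+ {x} {y} (m , x≈) (n , y≈) = (λ i → m i ℤ.+ n i) , (begin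
    x + y                                                   ≈⟨ +-cong x≈ y≈ ⟩
    sum (λ i → int (m i) * b i) + sum (λ i → int (n i) * b i) ≈⟨ ∑-distrib-+ (λ i → int (m i) * b i) (λ i → int (n i) * b i) ⟨
    sum (λ i → int (m i) * b i + int (n i) * b i)
      ≈⟨ sum-cong-≋ (λ i → trans (*-congʳ (int-+ (m i) (n i))) (distribʳ (b i) (int (m i)) (int (n i)))) ⟨
    sum (λ i → int (m i ℤ.+ n i) * b i)                     ∎)

  span-scale : ∀ z {x} → Span x → Span (int z * x)
  span-scale z {x} (n , x≈) = (λ i → z ℤ.* n i) , (begin
    int z * x                                ≈⟨ *-congˡ x≈ ⟩
    int z * sum (λ i → int (n i) * b i)      ≈⟨ *-distribˡ-sum (int z) (λ i → int (n i) * b i) ⟩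
    sum (λ i → int z * (int (n i) * b i))
      ≈⟨ sum-cong-≋ (λ i → trans (*-congʳ (int-* z (n i))) (*-assoc (int z) (int (n i)) (b i))) ⟨
    sum (λ i → int (z ℤ.* n i) * b i)        ∎)

  span-0 : Span 0#
  span-0 = (λ _ → 0ℤ) , sym (trans
    (sum-cong-≋ λ i → trans (*-congʳ int-0) (zeroˡ (b i)))
    (sum-replicate-zero (suc d)))

  span-sum : ∀ {n} {x : Vector Carrier n} → (∀ i → Span (x i)) → Span (sum x)
  span-sum {zero}  p = span-0
  span-sum {suc n} p = span-+ (p zero) (span-sum (p ∘ suc))

  span-basis : ∀ i → Span (b i)
  span-basis i = indicator , (begin
    b i                                ≈⟨ *-identityˡ (b i) ⟨
    1# * b i                           ≈⟨ *-congʳ indicator-diagonal ⟨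
    int (indicator i) * b i
      ≈⟨ sum-single +-commutativeMonoid (λ j → int (indicator j) * b j) i
           (λ j j≢i → trans (*-congʳ (indicator-off j≢i)) (zeroˡ (b j))) ⟨
    sum (λ j → int (indicator j) * b j) ∎)
    where
    indicator : Vector ℤ (suc d)
    indicator j with j Fin.≟ i
    ... | yes _ = 1ℤ
    ... | no  _ = 0ℤ
    indicator-diagonal : int (indicator i) ≈ 1#
    indicator-diagonal with i Fin.≟ i
    ... | yes _  = int-1
    ... | no i≢i = contradiction ≡.refl i≢i
    indicator-off : ∀ {j} → j ≢ i → int (indicator j) ≈ 0#
    indicator-off {j} j≢i with j Fin.≟ i
    ... | yes j≡i = contradiction j≡i j≢i
    ... | no _    = int-0

  Multiplier : Carrier → Set ℓ
  Multiplier x = ∀ j → Span (x * b j)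

  multiplier-cong : ∀ {x y} → x ≈ y → Multiplier y → Multiplier x
  multiplier-cong x≈y p j = span-cong (*-congʳ x≈y) (p j)

  multiplier-+ : ∀ {x y} → Multiplier x → Multiplier y → Multiplier (x + y)
  multiplier-+ {x} {y} p q j = span-cong (distribʳ (b j) x y) (span-+ (p j) (q j))

  multiplier-scale : ∀ z {x} → Multiplier x → Multiplier (int z * x)
  multiplier-scale z {x} p j = span-cong (*-assoc (int z) x (b j)) (span-scale z (p j))

  multiplier-neg : ∀ {x} → Multiplier x → Multiplier (- x)
  multiplier-neg {x} p = multiplier-cong (solve 1 (λ x → :- x := con -1ℤ :* x) refl x) (multiplier-scale -1ℤ p)
    where open Solver

  multiplier-sum : ∀ {n} {x : Vector Carrier n} → (∀ i → Multiplier (x i)) → Multiplier (sum x)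
  multiplier-sum {x = x} p j = span-cong (*-distribʳ-sum (b j) x) (span-sum λ i → p i j)

  multiplier-span : ∀ {x y} → Multiplier x → Span y → Span (x * y)
  multiplier-span {x} {y} p (n , y≈) = span-cong
    (begin
      x * y                                ≈⟨ *-congˡ y≈ ⟩
      x * sum (λ i → int (n i) * b i)      ≈⟨ *-distribˡ-sum x (λ i → int (n i) * b i) ⟩
      sum (λ i → x * (int (n i) * b i))
        ≈⟨ sum-cong-≋ (λ i → solve 3 (λ x n b → x :* (n :* b) := n :* (x :* b)) refl x (int (n i)) (b i)) ⟩
      sum (λ i → int (n i) * (x * b i))    ∎)
    (span-sum λ i → span-scale (n i) (p i))
    where open Solver

  -- Multipliers compose as endomorphisms of the span. This closure stands in for the theorem that
  -- products of algebraic integers are algebraic integers.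
  multiplier-* : ∀ {x y} → Multiplier x → Multiplier y → Multiplier (x * y)
  multiplier-* {x} {y} p q j = span-cong (*-assoc x y (b j)) (multiplier-span p (q j))

open import Defs
open Estimates

module _ {c₁ ℓ₁ c₂ ℓ₂} (A : RawRing c₁ ℓ₁) (B : RawRing c₂ ℓ₂) where

  private
    module A = RawRing A
    module B = RawRing B

  mkRingHomomorphism : {f : A.Carrier → B.Carrier} →
    (∀ {x y} → x A.≈ y → f x B.≈ f y) →
    (∀ x y → f (x A.+ y) B.≈ (f x B.+ f y)) → (∀ x y → f (x A.* y) B.≈ (f x B.* f y)) →
    (∀ x → f (A.- x) B.≈ (B.- f x)) → f A.0# B.≈ B.0# → f A.1# B.≈ B.1# →
    RingMorphisms.IsRingHomomorphism A B f
  mkRingHomomorphism f-cong f-+ f-* f-neg f-0 f-1 = record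
    { isSemiringHomomorphism = record
      { isNearSemiringHomomorphism = record
        { +-isMonoidHomomorphism = record
          { isMagmaHomomorphism = record { isRelHomomorphism = record { cong = f-cong } ; homo = f-+ }
          ; ε-homo = f-0
          }
        ; *-homo = f-*
        }
      ; 1#-homo = f-1
      }
    ; -‿homo = f-neg
    }

-- Rational arithmetic

fromℤ-/1 : ∀ n → n ℚ./ 1 ≡ fromℤ n
fromℤ-/1 n = ℚ.↥p/↧p≡p (fromℤ n)

fromℤ-+ : ∀ m n → fromℤ (m ℤ.+ n) ≡ fromℤ m ℚ.+ fromℤ n
fromℤ-+ m n = ≡.trans (≡.sym (fromℤ-/1 (m ℤ.+ n)))
  (cong₂ (λ i j → (i ℤ.+ j) ℚ./ 1) (≡.sym (ℤ.*-identityʳ m)) (≡.sym (ℤ.*-identityʳ n)))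

fromℤ-* : ∀ m n → fromℤ (m ℤ.* n) ≡ fromℤ m ℚ.* fromℤ n
fromℤ-* m n = ≡.sym (fromℤ-/1 (m ℤ.* n))

fromℤ-neg : ∀ n → fromℤ (ℤ.- n) ≡ ℚ.- fromℤ n
fromℤ-neg (+ zero)      = ≡.refl
fromℤ-neg (+ suc n)     = ≡.refl
fromℤ-neg (ℤ.-[1+ n ])  = ≡.refl

floor-bounds : ∀ p → ∃[ n ] fromℤ n ℚ.≤ p × p ℚ.≤ fromℤ n ℚ.+ 1ℚ
floor-bounds p@(mkℚ n d-1 _) = z , ℚ.*≤* below , subst (p ℚ.≤_) (fromℤ-+ z 1ℤ) (ℚ.*≤* above)
  where
  d = + suc d-1
  z = n ℤ./ d
  r = n ℤ.% d
  n≡ : n ≡ + r ℤ.+ z ℤ.* d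
  n≡ = ℤ.a≡a%n+[a/n]*n n d
  below : z ℤ.* d ℤ.≤ n ℤ.* 1ℤ
  below = subst (z ℤ.* d ℤ.≤_) (≡.sym (≡.trans (ℤ.*-identityʳ n) n≡)) (ℤ.i≤j+i (z ℤ.* d) (+ r))
  above : n ℤ.* 1ℤ ℤ.≤ (z ℤ.+ 1ℤ) ℤ.* d
  above = subst₂ ℤ._≤_ (≡.sym (≡.trans (ℤ.*-identityʳ n) n≡))
    (≡.trans (cong (ℤ._+ z ℤ.* d) (≡.sym (ℤ.*-identityˡ d)))
      (≡.trans (≡.sym (ℤ.*-distribʳ-+ d 1ℤ z)) (cong (ℤ._* d) (ℤ.+-comm 1ℤ z))))
    (ℤ.+-monoˡ-≤ (z ℤ.* d) (ℤ.+≤+ (ℕ.<⇒≤ (ℤ.n%d<d n d))))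

∣∣≤-intro : ∀ {p q} → p ℚ.≤ q → ℚ.- p ℚ.≤ q → ℚ.∣ p ∣ ℚ.≤ q
∣∣≤-intro {p} {q} p≤q -p≤q with ℚ.∣p∣≡p∨∣p∣≡-p p
... | inj₁ eq = subst (ℚ._≤ q) (≡.sym eq) p≤q
... | inj₂ eq = subst (ℚ._≤ q) (≡.sym eq) -p≤q

-p≤∣p∣ : ∀ p → ℚ.- p ℚ.≤ ℚ.∣ p ∣
-p≤∣p∣ p = subst (ℚ.- p ℚ.≤_) (ℚ.∣-p∣≡∣p∣ p) (p≤∣p∣ (ℚ.- p))

∣p-q∣≡∣q-p∣ : ∀ p q → ℚ.∣ p ℚ.- q ∣ ≡ ℚ.∣ q ℚ.- p ∣
∣p-q∣≡∣q-p∣ p q = ≡.trans (cong ℚ.∣_∣ (solve 2 (λ p q → p :- q := :- (q :- p)) ≡.refl p q)) (ℚ.∣-p∣≡∣p∣ (q ℚ.- p))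
  where open +-*-Solver

∣p-r∣≤ : ∀ p q r → ℚ.∣ p ℚ.- r ∣ ℚ.≤ ℚ.∣ p ℚ.- q ∣ ℚ.+ ℚ.∣ q ℚ.- r ∣
∣p-r∣≤ p q r = subst (λ s → ℚ.∣ s ∣ ℚ.≤ ℚ.∣ p ℚ.- q ∣ ℚ.+ ℚ.∣ q ℚ.- r ∣)
  (solve 3 (λ p q r → (p :- q) :+ (q :- r) := p :- r) ≡.refl p q r)
  (ℚ.∣p+q∣≤∣p∣+∣q∣ (p ℚ.- q) (q ℚ.- r))
  where open +-*-Solver

-- Eventual properties of sequences

Eventually : (ℕ → Set) → Set
Eventually P = ∃[ N ] ∀ n → N ℕ.≤ n → P n

module _ {P Q : ℕ → Set} where

  eventually-map : (∀ n → P n → Q n) → Eventually P → Eventually Q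
  eventually-map f (N , p) = N , λ n N≤n → f n (p n N≤n)

  eventually-zip : {R : ℕ → Set} → (∀ n → P n → Q n → R n) → Eventually P → Eventually Q → Eventually R
  eventually-zip f (M , p) (N , q) = M ℕ.⊔ N , λ n ≤n →
    f n (p n (ℕ.m⊔n≤o⇒m≤o M N ≤n)) (q n (ℕ.m⊔n≤o⇒n≤o M N ≤n))

eventually-witness : {P : Set} → Eventually (λ _ → P) → P
eventually-witness (N , p) = p N ℕ.≤-refl

-- The ring of real numbers

infix 4 _≈_

-- A record, unlike _≃_, lets Agda infer x and y from a proof of x ≈ y.
record _≈_ (x y : ℝ) : Set where
  constructor ⌊_⌋
  field ⌈_⌉ : x ≃ y

open _≈_ public

pointwise : ∀ {x y} → (∀ n → seq x n ≡ seq y n) → x ≈ y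
pointwise {x} {y} x≗y = ⌊ (λ ε 0<ε → 0 , λ n _ → subst (ℚ._< ε)
  (≡.sym (cong ℚ.∣_∣ (≡.trans (cong (ℚ._- seq y n) (x≗y n)) (ℚ.+-inverseʳ (seq y n))))) 0<ε) ⌋

≈-sym : ∀ {x y} → x ≈ y → y ≈ x
≈-sym {x} {y} ⌊ x≃y ⌋ = ⌊ (λ ε 0<ε → eventually-map
  (λ n → subst (ℚ._< ε) (∣p-q∣≡∣q-p∣ (seq x n) (seq y n))) (x≃y ε 0<ε)) ⌋

≈-trans : ∀ {x y z} → x ≈ y → y ≈ z → x ≈ z
≈-trans {x} {y} {z} ⌊ x≃y ⌋ ⌊ y≃z ⌋ = ⌊ (λ ε 0<ε → eventually-zip
  (λ n p q → subst (ℚ.∣ seq x n ℚ.- seq z n ∣ ℚ.<_) (½+½ ε)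
    (ℚ.≤-<-trans (∣p-r∣≤ (seq x n) (seq y n) (seq z n)) (ℚ.+-mono-< p q)))
  (x≃y (½ ℚ.* ε) (0<½* 0<ε)) (y≃z (½ ℚ.* ε) (0<½* 0<ε))) ⌋

≈-isEquivalence : IsEquivalence _≈_
≈-isEquivalence = record { refl = pointwise (λ _ → ≡.refl) ; sym = ≈-sym ; trans = ≈-trans }

-- A bound on the late terms of the representing sequence, not on the real number: it passes to an
-- equal real only at the price of some `δ > 0`, see `bounded-cong`.
Bounded : ℚ → ℝ → Set
Bounded b x = Eventually λ n → ℚ.∣ seq x n ∣ ℚ.≤ b

≈-+-cong : ∀ {x x′ y y′} → x ≈ x′ → y ≈ y′ → x + y ≈ x′ + y′
≈-+-cong {x} {x′} {y} {y′} ⌊ x≃x′ ⌋ ⌊ y≃y′ ⌋ = ⌊ (λ ε 0<ε → eventually-zip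
  (λ n p q → subst₂ ℚ._<_ (cong ℚ.∣_∣ (regroup (seq x n) (seq y n) (seq x′ n) (seq y′ n))) (½+½ ε)
    (ℚ.≤-<-trans (ℚ.∣p+q∣≤∣p∣+∣q∣ (seq x n ℚ.- seq x′ n) (seq y n ℚ.- seq y′ n)) (ℚ.+-mono-< p q)))
  (x≃x′ (½ ℚ.* ε) (0<½* 0<ε)) (y≃y′ (½ ℚ.* ε) (0<½* 0<ε))) ⌋
  where
  open +-*-Solver
  regroup : ∀ a b c d → (a ℚ.- c) ℚ.+ (b ℚ.- d) ≡ (a ℚ.+ b) ℚ.- (c ℚ.+ d)
  regroup = solve 4 (λ a b c d → (a :- c) :+ (b :- d) := (a :+ b) :- (c :+ d)) ≡.refl

≈-neg-cong : ∀ {x y} → x ≈ y → - x ≈ - y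
≈-neg-cong {x} {y} ⌊ x≃y ⌋ = ⌊ (λ ε 0<ε → eventually-map
  (λ n → subst (ℚ._< ε) (≡.trans (≡.sym (ℚ.∣-p∣≡∣p∣ (seq x n ℚ.- seq y n)))
    (cong ℚ.∣_∣ (ℚ.neg-distrib-+ (seq x n) (ℚ.- seq y n))))) (x≃y ε 0<ε)) ⌋

≈-*-congʳ : ∀ {x x′} y → x ≈ x′ → x * y ≈ x′ * y
≈-*-congʳ {x} {x′} y ⌊ x≃x′ ⌋ = ⌊ (λ ε 0<ε → eventually-zip
  (λ n → estimate ε (seq y n) (seq x n) (seq x′ n))
  y-bounded (x≃x′ (scale b ε 0<b) (scale-pos {b} {ε} 0<b 0<ε))) ⌋
  where
  open +-*-Solver
  b         = proj₁ (eventually-bounded y)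
  0<b       = proj₁ (proj₂ (eventually-bounded y))
  y-bounded = proj₂ (proj₂ (eventually-bounded y))
  regroup : ∀ r p q → r ℚ.* (p ℚ.- q) ≡ p ℚ.* r ℚ.- q ℚ.* r
  regroup = solve 3 (λ r p q → r :* (p :- q) := p :* r :- q :* r) ≡.refl
  estimate : ∀ ε r p q → ℚ.∣ r ∣ ℚ.≤ b → ℚ.∣ p ℚ.- q ∣ ℚ.< scale b ε 0<b → ℚ.∣ p ℚ.* r ℚ.- q ℚ.* r ∣ ℚ.< ε
  estimate ε r p q r≤b p-q< = subst₂ ℚ._<_
    (≡.trans (≡.sym (ℚ.∣p*q∣≡∣p∣*∣q∣ r (p ℚ.- q))) (cong ℚ.∣_∣ (regroup r p q)))
    (scale-* {b} {ε} 0<b)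
    (ℚ.≤-<-trans (ℚ.*-monoʳ-≤-nonNeg ℚ.∣ p ℚ.- q ∣ {{ℚ.∣-∣-nonNeg (p ℚ.- q)}} r≤b)
                 (ℚ.*-monoʳ-<-pos b {{ℚ.positive 0<b}} p-q<))

≈-*-comm : ∀ x y → x * y ≈ y * x
≈-*-comm x y = pointwise λ n → ℚ.*-comm (seq x n) (seq y n)

≈-*-cong : ∀ {x x′ y y′} → x ≈ x′ → y ≈ y′ → x * y ≈ x′ * y′
≈-*-cong {x} {x′} {y} {y′} p q =
  ≈-trans {x * y} {x′ * y} {x′ * y′} (≈-*-congʳ {x} {x′} y p)
    (≈-trans {x′ * y} {y * x′} {x′ * y′} (≈-*-comm x′ y)
      (≈-trans {y * x′} {y′ * x′} {x′ * y′} (≈-*-congʳ {y} {y′} x′ q) (≈-*-comm y′ x′)))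

Defs-isCommutativeRing : IsCommutativeRing _≈_ _+_ _*_ -_ 0ℝ 1ℝ
Defs-isCommutativeRing = record
  { isRing = record
    { +-isAbelianGroup = record
      { isGroup = record
        { isMonoid = record
          { isSemigroup = record
            { isMagma = record { isEquivalence = ≈-isEquivalence ; ∙-cong = ≈-+-cong }
            ; assoc   = λ x y z → pointwise λ n → ℚ.+-assoc (seq x n) (seq y n) (seq z n)
            }
          ; identity = (λ x → pointwise λ n → ℚ.+-identityˡ (seq x n))
                     , (λ x → pointwise λ n → ℚ.+-identityʳ (seq x n))
          }
        ; inverse = (λ x → pointwise λ n → ℚ.+-inverseˡ (seq x n))
                  , (λ x → pointwise λ n → ℚ.+-inverseʳ (seq x n))
        ; ⁻¹-cong = ≈-neg-cong
        }
      ; comm = λ x y → pointwise λ n → ℚ.+-comm (seq x n) (seq y n)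
      }
    ; *-cong     = ≈-*-cong
    ; *-assoc    = λ x y z → pointwise λ n → ℚ.*-assoc (seq x n) (seq y n) (seq z n)
    ; *-identity = (λ x → pointwise λ n → ℚ.*-identityˡ (seq x n))
                 , (λ x → pointwise λ n → ℚ.*-identityʳ (seq x n))
    ; distrib    = (λ x y z → pointwise λ n → ℚ.*-distribˡ-+ (seq x n) (seq y n) (seq z n))
                 , (λ x y z → pointwise λ n → ℚ.*-distribʳ-+ (seq x n) (seq y n) (seq z n))
    }
  ; *-comm = ≈-*-comm
  }

bounded-mono : ∀ {p q x} → p ℚ.≤ q → Bounded p x → Bounded q x
bounded-mono p≤q = eventually-map λ n ≤p → ℚ.≤-trans ≤p p≤q

bounded-+ : ∀ {p q x y} → Bounded p x → Bounded q y → Bounded (p ℚ.+ q) (x + y)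
bounded-+ {x = x} {y} = eventually-zip λ n ≤p ≤q →
  ℚ.≤-trans (ℚ.∣p+q∣≤∣p∣+∣q∣ (seq x n) (seq y n)) (ℚ.+-mono-≤ ≤p ≤q)

bounded-neg : ∀ {p x} → Bounded p x → Bounded p (- x)
bounded-neg {p} {x} = eventually-map λ n → subst (ℚ._≤ p) (≡.sym (ℚ.∣-p∣≡∣p∣ (seq x n)))

bounded-* : ∀ {p q x y} → Bounded p x → Bounded q y → Bounded (p ℚ.* q) (x * y)
bounded-* {p} {q} {x} {y} = eventually-zip λ n ≤p ≤q →
  subst (ℚ._≤ p ℚ.* q) (≡.sym (ℚ.∣p*q∣≡∣p∣*∣q∣ (seq x n) (seq y n)))
    (*-mono-≤ {ℚ.∣ seq x n ∣} {p} {ℚ.∣ seq y n ∣} {q}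
      (ℚ.0≤∣p∣ (seq x n)) (ℚ.≤-trans (ℚ.0≤∣p∣ (seq y n)) ≤q) ≤p ≤q)

bounded-cong : ∀ {p δ x y} → 0ℚ ℚ.< δ → x ≈ y → Bounded p x → Bounded (p ℚ.+ δ) y
bounded-cong {p} {δ} {x} {y} 0<δ ⌊ x≃y ⌋ = eventually-zip
  (λ n <δ ≤p → subst (λ q → ℚ.∣ q ∣ ℚ.≤ p ℚ.+ δ) (regroup (seq x n) (seq y n))
    (ℚ.≤-trans (ℚ.∣p-q∣≤∣p∣+∣q∣ (seq x n) (seq x n ℚ.- seq y n)) (ℚ.+-mono-≤ ≤p (ℚ.<⇒≤ <δ))))
  (x≃y δ 0<δ)
  where
  open +-*-Solver
  regroup : ∀ p q → p ℚ.- (p ℚ.- q) ≡ q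
  regroup = solve 2 (λ p q → p :- (p :- q) := q) ≡.refl

approximate-Defs : ∀ x δ → 0ℚ ℚ.< δ → ∃[ q ] Bounded δ (x - fromℚ q)
approximate-Defs x δ 0<δ with cauchy x δ 0<δ
... | N , close = seq x N , N , λ n N≤n → ℚ.<⇒≤ (close n N N≤n ℕ.≤-refl)

-- The floor of a real is not computable, so a rational `δ`-approximation is rounded instead; the
-- floor then accounts for `D` in the error.
round-Defs : ∀ x D δ → 0ℚ ℚ.< D → 0ℚ ℚ.< δ → ∃[ n ] Bounded (D ℚ.+ δ) (x - fromℚ (D ℚ.* fromℤ n))
round-Defs x D δ 0<D 0<δ with approximate-Defs x δ 0<δ
... | q , close with floor-bounds (scale D q 0<D)
... | n , n≤p , p≤n+1 = n , eventually-map
  (λ k ≤1 → ℚ.≤-trans (∣p-r∣≤ (seq x k) q (D ℚ.* fromℤ n))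
    (subst (ℚ.∣ seq x k ℚ.- q ∣ ℚ.+ ℚ.∣ q ℚ.- D ℚ.* fromℤ n ∣ ℚ.≤_) (ℚ.+-comm δ D)
      (ℚ.+-mono-≤ ≤1 (∣∣≤-intro upper lower)))) close
  where
  open +-*-Solver
  p = scale D q 0<D
  instance
    D-pos : ℚ.NonNegative D
    D-pos = ℚ.nonNegative (ℚ.<⇒≤ 0<D)
  upper : q ℚ.- D ℚ.* fromℤ n ℚ.≤ D
  upper = subst₂ ℚ._≤_ (cong (ℚ._- D ℚ.* fromℤ n) (scale-* {D} {q} 0<D))
    (solve 2 (λ D n → D :* (n :+ con 1ℚ) :- D :* n := D) ≡.refl D (fromℤ n))
    (ℚ.+-monoˡ-≤ (ℚ.- (D ℚ.* fromℤ n)) (ℚ.*-monoˡ-≤-nonNeg D p≤n+1))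
  lower : ℚ.- (q ℚ.- D ℚ.* fromℤ n) ℚ.≤ D
  lower = subst (ℚ._≤ D) (solve 2 (λ q n → n :- q := :- (q :- n)) ≡.refl q (D ℚ.* fromℤ n))
    (ℚ.≤-trans (subst (D ℚ.* fromℤ n ℚ.- q ℚ.≤_)
      (≡.trans (cong (ℚ._- q) (scale-* {D} {q} 0<D)) (ℚ.+-inverseʳ q))
      (ℚ.+-monoˡ-≤ (ℚ.- q) (ℚ.*-monoˡ-≤-nonNeg D n≤p))) (ℚ.<⇒≤ 0<D))

*-cancel-≈0-Defs : ∀ {x y δ} → 0ℚ ℚ.< δ → Eventually (λ n → δ ℚ.≤ seq x n) → x * y ≈ 0ℝ → y ≈ 0ℝ
*-cancel-≈0-Defs {x} {y} {δ} 0<δ x≥δ ⌊ xy≃0 ⌋ = ⌊ (λ ε 0<ε → eventually-zip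
  (λ n δ≤x xy<δε → ℚ.*-cancelˡ-<-nonNeg δ {{ℚ.nonNegative (ℚ.<⇒≤ 0<δ)}}
    (ℚ.≤-<-trans
      (*-mono-≤ {δ} {ℚ.∣ seq x n ∣} {ℚ.∣ seq y n ℚ.- 0ℚ ∣} {ℚ.∣ seq y n ℚ.- 0ℚ ∣} (ℚ.<⇒≤ 0<δ)
        (ℚ.0≤∣p∣ (seq y n ℚ.- 0ℚ)) (ℚ.≤-trans δ≤x (p≤∣p∣ (seq x n))) ℚ.≤-refl)
      (subst (ℚ._< δ ℚ.* ε) (≡.trans (cong ℚ.∣_∣ (regroup (seq x n) (seq y n))) (ℚ.∣p*q∣≡∣p∣*∣q∣ (seq x n) (seq y n ℚ.- 0ℚ))) xy<δε)))
  x≥δ (xy≃0 (δ ℚ.* ε) (*-pos {δ} {ε} 0<δ 0<ε))) ⌋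
  where
  open +-*-Solver
  regroup : ∀ x y → x ℚ.* y ℚ.- 0ℚ ≡ x ℚ.* (y ℚ.- 0ℚ)
  regroup = solve 2 (λ x y → x :* y :- con 0ℚ := x :* (y :- con 0ℚ)) ≡.refl

-- Defs._+_ and Defs._*_ are defined by copatterns, so comparing two sums of reals unfolds the proofs
-- that they are Cauchy sequences. The opaque copies are compared as terms.
infixl 6 _⊕_
infixl 7 _⊗_
infix  8 ⊖_

opaque
  _⊕_ _⊗_ : ℝ → ℝ → ℝ
  _⊕_ = _+_
  _⊗_ = _*_

  ⊖_ : ℝ → ℝ
  ⊖_ = -_

  rational : ℚ → ℝ
  rational = fromℚ

integer : ℤ → ℝ
integer = rational ∘ fromℤ

0ʳ 1ʳ : ℝ
0ʳ = rational 0ℚ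
1ʳ = rational 1ℚ

opaque
  unfolding _⊕_ _⊗_ ⊖_ rational

  ⊕-def : ∀ x y → x ⊕ y ≡ x + y
  ⊕-def x y = ≡.refl

  ⊗-def : ∀ x y → x ⊗ y ≡ x * y
  ⊗-def x y = ≡.refl

  ⊖-def : ∀ x → ⊖ x ≡ - x
  ⊖-def x = ≡.refl

  rational-def : ∀ q → rational q ≡ fromℚ q
  rational-def q = ≡.refl

  ℝ-isCommutativeRing : IsCommutativeRing _≈_ _⊕_ _⊗_ ⊖_ 0ʳ 1ʳ
  ℝ-isCommutativeRing = Defs-isCommutativeRing

ℝ-commutativeRing : CommutativeRing 0ℓ 0ℓ
ℝ-commutativeRing = record { isCommutativeRing = ℝ-isCommutativeRing }

module ℝ-Ring = CommutativeRing ℝ-commutativeRing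
module ℝ-Sum = SemiringSum ℝ-Ring.semiring

opaque
  unfolding _⊕_ _⊗_ ⊖_ rational

  rational-homo : RingMorphisms.IsRingHomomorphism ℚ.+-*-rawRing ℝ-Ring.rawRing rational
  rational-homo = mkRingHomomorphism ℚ.+-*-rawRing ℝ-Ring.rawRing
    (λ p≡q → ℝ-Ring.reflexive (cong rational p≡q))
    (λ _ _ → pointwise λ _ → ≡.refl) (λ _ _ → pointwise λ _ → ≡.refl)
    (λ _ → pointwise λ _ → ≡.refl) ℝ-Ring.refl ℝ-Ring.refl

  integer-homo : RingMorphisms.IsRingHomomorphism ℤ.+-*-rawRing ℝ-Ring.rawRing integer
  integer-homo = mkRingHomomorphism ℤ.+-*-rawRing ℝ-Ring.rawRing
    (λ m≡n → ℝ-Ring.reflexive (cong integer m≡n))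
    (λ m n → pointwise λ _ → fromℤ-+ m n) (λ m n → pointwise λ _ → fromℤ-* m n)
    (λ n → pointwise λ _ → fromℤ-neg n) ℝ-Ring.refl ℝ-Ring.refl

  bounded-⊕ : ∀ {p q x y} → Bounded p x → Bounded q y → Bounded (p ℚ.+ q) (x ⊕ y)
  bounded-⊕ {x = x} {y} = bounded-+ {x = x} {y}

  bounded-⊖ : ∀ {p x} → Bounded p x → Bounded p (⊖ x)
  bounded-⊖ {x = x} = bounded-neg {x = x}

  bounded-⊗ : ∀ {p q x y} → Bounded p x → Bounded q y → Bounded (p ℚ.* q) (x ⊗ y)
  bounded-⊗ {x = x} {y} = bounded-* {x = x} {y}

  approximate : ∀ x δ → 0ℚ ℚ.< δ → ∃[ q ] Bounded δ (x ⊕ ⊖ rational q)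
  approximate = approximate-Defs

  round : ∀ x D δ → 0ℚ ℚ.< D → 0ℚ ℚ.< δ → ∃[ n ] Bounded (D ℚ.+ δ) (x ⊕ ⊖ rational (D ℚ.* fromℤ n))
  round = round-Defs

  *-cancel-≈0 : ∀ {x y δ} → 0ℚ ℚ.< δ → Eventually (λ n → δ ℚ.≤ seq x n) → x ⊗ y ≈ 0ʳ → y ≈ 0ʳ
  *-cancel-≈0 {x} {y} = *-cancel-≈0-Defs {x} {y}

  bounded-rational : ∀ q → Bounded ℚ.∣ q ∣ (rational q)
  bounded-rational q = 0 , λ _ _ → ℚ.≤-refl

module ℝ-Int = IntegerCoefficients ℝ-commutativeRing integer integer-homo

bounded-sum : ∀ {n} {p : Vector ℚ n} {x : Vector ℝ n} → (∀ i → Bounded (p i) (x i)) →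
              Bounded (ℚ-Sum.sum p) (ℝ-Sum.sum x)
bounded-sum {zero}          b = bounded-rational 0ℚ
bounded-sum {suc n} {p} {x} b = bounded-⊕ {x = x zero} {ℝ-Sum.sum (x ∘ suc)} (b zero) (bounded-sum (b ∘ suc))

-- The ring of complex numbers

infix 4 _≈ᶜ_
infixl 6 _+ᶜ_
infixl 7 _*ᶜ_

_+ᶜ_ _*ᶜ_ : ℂ → ℂ → ℂ
z +ᶜ w = (re z ⊕ re w) +i (im z ⊕ im w)
z *ᶜ w = (re z ⊗ re w ⊕ ⊖ (im z ⊗ im w)) +i (re z ⊗ im w ⊕ im z ⊗ re w)

-ᶜ_ : ℂ → ℂ
-ᶜ z = (⊖ re z) +i (⊖ im z)

0ᶜ 1ᶜ : ℂ
0ᶜ = 0ʳ +i 0ʳ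
1ᶜ = 1ʳ +i 0ʳ

record _≈ᶜ_ (z w : ℂ) : Set where
  constructor _,ᶜ_
  field
    re-≈ : re z ≈ re w
    im-≈ : im z ≈ im w

open _≈ᶜ_ public

≃ᶜ⇒≈ᶜ : ∀ {z w} → z ≃ᶜ w → z ≈ᶜ w
≃ᶜ⇒≈ᶜ (p , q) = ⌊ p ⌋ ,ᶜ ⌊ q ⌋

≈ᶜ⇒≃ᶜ : ∀ {z w} → z ≈ᶜ w → z ≃ᶜ w
≈ᶜ⇒≃ᶜ (p ,ᶜ q) = ⌈ p ⌉ , ⌈ q ⌉

module ℂ-Identities where

  open ℝ-Int.Solver

  *ᶜ-assoc-re : ∀ a b c d e f → (a ⊗ c ⊕ ⊖ (b ⊗ d)) ⊗ e ⊕ ⊖ ((a ⊗ d ⊕ b ⊗ c) ⊗ f) ≈ a ⊗ (c ⊗ e ⊕ ⊖ (d ⊗ f)) ⊕ ⊖ (b ⊗ (c ⊗ f ⊕ d ⊗ e))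
  *ᶜ-assoc-re = solve 6 (λ a b c d e f →
    (a :* c :- b :* d) :* e :- (a :* d :+ b :* c) :* f := a :* (c :* e :- d :* f) :- b :* (c :* f :+ d :* e)) ℝ-Ring.refl

  *ᶜ-assoc-im : ∀ a b c d e f → (a ⊗ c ⊕ ⊖ (b ⊗ d)) ⊗ f ⊕ (a ⊗ d ⊕ b ⊗ c) ⊗ e ≈ a ⊗ (c ⊗ f ⊕ d ⊗ e) ⊕ b ⊗ (c ⊗ e ⊕ ⊖ (d ⊗ f))
  *ᶜ-assoc-im = solve 6 (λ a b c d e f →
    (a :* c :- b :* d) :* f :+ (a :* d :+ b :* c) :* e := a :* (c :* f :+ d :* e) :+ b :* (c :* e :- d :* f)) ℝ-Ring.refl

  *ᶜ-distrib-re : ∀ a b c d e f → a ⊗ (c ⊕ e) ⊕ ⊖ (b ⊗ (d ⊕ f)) ≈ (a ⊗ c ⊕ ⊖ (b ⊗ d)) ⊕ (a ⊗ e ⊕ ⊖ (b ⊗ f))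
  *ᶜ-distrib-re = solve 6 (λ a b c d e f → a :* (c :+ e) :- b :* (d :+ f) := (a :* c :- b :* d) :+ (a :* e :- b :* f)) ℝ-Ring.refl

  *ᶜ-distrib-im : ∀ a b c d e f → a ⊗ (d ⊕ f) ⊕ b ⊗ (c ⊕ e) ≈ (a ⊗ d ⊕ b ⊗ c) ⊕ (a ⊗ f ⊕ b ⊗ e)
  *ᶜ-distrib-im = solve 6 (λ a b c d e f → a :* (d :+ f) :+ b :* (c :+ e) := (a :* d :+ b :* c) :+ (a :* f :+ b :* e)) ℝ-Ring.refl

  *ᶜ-comm-re : ∀ a b c d → a ⊗ c ⊕ ⊖ (b ⊗ d) ≈ c ⊗ a ⊕ ⊖ (d ⊗ b)
  *ᶜ-comm-re = solve 4 (λ a b c d → a :* c :- b :* d := c :* a :- d :* b) ℝ-Ring.refl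

  *ᶜ-comm-im : ∀ a b c d → a ⊗ d ⊕ b ⊗ c ≈ c ⊗ b ⊕ d ⊗ a
  *ᶜ-comm-im = solve 4 (λ a b c d → a :* d :+ b :* c := c :* b :+ d :* a) ℝ-Ring.refl

  *ᶜ-identity-re : ∀ a b → 1ʳ ⊗ a ⊕ ⊖ (0ʳ ⊗ b) ≈ a
  *ᶜ-identity-re = solve 2 (λ a b → con 1ℤ :* a :+ :- (con 0ℤ :* b) := a) ℝ-Ring.refl

  *ᶜ-identity-im : ∀ a b → 1ʳ ⊗ b ⊕ 0ʳ ⊗ a ≈ b
  *ᶜ-identity-im = solve 2 (λ a b → con 1ℤ :* b :+ con 0ℤ :* a := b) ℝ-Ring.refl

  -- For z = a + bi and w = u + vi, this and `conjugate-*-im` are the parts of |z|² w = z̄ (z w).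
  -- They reduce cancelling a complex factor to cancelling the real number |z|².
  conjugate-*-re : ∀ a b u v → (a ⊗ a ⊕ b ⊗ b) ⊗ u ≈ a ⊗ (a ⊗ u ⊕ ⊖ (b ⊗ v)) ⊕ b ⊗ (a ⊗ v ⊕ b ⊗ u)
  conjugate-*-re = solve 4 (λ a b u v → (a :* a :+ b :* b) :* u := a :* (a :* u :- b :* v) :+ b :* (a :* v :+ b :* u)) ℝ-Ring.refl

  conjugate-*-im : ∀ a b u v → (a ⊗ a ⊕ b ⊗ b) ⊗ v ≈ a ⊗ (a ⊗ v ⊕ b ⊗ u) ⊕ (⊖ b) ⊗ (a ⊗ u ⊕ ⊖ (b ⊗ v))
  conjugate-*-im = solve 4 (λ a b u v → (a :* a :+ b :* b) :* v := a :* (a :* v :+ b :* u) :+ (:- b) :* (a :* u :- b :* v)) ℝ-Ring.refl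

open ℂ-Identities

≈ᶜ-isEquivalence : IsEquivalence _≈ᶜ_
≈ᶜ-isEquivalence = record
  { refl  = ℝ-Ring.refl ,ᶜ ℝ-Ring.refl
  ; sym   = λ p → ℝ-Ring.sym (re-≈ p) ,ᶜ ℝ-Ring.sym (im-≈ p)
  ; trans = λ p q → ℝ-Ring.trans (re-≈ p) (re-≈ q) ,ᶜ ℝ-Ring.trans (im-≈ p) (im-≈ q)
  }

*ᶜ-comm : ∀ z w → z *ᶜ w ≈ᶜ w *ᶜ z
*ᶜ-comm z w = *ᶜ-comm-re (re z) (im z) (re w) (im w) ,ᶜ *ᶜ-comm-im (re z) (im z) (re w) (im w)

*ᶜ-cong : ∀ {z z′ w w′} → z ≈ᶜ z′ → w ≈ᶜ w′ → z *ᶜ w ≈ᶜ z′ *ᶜ w′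
*ᶜ-cong p q =
  ℝ-Ring.+-cong (ℝ-Ring.*-cong (re-≈ p) (re-≈ q)) (ℝ-Ring.-‿cong (ℝ-Ring.*-cong (im-≈ p) (im-≈ q))) ,ᶜ
  ℝ-Ring.+-cong (ℝ-Ring.*-cong (re-≈ p) (im-≈ q)) (ℝ-Ring.*-cong (im-≈ p) (re-≈ q))

*ᶜ-identityˡ : ∀ z → 1ᶜ *ᶜ z ≈ᶜ z
*ᶜ-identityˡ z = *ᶜ-identity-re (re z) (im z) ,ᶜ *ᶜ-identity-im (re z) (im z)

*ᶜ-distribˡ : ∀ z w u → z *ᶜ (w +ᶜ u) ≈ᶜ z *ᶜ w +ᶜ z *ᶜ u
*ᶜ-distribˡ z w u = *ᶜ-distrib-re (re z) (im z) (re w) (im w) (re u) (im u)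
                 ,ᶜ *ᶜ-distrib-im (re z) (im z) (re w) (im w) (re u) (im u)

+ᶜ-cong : ∀ {z z′ w w′} → z ≈ᶜ z′ → w ≈ᶜ w′ → z +ᶜ w ≈ᶜ z′ +ᶜ w′
+ᶜ-cong p q = ℝ-Ring.+-cong (re-≈ p) (re-≈ q) ,ᶜ ℝ-Ring.+-cong (im-≈ p) (im-≈ q)

ℂ-isCommutativeRing : IsCommutativeRing _≈ᶜ_ _+ᶜ_ _*ᶜ_ -ᶜ_ 0ᶜ 1ᶜ
ℂ-isCommutativeRing = record
  { isRing = record
    { +-isAbelianGroup = record
      { isGroup = record
        { isMonoid = record
          { isSemigroup = record
            { isMagma = record { isEquivalence = ≈ᶜ-isEquivalence ; ∙-cong = +ᶜ-cong }
            ; assoc   = λ z w u → ℝ-Ring.+-assoc (re z) (re w) (re u) ,ᶜ ℝ-Ring.+-assoc (im z) (im w) (im u)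
            }
          ; identity = (λ z → ℝ-Ring.+-identityˡ (re z) ,ᶜ ℝ-Ring.+-identityˡ (im z))
                     , (λ z → ℝ-Ring.+-identityʳ (re z) ,ᶜ ℝ-Ring.+-identityʳ (im z))
          }
        ; inverse = (λ z → ℝ-Ring.-‿inverseˡ (re z) ,ᶜ ℝ-Ring.-‿inverseˡ (im z))
                  , (λ z → ℝ-Ring.-‿inverseʳ (re z) ,ᶜ ℝ-Ring.-‿inverseʳ (im z))
        ; ⁻¹-cong = λ p → ℝ-Ring.-‿cong (re-≈ p) ,ᶜ ℝ-Ring.-‿cong (im-≈ p)
        }
      ; comm = λ z w → ℝ-Ring.+-comm (re z) (re w) ,ᶜ ℝ-Ring.+-comm (im z) (im w)
      }
    ; *-cong     = *ᶜ-cong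
    ; *-assoc    = λ z w u → *ᶜ-assoc-re (re z) (im z) (re w) (im w) (re u) (im u)
                          ,ᶜ *ᶜ-assoc-im (re z) (im z) (re w) (im w) (re u) (im u)
    ; *-identity = *ᶜ-identityˡ
                 , λ z → E.trans {z *ᶜ 1ᶜ} {1ᶜ *ᶜ z} {z} (*ᶜ-comm z 1ᶜ) (*ᶜ-identityˡ z)
    ; distrib    = *ᶜ-distribˡ
                 , λ z w u → E.trans {(w +ᶜ u) *ᶜ z} {z *ᶜ (w +ᶜ u)} {w *ᶜ z +ᶜ u *ᶜ z} (*ᶜ-comm (w +ᶜ u) z)
                     (E.trans {z *ᶜ (w +ᶜ u)} {z *ᶜ w +ᶜ z *ᶜ u} {w *ᶜ z +ᶜ u *ᶜ z} (*ᶜ-distribˡ z w u)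
                       (+ᶜ-cong {z *ᶜ w} {w *ᶜ z} {z *ᶜ u} {u *ᶜ z} (*ᶜ-comm z w) (*ᶜ-comm z u)))
    }
  ; *-comm = *ᶜ-comm
  }
  where module E = IsEquivalence ≈ᶜ-isEquivalence

ℂ-commutativeRing : CommutativeRing 0ℓ 0ℓ
ℂ-commutativeRing = record { isCommutativeRing = ℂ-isCommutativeRing }

module ℂ-Ring = CommutativeRing ℂ-commutativeRing
module ℂ-Sum = SemiringSum ℂ-Ring.semiring

-- Cancellation and idempotents in ℂ

¼ : ℚ
¼ = ½ ℚ.* ½

opaque
  unfolding _⊕_ _⊗_ ⊖_ rational

  -- Decided by comparing a rational 1/4-approximation of x with 1/2.
  bounded-below-or-1- : ∀ x → Eventually (λ n → ¼ ℚ.≤ seq x n) ⊎ Eventually (λ n → ¼ ℚ.≤ seq (1ʳ ⊕ ⊖ x) n)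
  bounded-below-or-1- x with approximate-Defs x ¼ (ℚ.positive⁻¹ ¼)
  ... | q , close with ℚ.≤-total ½ q
  ... | inj₁ ½≤q = inj₁ (eventually-map (λ n ≤¼ → subst₂ ℚ._≤_
          (solve 1 (λ q → q :+ (con ¼ :- q) := con ¼) ≡.refl q)
          (solve 2 (λ q x → q :+ (x :- q) := x) ≡.refl q (seq x n))
          (ℚ.+-monoʳ-≤ q (ℚ.≤-trans (ℚ.+-monoʳ-≤ ¼ (ℚ.neg-antimono-≤ ½≤q))
            (subst (ℚ._≤ seq x n ℚ.- q) ≡.refl (subst (ℚ.- ¼ ℚ.≤_)
              (solve 2 (λ x q → :- (q :- x) := x :- q) ≡.refl (seq x n) q)
              (ℚ.neg-antimono-≤ (ℚ.≤-trans (subst (ℚ._≤ ℚ.∣ seq x n ℚ.- q ∣)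
                (solve 2 (λ x q → :- (x :- q) := q :- x) ≡.refl (seq x n) q) (-p≤∣p∣ (seq x n ℚ.- q))) ≤¼)))))))
          close)
    where open +-*-Solver
  ... | inj₂ q≤½ = inj₂ (eventually-map (λ n ≤¼ → subst (ℚ._≤ 1ℚ ℚ.- seq x n) ≡.refl
          (ℚ.+-monoʳ-≤ 1ℚ (ℚ.neg-antimono-≤ (ℚ.≤-trans (subst (ℚ._≤ ½ ℚ.+ ¼)
            (solve 2 (λ q x → q :+ (x :- q) := x) ≡.refl q (seq x n))
            (ℚ.+-mono-≤ q≤½ (ℚ.≤-trans (p≤∣p∣ (seq x n ℚ.- q)) ≤¼))) ℚ.≤-refl))))
          close)
    where open +-*-Solver

  norm-bounded-below : ∀ {δ z} → 0ℚ ℚ.< δ → Eventually (λ n → δ ℚ.≤ seq (re z) n) →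
    Eventually (λ n → δ ℚ.* δ ℚ.≤ seq (re z ⊗ re z ⊕ im z ⊗ im z) n)
  norm-bounded-below {δ} {z} 0<δ = eventually-map λ n δ≤ →
    ℚ.≤-trans (*-mono-≤ {δ} {seq (re z) n} {δ} {seq (re z) n} (ℚ.<⇒≤ 0<δ) (ℚ.≤-trans (ℚ.<⇒≤ 0<δ) δ≤) δ≤ δ≤)
      (p≤p+q {seq (re z) n ℚ.* seq (re z) n} {seq (im z) n ℚ.* seq (im z) n} (0≤p*p (seq (im z) n)))
    where
    0≤p*p : ∀ p → 0ℚ ℚ.≤ p ℚ.* p
    0≤p*p p with ℚ.≤-total 0ℚ p
    ... | inj₁ 0≤p = *-nonNeg {p} {p} 0≤p 0≤p
    ... | inj₂ p≤0 = subst (0ℚ ℚ.≤_) (solve 1 (λ p → :- p :* :- p := p :* p) ≡.refl p)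
                       (*-nonNeg {ℚ.- p} {ℚ.- p} (ℚ.neg-antimono-≤ p≤0) (ℚ.neg-antimono-≤ p≤0))
      where open +-*-Solver

*ᶜ-cancel-≈0 : ∀ {z w δ} → 0ℚ ℚ.< δ → Eventually (λ n → δ ℚ.≤ seq (re z) n) → z *ᶜ w ≈ᶜ 0ᶜ → w ≈ᶜ 0ᶜ
*ᶜ-cancel-≈0 {z} {w} {δ} 0<δ δ≤ (re≈0 ,ᶜ im≈0) =
  *-cancel-≈0 0<δδ bound (ℝ-Ring.trans (conjugate-*-re a b u v) (vanish a b re≈0 im≈0)) ,ᶜ
  *-cancel-≈0 0<δδ bound (ℝ-Ring.trans (conjugate-*-im a b u v) (vanish a (⊖ b) im≈0 re≈0))
  where
  a = re z
  b = im z
  u = re w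
  v = im w
  0<δδ : 0ℚ ℚ.< δ ℚ.* δ
  0<δδ = *-pos {δ} {δ} 0<δ 0<δ
  bound : Eventually (λ n → δ ℚ.* δ ℚ.≤ seq (a ⊗ a ⊕ b ⊗ b) n)
  bound = norm-bounded-below {δ} {z} 0<δ δ≤
  vanish : ∀ a b {x y} → x ≈ 0ʳ → y ≈ 0ʳ → a ⊗ x ⊕ b ⊗ y ≈ 0ʳ
  vanish a b x≈0 y≈0 = ℝ-Ring.trans
    (ℝ-Ring.+-cong (ℝ-Ring.trans (ℝ-Ring.*-congˡ x≈0) (ℝ-Ring.zeroʳ a))
                   (ℝ-Ring.trans (ℝ-Ring.*-congˡ y≈0) (ℝ-Ring.zeroʳ b)))
    (ℝ-Ring.+-identityˡ 0ʳ)

-- Either the real part of `e` or that of `1 - e` stays above 1/4, so that number can be cancelled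
-- from e (1 - e) = 0 or e (e - 1) = 0. Cancelling `1 - e` gives the claim; cancelling `e` gives the
-- excluded value 1.
idempotent-≈0 : ∀ {e} → e *ᶜ e ≈ᶜ e → ¬ e ≈ᶜ 1ᶜ → e ≈ᶜ 0ᶜ
idempotent-≈0 {e} ee≈e e≉1 with bounded-below-or-1- (re e)
... | inj₂ below = *ᶜ-cancel-≈0 {1ᶜ +ᶜ -ᶜ e} (ℚ.positive⁻¹ ¼) below (begin
    (1ᶜ +ᶜ -ᶜ e) *ᶜ e         ≈⟨ ℂ-Ring.distribʳ e 1ᶜ (-ᶜ e) ⟩
    1ᶜ *ᶜ e +ᶜ (-ᶜ e) *ᶜ e    ≈⟨ ℂ-Ring.+-cong (ℂ-Ring.*-identityˡ e) (ℂ-Ring.sym (-‿distribˡ-* e e)) ⟩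
    e +ᶜ -ᶜ (e *ᶜ e)          ≈⟨ ℂ-Ring.+-congˡ (ℂ-Ring.-‿cong ee≈e) ⟩
    e +ᶜ -ᶜ e                 ≈⟨ ℂ-Ring.-‿inverseʳ e ⟩
    0ᶜ                        ∎)
  where
  open SetoidReasoning ℂ-Ring.setoid
  open RingProperties ℂ-Ring.ring using (-‿distribˡ-*)
... | inj₁ below = contradiction e≈1 e≉1
  where
  open SetoidReasoning ℂ-Ring.setoid
  open RingProperties ℂ-Ring.ring using (-‿distribʳ-*; x∙y⁻¹≈ε⇒x≈y)
  e≈1 : e ≈ᶜ 1ᶜ
  e≈1 = x∙y⁻¹≈ε⇒x≈y e 1ᶜ (*ᶜ-cancel-≈0 {e} (ℚ.positive⁻¹ ¼) below (begin
    e *ᶜ (e +ᶜ -ᶜ 1ᶜ)         ≈⟨ ℂ-Ring.distribˡ e e (-ᶜ 1ᶜ) ⟩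
    e *ᶜ e +ᶜ e *ᶜ (-ᶜ 1ᶜ)    ≈⟨ ℂ-Ring.+-cong ee≈e (ℂ-Ring.trans (ℂ-Ring.sym (-‿distribʳ-* e 1ᶜ)) (ℂ-Ring.-‿cong (ℂ-Ring.*-identityʳ e))) ⟩
    e +ᶜ -ᶜ e                 ≈⟨ ℂ-Ring.-‿inverseʳ e ⟩
    0ᶜ                        ∎))

-- Homomorphisms out of ℚ

q*↧q : ∀ q → q ℚ.* ι (ℚ.↧ₙ q) ≡ fromℤ (↥ q)
q*↧q q@(mkℚ n d-1 _) = ℚ.toℚᵘ-injective (ℚᵘ.≃-trans (ℚ.toℚᵘ-homo-* q (ι (suc d-1)))
  (ℚᵘ.*≡* (≡.trans (ℤ.*-identityʳ (n ℤ.* + suc d-1)) (cong (λ k → n ℤ.* + suc k) (≡.sym (ℕ.*-identityʳ d-1))))))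

module _ {c ℓ} (S : CommutativeRing c ℓ) where

  private module S = CommutativeRing S
  open RingMorphisms ℚ.+-*-rawRing S.rawRing using (IsRingHomomorphism)

  -- The maps agree on integers by induction. The target is merely a commutative ring, so the image
  -- of the denominator `m` is inverted there by `g (1/ m)`.
  ℚ-homomorphism-unique : ∀ {f g} → IsRingHomomorphism f → IsRingHomomorphism g → ∀ q → f q S.≈ g q
  ℚ-homomorphism-unique {f} {g} f-homo g-homo q@(mkℚ n d-1 _) = begin
    f q                                      ≈⟨ S.*-identityʳ (f q) ⟨
    f q S.* S.1#                             ≈⟨ S.*-congˡ (S.trans (g.⟦⟧-cong (ℚ.*-inverseʳ m)) g.1#-homo) ⟨
    f q S.* g (m ℚ.* 1/ m)                   ≈⟨ S.*-congˡ (g.*-homo m (1/ m)) ⟩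
    f q S.* (g m S.* g (1/ m))               ≈⟨ S.*-assoc (f q) (g m) (g (1/ m)) ⟨
    f q S.* g m S.* g (1/ m)                 ≈⟨ S.*-congʳ (S.*-congˡ (natural (suc d-1))) ⟨
    f q S.* f m S.* g (1/ m)                 ≈⟨ S.*-congʳ (S.trans (S.sym (f.*-homo q m)) (f.⟦⟧-cong (q*↧q q))) ⟩
    f (fromℤ n) S.* g (1/ m)                 ≈⟨ S.*-congʳ (integral n) ⟩
    g (fromℤ n) S.* g (1/ m)                 ≈⟨ S.*-congʳ (S.trans (S.sym (g.*-homo q m)) (g.⟦⟧-cong (q*↧q q))) ⟨
    g q S.* g m S.* g (1/ m)                 ≈⟨ S.*-assoc (g q) (g m) (g (1/ m)) ⟩
    g q S.* (g m S.* g (1/ m))               ≈⟨ S.*-congˡ (g.*-homo m (1/ m)) ⟨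
    g q S.* g (m ℚ.* 1/ m)                   ≈⟨ S.*-congˡ (S.trans (g.⟦⟧-cong (ℚ.*-inverseʳ m)) g.1#-homo) ⟩
    g q S.* S.1#                             ≈⟨ S.*-identityʳ (g q) ⟩
    g q                                      ∎
    where
    open SetoidReasoning S.setoid
    module f = RingMorphisms.IsRingHomomorphism f-homo
    module g = RingMorphisms.IsRingHomomorphism g-homo
    m = ι (suc d-1)
    natural : ∀ k → f (ι k) S.≈ g (ι k)
    natural zero    = S.trans f.0#-homo (S.sym g.0#-homo)
    natural (suc k) = begin
      f (ι (suc k))            ≈⟨ f.⟦⟧-cong (ι-suc k) ⟩
      f (1ℚ ℚ.+ ι k)           ≈⟨ f.+-homo 1ℚ (ι k) ⟩
      f 1ℚ S.+ f (ι k)         ≈⟨ S.+-cong (S.trans f.1#-homo (S.sym g.1#-homo)) (natural k) ⟩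
      g 1ℚ S.+ g (ι k)         ≈⟨ g.+-homo 1ℚ (ι k) ⟨
      g (1ℚ ℚ.+ ι k)           ≈⟨ g.⟦⟧-cong (ι-suc k) ⟨
      g (ι (suc k))            ∎
    integral : ∀ k → f (fromℤ k) S.≈ g (fromℤ k)
    integral (+ k)      = natural k
    integral ℤ.-[1+ k ] = begin
      f (ℚ.- ι (suc k))  ≈⟨ f.-‿homo (ι (suc k)) ⟩
      S.- f (ι (suc k))  ≈⟨ S.-‿cong (natural (suc k)) ⟩
      S.- g (ι (suc k))  ≈⟨ g.-‿homo (ι (suc k)) ⟨
      g (ℚ.- ι (suc k))  ∎

≃⇒≈ : ∀ x y → x ≃ y → x ≈ y
≃⇒≈ x y x≃y = ⌊ x≃y ⌋

≃-rational-0 : ∀ q → rational q ≈ 0ʳ → q ≡ 0ℚ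
≃-rational-0 q q≈0 with q ℚ.≟ 0ℚ
... | yes q≡0 = q≡0
... | no  q≢0 = contradiction (small q≈0) (ℚ.<-irrefl ≡.refl)
  where
  0<∣q∣ : 0ℚ ℚ.< ℚ.∣ q ∣
  0<∣q∣ = ℚ.≰⇒> λ ∣q∣≤0 → q≢0 (ℚ.∣p∣≡0⇒p≡0 q (ℚ.≤-antisym ∣q∣≤0 (ℚ.0≤∣p∣ q)))
  opaque
    unfolding rational
    small : rational q ≈ 0ʳ → ℚ.∣ q ∣ ℚ.< ℚ.∣ q ∣
    small ⌊ q≃0 ⌋ = eventually-witness (eventually-map
      (λ n → subst (λ p → ℚ.∣ p ∣ ℚ.< ℚ.∣ q ∣) (ℚ.+-identityʳ q)) (q≃0 ℚ.∣ q ∣ 0<∣q∣))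

foldr-cong : ∀ {a} {A : Set a} {f g : A → A → A} {e e′ : A} →
  (∀ x y → f x y ≡ g x y) → e ≡ e′ → ∀ {n} {x y : Vector A n} → (∀ i → x i ≡ y i) →
  Vector.foldr f e x ≡ Vector.foldr g e′ y
foldr-cong f≗g e≡e′ {zero}  x≗y = e≡e′
foldr-cong {f = f} f≗g e≡e′ {suc n} x≗y =
  ≡.trans (cong₂ f (x≗y zero) (foldr-cong f≗g e≡e′ (x≗y ∘ suc))) (f≗g _ _)

sum-def : ∀ {n} {x y : Vector ℝ n} → (∀ i → x i ≡ y i) → ℝ-Sum.sum x ≡ sum y
sum-def = foldr-cong ⊕-def (rational-def 0ℚ)

private module ℂ-Raw = RawRing ℂ-rawRing

0ᶜ-def : 0ᶜ ≡ ℂ-Raw.0#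
0ᶜ-def = cong₂ _+i_ (rational-def 0ℚ) (rational-def 0ℚ)

1ᶜ-def : 1ᶜ ≡ ℂ-Raw.1#
1ᶜ-def = cong₂ _+i_ (rational-def 1ℚ) (rational-def 0ℚ)

-ᶜ-def : ∀ z → -ᶜ z ≡ ℂ-Raw.- z
-ᶜ-def z = cong₂ _+i_ (⊖-def (re z)) (⊖-def (im z))

+ᶜ-def : ∀ z w → z +ᶜ w ≡ z ℂ-Raw.+ w
+ᶜ-def z w = cong₂ _+i_ (⊕-def (re z) (re w)) (⊕-def (im z) (im w))

*ᶜ-def : ∀ z w → z *ᶜ w ≡ z ℂ-Raw.* w
*ᶜ-def z w = cong₂ _+i_
  (≡.trans (cong₂ (λ x y → x ⊕ ⊖ y) (⊗-def (re z) (re w)) (⊗-def (im z) (im w)))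
    (≡.trans (cong (re z * re w ⊕_) (⊖-def (im z * im w))) (⊕-def (re z * re w) (- (im z * im w)))))
  (≡.trans (cong₂ _⊕_ (⊗-def (re z) (im w)) (⊗-def (im z) (re w))) (⊕-def (re z * im w) (im z * re w)))

-- The number field as a finite extension of ℚ, and its embeddings

module NumberField {ℓ d} (K : RealNumberField ℓ (suc d)) where

  open RealNumberField K using (_∈K; Element; respects; basis)
  private module K = RealNumberField K

  ∈K-resp-≈ : ∀ {x y} → x ≈ y → x ∈K → y ∈K
  ∈K-resp-≈ {x} {y} ⌊ x≃y ⌋ = respects {x} {y} x≃y

  ⊕-∈K : ∀ {x y} → x ∈K → y ∈K → (x ⊕ y) ∈K
  ⊕-∈K {x} {y} x∈K y∈K = subst _∈K (≡.sym (⊕-def x y)) (K.+-closed {x} {y} x∈K y∈K)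

  ⊗-∈K : ∀ {x y} → x ∈K → y ∈K → (x ⊗ y) ∈K
  ⊗-∈K {x} {y} x∈K y∈K = subst _∈K (≡.sym (⊗-def x y)) (K.*-closed {x} {y} x∈K y∈K)

  ⊖-∈K : ∀ {x} → x ∈K → (⊖ x) ∈K
  ⊖-∈K {x} x∈K = subst _∈K (≡.sym (⊖-def x)) (K.neg-closed {x} x∈K)

  0-∈K : 0ʳ ∈K
  0-∈K = subst _∈K (≡.sym (rational-def 0ℚ)) K.0∈K

  1-∈K : 1ʳ ∈K
  1-∈K = subst _∈K (≡.sym (rational-def 1ℚ)) K.1∈K

  inverse-∈K : ∀ {x} → x ∈K → ¬ x ≈ 0ʳ → ∃[ y ] y ∈K × x ⊗ y ≈ 1ʳ
  inverse-∈K {x} x∈K x≉0 = proj₁ y , proj₁ (proj₂ y) ,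
    subst₂ _≈_ (≡.sym (⊗-def x (proj₁ y))) (≡.sym (rational-def 1ℚ)) (≃⇒≈ (x * proj₁ y) 1ℝ (proj₂ (proj₂ y)))
    where
    y : ∃[ y ] y ∈K × x * y ≃ 1ℝ
    y = K.inverse {x} x∈K λ x≃0 → x≉0 (subst (x ≈_) (≡.sym (rational-def 0ℚ)) (≃⇒≈ x 0ℝ x≃0))

  combination-def : ∀ {n} (q : Vector ℚ n) (x : Vector Element n) →
    (ℝ-Sum.sum λ i → rational (q i) ⊗ proj₁ (x i)) ≡ sum λ i → fromℚ (q i) * proj₁ (x i)
  combination-def q x = sum-def λ i →
    ≡.trans (cong (_⊗ proj₁ (x i)) (rational-def (q i))) (⊗-def (fromℚ (q i)) (proj₁ (x i)))

  spanning-≈ : ∀ (x : Element) → Σ[ q ∈ Vector ℚ (suc d) ] proj₁ x ≈ ℝ-Sum.sum λ i → rational (q i) ⊗ proj₁ (basis i)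
  spanning-≈ x = q , subst (proj₁ x ≈_) (≡.sym (combination-def q basis))
    (≃⇒≈ (proj₁ x) (K.combination q basis) (proj₂ (K.spanning x)))
    where
    q : Vector ℚ (suc d)
    q = proj₁ (K.spanning x)

  independent-≈ : ∀ (q : Vector ℚ (suc d)) → (ℝ-Sum.sum λ i → rational (q i) ⊗ proj₁ (basis i)) ≈ 0ʳ → ∀ i → q i ≡ 0ℚ
  independent-≈ q ≈0 = K.independent q ⌈ subst₂ _≈_ (combination-def q basis) (rational-def 0ℚ) ≈0 ⌉

  infixl 6 _+ᴷ_
  infixl 7 _*ᴷ_

  _+ᴷ_ _*ᴷ_ : Element → Element → Element
  x +ᴷ y = proj₁ x ⊕ proj₁ y , ⊕-∈K (proj₂ x) (proj₂ y)
  x *ᴷ y = proj₁ x ⊗ proj₁ y , ⊗-∈K (proj₂ x) (proj₂ y)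

  -ᴷ_ : Element → Element
  -ᴷ x = ⊖ proj₁ x , ⊖-∈K (proj₂ x)

  0ᴷ 1ᴷ : Element
  0ᴷ = 0ʳ , 0-∈K
  1ᴷ = 1ʳ , 1-∈K

  infix 4 _≈ᴷ_

  record _≈ᴷ_ (x y : Element) : Set where
    constructor inK
    field inℝ : proj₁ x ≈ proj₁ y

  open _≈ᴷ_ public

  K-isCommutativeRing : IsCommutativeRing _≈ᴷ_ _+ᴷ_ _*ᴷ_ -ᴷ_ 0ᴷ 1ᴷ
  K-isCommutativeRing = record
    { isRing = record
      { +-isAbelianGroup = record
        { isGroup = record
          { isMonoid = record
            { isSemigroup = record
              { isMagma = record
                { isEquivalence = record
                  { refl  = inK ℝ-Ring.refl
                  ; sym   = λ p → inK (ℝ-Ring.sym (inℝ p))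
                  ; trans = λ p q → inK (ℝ-Ring.trans (inℝ p) (inℝ q))
                  }
                ; ∙-cong = λ p q → inK (ℝ-Ring.+-cong (inℝ p) (inℝ q))
                }
              ; assoc = λ x y z → inK (ℝ-Ring.+-assoc (proj₁ x) (proj₁ y) (proj₁ z))
              }
            ; identity = (λ x → inK (ℝ-Ring.+-identityˡ (proj₁ x))) , (λ x → inK (ℝ-Ring.+-identityʳ (proj₁ x)))
            }
          ; inverse = (λ x → inK (ℝ-Ring.-‿inverseˡ (proj₁ x))) , (λ x → inK (ℝ-Ring.-‿inverseʳ (proj₁ x)))
          ; ⁻¹-cong = λ p → inK (ℝ-Ring.-‿cong (inℝ p))
          }
        ; comm = λ x y → inK (ℝ-Ring.+-comm (proj₁ x) (proj₁ y))
        }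
      ; *-cong     = λ p q → inK (ℝ-Ring.*-cong (inℝ p) (inℝ q))
      ; *-assoc    = λ x y z → inK (ℝ-Ring.*-assoc (proj₁ x) (proj₁ y) (proj₁ z))
      ; *-identity = (λ x → inK (ℝ-Ring.*-identityˡ (proj₁ x))) , (λ x → inK (ℝ-Ring.*-identityʳ (proj₁ x)))
      ; distrib    = (λ x y z → inK (ℝ-Ring.distribˡ (proj₁ x) (proj₁ y) (proj₁ z)))
                   , (λ x y z → inK (ℝ-Ring.distribʳ (proj₁ x) (proj₁ y) (proj₁ z)))
      }
    ; *-comm = λ x y → inK (ℝ-Ring.*-comm (proj₁ x) (proj₁ y))
    }

  K-commutativeRing : CommutativeRing ℓ 0ℓ
  K-commutativeRing = record { isCommutativeRing = K-isCommutativeRing }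

  module K-Ring = CommutativeRing K-commutativeRing
  module K-Sum = SemiringSum K-Ring.semiring

  proj₁-sum : ∀ {n} (x : Vector Element n) → proj₁ (K-Sum.sum x) ≡ ℝ-Sum.sum (proj₁ ∘ x)
  proj₁-sum {zero}  x = ≡.refl
  proj₁-sum {suc n} x = cong (proj₁ (x zero) ⊕_) (proj₁-sum (x ∘ suc))

  -- A subfield contains 1, hence the integers, and a rational is its numerator times the inverse of
  -- its denominator. The latter is nonzero as a real because a rational equal to 0 in `ℝ` is 0.
  rational-∈K : ∀ q → rational q ∈K
  rational-∈K q = ∈K-resp-≈ q≈ (⊗-∈K (integer-∈K (↥ q)) m⁻¹∈K)
    where
    module rat = RingMorphisms.IsRingHomomorphism rational-homo
    natural-∈K : ∀ k → rational (ι k) ∈K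
    natural-∈K zero    = 0-∈K
    natural-∈K (suc k) = ∈K-resp-≈
      (ℝ-Ring.sym (ℝ-Ring.trans (rat.⟦⟧-cong (ι-suc k)) (rat.+-homo 1ℚ (ι k))))
      (⊕-∈K 1-∈K (natural-∈K k))
    integer-∈K : ∀ k → integer k ∈K
    integer-∈K (+ k)      = natural-∈K k
    integer-∈K ℤ.-[1+ k ] = ∈K-resp-≈ (ℝ-Ring.sym (rat.-‿homo (ι (suc k)))) (⊖-∈K (natural-∈K (suc k)))
    m = ℚ.↧ₙ q
    m≉0 : ¬ rational (ι m) ≈ 0ʳ
    m≉0 m≈0 with () ← ≃-rational-0 (ι m) m≈0
    m⁻¹ = proj₁ (inverse-∈K (natural-∈K m) m≉0)
    m⁻¹∈K = proj₁ (proj₂ (inverse-∈K (natural-∈K m) m≉0))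
    q≈ : integer (↥ q) ⊗ m⁻¹ ≈ rational q
    q≈ = begin
      rational (fromℤ (↥ q)) ⊗ m⁻¹         ≈⟨ ℝ-Ring.*-congʳ (rat.⟦⟧-cong (q*↧q q)) ⟨
      rational (q ℚ.* ι m) ⊗ m⁻¹           ≈⟨ ℝ-Ring.*-congʳ (rat.*-homo q (ι m)) ⟩
      rational q ⊗ rational (ι m) ⊗ m⁻¹    ≈⟨ ℝ-Ring.*-assoc (rational q) (rational (ι m)) m⁻¹ ⟩
      rational q ⊗ (rational (ι m) ⊗ m⁻¹)  ≈⟨ ℝ-Ring.*-congˡ (proj₂ (proj₂ (inverse-∈K (natural-∈K m) m≉0))) ⟩
      rational q ⊗ 1ʳ                      ≈⟨ ℝ-Ring.*-identityʳ (rational q) ⟩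
      rational q                           ∎
      where open SetoidReasoning ℝ-Ring.setoid

  rationalᴷ : ℚ → Element
  rationalᴷ q = rational q , rational-∈K q

  rationalᴷ-homo : RingMorphisms.IsRingHomomorphism ℚ.+-*-rawRing K-Ring.rawRing rationalᴷ
  rationalᴷ-homo = mkRingHomomorphism ℚ.+-*-rawRing K-Ring.rawRing
    (λ p≡q → inK (rat.⟦⟧-cong p≡q)) (λ p q → inK (rat.+-homo p q)) (λ p q → inK (rat.*-homo p q))
    (λ p → inK (rat.-‿homo p)) (inK ℝ-Ring.refl) (inK ℝ-Ring.refl)
    where module rat = RingMorphisms.IsRingHomomorphism rational-homo

  extension : FiniteExtension K-commutativeRing d
  extension = record
    { rat         = rationalᴷ
    ; rat-homo    = rationalᴷ-homo
    ; basis       = basis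
    ; spanning    = λ x → let q , x≈ = spanning-≈ x in
        q , inK (ℝ-Ring.trans x≈ (ℝ-Ring.reflexive (≡.sym (proj₁-sum (λ i → rationalᴷ (q i) *ᴷ basis i)))))
    ; independent = λ q ≈0 → independent-≈ q
        (ℝ-Ring.trans (ℝ-Ring.reflexive (≡.sym (proj₁-sum (λ i → rationalᴷ (q i) *ᴷ basis i)))) (inℝ ≈0))
    ; inverse     = λ {x} x≉0 → let y , y∈K , xy≈1 = inverse-∈K (proj₂ x) (λ x≈0 → x≉0 (inK x≈0)) in
        (y , y∈K) , inK xy≈1
    }

  open TraceForm extension public using (dual)
  open Separability extension ℂ-commutativeRing

  embedding-homo : (σ : Embedding K) → RingMorphisms.IsRingHomomorphism K-Ring.rawRing ℂ-Ring.rawRing ⟦ σ ⟧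
  embedding-homo σ = mkRingHomomorphism K-Ring.rawRing ℂ-Ring.rawRing
    (λ {x} {y} x≈y → ≃ᶜ⇒≈ᶜ (σ.⟦⟧-cong {x} {y} ⌈ inℝ x≈y ⌉))
    (λ x y → transport (x +ᴷ y) (x K-Raw.+ y) (⊕-def (proj₁ x) (proj₁ y)) (+ᶜ-def (⟦ σ ⟧ x) (⟦ σ ⟧ y)) (σ.+-homo x y))
    (λ x y → transport (x *ᴷ y) (x K-Raw.* y) (⊗-def (proj₁ x) (proj₁ y)) (*ᶜ-def (⟦ σ ⟧ x) (⟦ σ ⟧ y)) (σ.*-homo x y))
    (λ x → transport (-ᴷ x) (K-Raw.- x) (⊖-def (proj₁ x)) (-ᶜ-def (⟦ σ ⟧ x)) (σ.-‿homo x))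
    (transport 0ᴷ K-Raw.0# (rational-def 0ℚ) 0ᶜ-def σ.0#-homo)
    (transport 1ᴷ K-Raw.1# (rational-def 1ℚ) 1ᶜ-def σ.1#-homo)
    where
    module K-Raw = RawRing K.rawRing
    module σ = RingMorphisms.IsRingHomomorphism (Embedding.isHomomorphism σ)
    transport : ∀ (x y : Element) {z w} → proj₁ x ≡ proj₁ y → z ≡ w → ⟦ σ ⟧ y ≃ᶜ w → ⟦ σ ⟧ x ≈ᶜ z
    transport x y x≡y z≡w σy≃w = ℂ-Ring.trans
      (≃ᶜ⇒≈ᶜ (σ.⟦⟧-cong {x} {y} ⌈ ℝ-Ring.reflexive x≡y ⌉))
      (subst (⟦ σ ⟧ y ≈ᶜ_) (≡.sym z≡w) (≃ᶜ⇒≈ᶜ σy≃w))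

  module embedding (σ : Embedding K) = RingMorphisms.IsRingHomomorphism (embedding-homo σ)

  embedding-rational : ∀ (σ τ : Embedding K) q → ⟦ σ ⟧ (rationalᴷ q) ≈ᶜ ⟦ τ ⟧ (rationalᴷ q)
  embedding-rational σ τ = ℚ-homomorphism-unique ℂ-commutativeRing (restrict σ) (restrict τ)
    where
    restrict : ∀ ρ → RingMorphisms.IsRingHomomorphism ℚ.+-*-rawRing ℂ-Ring.rawRing (⟦ ρ ⟧ ∘ rationalᴷ)
    restrict ρ = isRingHomomorphism ℂ-Ring.trans rationalᴷ-homo (embedding-homo ρ)

  dual-orthonormal : ∀ σ → ℂ-Sum.sum (λ k → ⟦ σ ⟧ (basis k) *ᶜ ⟦ σ ⟧ (dual k)) ≈ᶜ 1ᶜ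
  dual-orthonormal σ = idempotent-diagonal (embedding-homo σ)

  -- If e were 1, the intertwining relation would make the two embeddings agree at every element.
  -- Hence e ≠ 1 follows from mere non-agreement, and the idempotent e is 0.
  dual-orthogonal : ∀ {σ τ} → ¬ σ ≗ τ → ℂ-Sum.sum (λ k → ⟦ σ ⟧ (basis k) *ᶜ ⟦ τ ⟧ (dual k)) ≈ᶜ 0ᶜ
  dual-orthogonal {σ} {τ} σ≇τ = idempotent-≈0
    (idempotent-idem (embedding-homo σ) (embedding-homo τ) (embedding-rational σ τ))
    λ e≈1 → σ≇τ λ x → ≈ᶜ⇒≃ᶜ (begin
      ⟦ σ ⟧ x            ≈⟨ ℂ-Ring.*-identityʳ (⟦ σ ⟧ x) ⟨
      ⟦ σ ⟧ x *ᶜ 1ᶜ      ≈⟨ ℂ-Ring.*-congˡ e≈1 ⟨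
      ⟦ σ ⟧ x *ᶜ e       ≈⟨ idempotent-intertwines (embedding-homo σ) (embedding-homo τ) (embedding-rational σ τ) x ⟩
      ⟦ τ ⟧ x *ᶜ e       ≈⟨ ℂ-Ring.*-congˡ e≈1 ⟩
      ⟦ τ ⟧ x *ᶜ 1ᶜ      ≈⟨ ℂ-Ring.*-identityʳ (⟦ τ ⟧ x) ⟩
      ⟦ τ ⟧ x            ∎)
    where
    open SetoidReasoning ℂ-Ring.setoid
    e = idempotent ⟦ σ ⟧ ⟦ τ ⟧

-- Powers are iterated `_×_` in the multiplicative monoid, so this compares the two versions of
-- `_^_`.
×-cong : ∀ {a ℓ₁ ℓ₂} {A : Set a} {_≈₁_ : A → A → Set ℓ₁} {_≈₂_ : A → A → Set ℓ₂} {f g : A → A → A} {e e′ : A} →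
  (∀ x y → f x y ≡ g x y) → e ≡ e′ → ∀ x n →
  RawMonoidDefinitions._×_ (record { _≈_ = _≈₁_ ; _∙_ = f ; ε = e }) n x ≡
  RawMonoidDefinitions._×_ (record { _≈_ = _≈₂_ ; _∙_ = g ; ε = e′ }) n x
×-cong f≗g e≡e′ x zero        = e≡e′
×-cong {f = f} f≗g e≡e′ x (suc n) = ≡.trans (cong (f x) (×-cong f≗g e≡e′ x n)) (f≗g x _)

open RawSemiringDefinitions (Semiring.rawSemiring ℝ-Ring.semiring) using () renaming (_^_ to _^ʳ_)

power-def : ∀ x n → x ^ʳ n ≡ x ^ n
power-def = ×-cong ⊗-def (rational-def 1ℚ)

integer-def : ∀ z → integer z ≡ fromInt z
integer-def z = rational-def (fromℤ z)

⊕-def-cong : ∀ {x x′ y y′} → x ≡ x′ → y ≡ y′ → x ⊕ y ≡ x′ + y′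
⊕-def-cong {x} {y = y} ≡.refl ≡.refl = ⊕-def x y

⊗-def-cong : ∀ {x x′ y y′} → x ≡ x′ → y ≡ y′ → x ⊗ y ≡ x′ * y′
⊗-def-cong {x} {y = y} ≡.refl ≡.refl = ⊗-def x y

-- The implicit arguments and lets make both sides of each equation syntactically equal. Otherwise Agda
-- compares proofs that sequences are Cauchy.
integer-root : ∀ {θ} k (a : Vector ℤ k) →
  θ ^ʳ k ⊕ ℝ-Sum.sum (λ i → integer (a i) ⊗ θ ^ʳ toℕ i) ≈ 0ʳ → IsAlgebraicInteger θ
integer-root {θ} k a root =
  let terms = λ i → ⊗-def-cong {integer (a i)} {fromInt (a i)} {θ ^ʳ toℕ i} {θ ^ toℕ i}
                      (integer-def (a i)) (power-def θ (toℕ i))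
      eq    = ⊕-def-cong {θ ^ʳ k} {θ ^ k} {ℝ-Sum.sum λ i → integer (a i) ⊗ θ ^ʳ toℕ i}
                {sum λ i → fromInt (a i) * θ ^ toℕ i} (power-def θ k) (sum-def terms)
      final = subst₂ _≈_ eq (rational-def 0ℚ) root
  in k , a , ⌈ final ⌉

-- A lattice of algebraic integers in K

module Integrality {ℓ d} (K : RealNumberField ℓ (suc d)) where

  open RealNumberField K using (Element; basis)
  open NumberField K
  open MultiplierRing ℝ-commutativeRing integer integer-homo (proj₁ ∘ basis) public
  private
    module rat = RingMorphisms.IsRingHomomorphism rational-homo
    b : Vector ℝ (suc d)
    b = proj₁ ∘ basis

  basis≉0 : ∀ i → ¬ b i ≈ 0ʳ
  basis≉0 i bᵢ≈0 = TraceForm.basis≉0 extension i (inK bᵢ≈0)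

  -- The equations for θ bⱼ say that the basis is an eigenvector of an integer matrix with
  -- eigenvalue `θ`. Elimination gives p bₙ = 0 with `p` monic in `θ` and bₙ the last basis element,
  -- which is invertible in K; so `p` vanishes.
  multiplier-integral : ∀ {θ} → Multiplier θ → IsAlgebraicInteger θ
  multiplier-integral {θ} p =
    let k , _ , monic , pb≈0 = eigenvalue-integral (λ j → proj₁ (p j)) b (λ j → proj₂ (p j))
        _ , _ , bc≈1         = inverse-∈K (proj₂ (basis (fromℕ d))) (basis≉0 (fromℕ d))
        a , root             = monic-root monic pb≈0 bc≈1
    in integer-root k a root
    where
    open IntegralElements ℝ-commutativeRing integer integer-homo θ

  private
    integer-pos-* : ∀ m n x → integer (+ (m ℕ.* n)) ⊗ x ≈ integer (+ m) ⊗ (integer (+ n) ⊗ x)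
    integer-pos-* m n x = ℝ-Ring.trans
      (ℝ-Ring.*-congʳ (ℝ-Ring.trans (ℝ-Ring.reflexive (cong integer (ℤ.pos-* m n))) (ℝ-Int.int-* (+ m) (+ n))))
      (ℝ-Ring.*-assoc (integer (+ m)) (integer (+ n)) x)

  denominator : ∀ (x : Element) → ∃[ D ] Span (integer (+ suc D) ⊗ proj₁ x)
  denominator x = D , span-cong
    (ℝ-Ring.trans (ℝ-Ring.*-congˡ (proj₂ (spanning-≈ x)))
      (ℝ-Sum.*-distribˡ-sum (integer (+ suc D)) (λ i → rational (q i) ⊗ b i)))
    (span-sum (proj₂ common))
    where
    q = proj₁ (spanning-≈ x)
    P : Fin (suc d) → ℕ → Set
    P i D = Span (integer (+ D) ⊗ (rational (q i) ⊗ b i))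
    common : ∃[ D ] ∀ i → P i (suc D)
    common = common-multiple P
      (λ i D E p → span-cong (integer-pos-* E D (rational (q i) ⊗ b i)) (span-scale (+ E) p))
      (λ i → ℚ.denominator-1 (q i) , span-cong
        (ℝ-Ring.trans (ℝ-Ring.sym (ℝ-Ring.*-assoc (rational (ι (ℚ.↧ₙ (q i)))) (rational (q i)) (b i)))
          (ℝ-Ring.*-congʳ (ℝ-Ring.trans (ℝ-Ring.*-comm (rational (ι (ℚ.↧ₙ (q i)))) (rational (q i)))
            (ℝ-Ring.trans (ℝ-Ring.sym (rat.*-homo (q i) (ι (ℚ.↧ₙ (q i))))) (rat.⟦⟧-cong (q*↧q (q i)))))))
        (span-scale (↥ (q i)) (span-basis i)))
    D = proj₁ common

  -- Clears the denominators of the structure constants, that is, of the coordinates of the products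
  -- `b k * b j`, first over `j` and then over `k`.
  common-denominator : ∃[ D ] ∀ k → Multiplier (integer (+ suc D) ⊗ b k)
  common-denominator = common-multiple (λ k D → Multiplier (integer (+ D) ⊗ b k))
    (λ k D E p → multiplier-cong (integer-pos-* E D (b k)) (multiplier-scale (+ E) p))
    λ k → common-multiple (λ j D → Span (integer (+ D) ⊗ b k ⊗ b j))
      (λ j D E p → span-cong
        (ℝ-Ring.trans (ℝ-Ring.*-congʳ (integer-pos-* E D (b k)))
          (ℝ-Ring.*-assoc (integer (+ E)) (integer (+ D) ⊗ b k) (b j)))
        (span-scale (+ E) p))
      (λ j → let D , p = denominator (basis k *ᴷ basis j) in
        D , span-cong (ℝ-Ring.*-assoc (integer (+ suc D)) (b k) (b j)) p)

  D : ℕ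
  D = suc (proj₁ common-denominator)

  -- The coefficients `D * n k` are passed through `rationalᴷ`, because the values of an embedding
  -- on rationals are known.
  lattice-point : Vector ℤ (suc d) → Element
  lattice-point n = K-Sum.sum λ k → rationalᴷ (ι D ℚ.* fromℤ (n k)) *ᴷ basis k

  lattice-multiplier : ∀ n → Multiplier (proj₁ (lattice-point n))
  lattice-multiplier n = multiplier-cong
    (ℝ-Ring.trans (ℝ-Ring.reflexive (proj₁-sum (λ k → rationalᴷ (ι D ℚ.* fromℤ (n k)) *ᴷ basis k)))
      (ℝ-Sum.sum-cong-≋ λ k → ℝ-Ring.trans
        (ℝ-Ring.*-congʳ (ℝ-Ring.trans (rat.*-homo (ι D) (fromℤ (n k))) (ℝ-Ring.*-comm (rational (ι D)) (integer (n k)))))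
        (ℝ-Ring.*-assoc (integer (n k)) (rational (ι D)) (b k))))
    (multiplier-sum λ k → multiplier-scale (n k) (proj₂ common-denominator k))

-- Bounds and conjugation in ℂ

-- Bounding the two parts separately keeps square roots out of the estimates; the modulus enters
-- only in `modulus≤`. The price is the factor 2 in `boundedᶜ-*`.
Boundedᶜ : ℚ → ℂ → Set
Boundedᶜ b z = Bounded b (re z) × Bounded b (im z)

boundedᶜ-mono : ∀ {p q z} → p ℚ.≤ q → Boundedᶜ p z → Boundedᶜ q z
boundedᶜ-mono {z = z} p≤q (r , i) = bounded-mono {x = re z} p≤q r , bounded-mono {x = im z} p≤q i

boundedᶜ-+ : ∀ {p q z w} → Boundedᶜ p z → Boundedᶜ q w → Boundedᶜ (p ℚ.+ q) (z +ᶜ w)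
boundedᶜ-+ (r , i) (r′ , i′) = bounded-⊕ r r′ , bounded-⊕ i i′

boundedᶜ-neg : ∀ {p z} → Boundedᶜ p z → Boundedᶜ p (-ᶜ z)
boundedᶜ-neg (r , i) = bounded-⊖ r , bounded-⊖ i

boundedᶜ-* : ∀ {p q z w} → Boundedᶜ p z → Boundedᶜ q w → Boundedᶜ (p ℚ.* q ℚ.+ p ℚ.* q) (z *ᶜ w)
boundedᶜ-* (r , i) (r′ , i′) =
  bounded-⊕ (bounded-⊗ r r′) (bounded-⊖ (bounded-⊗ i i′)) , bounded-⊕ (bounded-⊗ r i′) (bounded-⊗ i r′)

boundedᶜ-0 : Boundedᶜ 0ℚ 0ᶜ
boundedᶜ-0 = bounded-rational 0ℚ , bounded-rational 0ℚ

boundedᶜ-sum : ∀ {n} {p : Vector ℚ n} {z : Vector ℂ n} → (∀ k → Boundedᶜ (p k) (z k)) →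
               Boundedᶜ (ℚ-Sum.sum p) (ℂ-Sum.sum z)
boundedᶜ-sum {zero}          b = boundedᶜ-0
boundedᶜ-sum {suc n} {p} {z} b = boundedᶜ-+ {z = z zero} {ℂ-Sum.sum (z ∘ suc)} (b zero) (boundedᶜ-sum (b ∘ suc))

boundedᶜ-cong : ∀ {p δ z w} → 0ℚ ℚ.< δ → z ≈ᶜ w → Boundedᶜ p z → Boundedᶜ (p ℚ.+ δ) w
boundedᶜ-cong 0<δ z≈w (r , i) = bounded-cong 0<δ (re-≈ z≈w) r , bounded-cong 0<δ (im-≈ z≈w) i

boundedᶜ-exists : ∀ z → ∃[ b ] 0ℚ ℚ.< b × Boundedᶜ b z
boundedᶜ-exists z =
  let a , 0<a , r = eventually-bounded (re z)
      b , 0<b , i = eventually-bounded (im z)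
  in a ℚ.+ b , +-pos 0<a 0<b ,
     bounded-mono {x = re z} (p≤p+q {a} {b} (ℚ.<⇒≤ 0<b)) r ,
     bounded-mono {x = im z} (subst (b ℚ.≤_) (ℚ.+-comm b a) (p≤p+q {b} {a} (ℚ.<⇒≤ 0<a))) i

uniform-bound : ∀ {n} (P : Fin n → ℚ → Set) → (∀ i {p q} → p ℚ.≤ q → P i p → P i q) →
  (∀ i → ∃[ b ] 0ℚ ℚ.< b × P i b) → ∃[ b ] 0ℚ ℚ.< b × ∀ i → P i b
uniform-bound {zero}  P mono p = 1ℚ , ℚ.positive⁻¹ 1ℚ , λ ()
uniform-bound {suc n} P mono p with p zero | uniform-bound (P ∘ suc) (mono ∘ suc) (p ∘ suc)
... | a , 0<a , p₀ | b , 0<b , pₛ = a ℚ.+ b , +-pos 0<a 0<b , λ where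
  zero    → mono zero (p≤p+q {a} {b} (ℚ.<⇒≤ 0<b)) p₀
  (suc i) → mono (suc i) (subst (b ℚ.≤_) (ℚ.+-comm b a) (p≤p+q {b} {a} (ℚ.<⇒≤ 0<a))) (pₛ i)

-- `conj` and `realᶜ` are `conjugate` and `fromℝ` rebuilt from the opaque operations.
conj : ℂ → ℂ
conj z = re z +i (⊖ im z)

realᶜ : ℝ → ℂ
realᶜ x = x +i 0ʳ

module Conjugation where

  open ℝ-Int.Solver

  conj-cong : ∀ {z w} → z ≈ᶜ w → conj z ≈ᶜ conj w
  conj-cong p = re-≈ p ,ᶜ ℝ-Ring.-‿cong (im-≈ p)

  conj-+ : ∀ z w → conj (z +ᶜ w) ≈ᶜ conj z +ᶜ conj w
  conj-+ z w = ℝ-Ring.refl ,ᶜ solve 2 (λ a b → :- (a :+ b) := :- a :+ :- b) ℝ-Ring.refl (im z) (im w)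

  conj-* : ∀ z w → conj (z *ᶜ w) ≈ᶜ conj z *ᶜ conj w
  conj-* z w =
    solve 4 (λ a b c d → a :* c :+ :- (b :* d) := a :* c :+ :- (:- b :* :- d)) ℝ-Ring.refl (re z) (im z) (re w) (im w) ,ᶜ
    solve 4 (λ a b c d → :- (a :* d :+ b :* c) := a :* :- d :+ :- b :* c) ℝ-Ring.refl (re z) (im z) (re w) (im w)

  conj-0 : conj 0ᶜ ≈ᶜ 0ᶜ
  conj-0 = ℝ-Ring.refl ,ᶜ solve 0 (:- con 0ℤ := con 0ℤ) ℝ-Ring.refl

  conj-realᶜ : ∀ x → conj (realᶜ x) ≈ᶜ realᶜ x
  conj-realᶜ x = ℝ-Ring.refl ,ᶜ solve 0 (:- con 0ℤ := con 0ℤ) ℝ-Ring.refl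

  conj-involutive : ∀ z → conj (conj z) ≈ᶜ z
  conj-involutive z = ℝ-Ring.refl ,ᶜ solve 1 (λ a → :- (:- a) := a) ℝ-Ring.refl (im z)

  conj-sum : ∀ {n} (z : Vector ℂ n) → conj (ℂ-Sum.sum z) ≈ᶜ ℂ-Sum.sum (conj ∘ z)
  conj-sum {zero}  z = conj-0
  conj-sum {suc n} z = ℂ-Ring.trans (conj-+ (z zero) (ℂ-Sum.sum (z ∘ suc))) (ℂ-Ring.+-congˡ {conj (z zero)} (conj-sum (z ∘ suc)))

  realᶜ-+ : ∀ x y → realᶜ (x ⊕ y) ≈ᶜ realᶜ x +ᶜ realᶜ y
  realᶜ-+ x y = ℝ-Ring.refl ,ᶜ solve 0 (con 0ℤ := con 0ℤ :+ con 0ℤ) ℝ-Ring.refl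

  realᶜ-* : ∀ x y → realᶜ (x ⊗ y) ≈ᶜ realᶜ x *ᶜ realᶜ y
  realᶜ-* x y =
    solve 2 (λ x y → x :* y := x :* y :+ :- (con 0ℤ :* con 0ℤ)) ℝ-Ring.refl x y ,ᶜ
    solve 2 (λ x y → con 0ℤ := x :* con 0ℤ :+ con 0ℤ :* y) ℝ-Ring.refl x y

  realᶜ-neg : ∀ x → realᶜ (⊖ x) ≈ᶜ -ᶜ realᶜ x
  realᶜ-neg x = ℝ-Ring.refl ,ᶜ solve 0 (con 0ℤ := :- con 0ℤ) ℝ-Ring.refl

  realᶜ-rational-homo : RingMorphisms.IsRingHomomorphism ℚ.+-*-rawRing ℂ-Ring.rawRing (realᶜ ∘ rational)
  realᶜ-rational-homo = mkRingHomomorphism ℚ.+-*-rawRing ℂ-Ring.rawRing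
    (λ p≡q → ℂ-Ring.reflexive (cong (realᶜ ∘ rational) p≡q))
    (λ p q → ℂ-Ring.trans (rat.+-homo p q ,ᶜ ℝ-Ring.refl) (realᶜ-+ (rational p) (rational q)))
    (λ p q → ℂ-Ring.trans (rat.*-homo p q ,ᶜ ℝ-Ring.refl) (realᶜ-* (rational p) (rational q)))
    (λ p → ℂ-Ring.trans (rat.-‿homo p ,ᶜ ℝ-Ring.refl) (realᶜ-neg (rational p)))
    ℂ-Ring.refl ℂ-Ring.refl
    where module rat = RingMorphisms.IsRingHomomorphism rational-homo

  halfᶜ : ℂ
  halfᶜ = realᶜ (rational ½)

  halfᶜ-double : ∀ z → halfᶜ *ᶜ (z +ᶜ z) ≈ᶜ z
  halfᶜ-double z = begin
    halfᶜ *ᶜ (z +ᶜ z)          ≈⟨ ℂ-Ring.distribˡ halfᶜ z z ⟩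
    halfᶜ *ᶜ z +ᶜ halfᶜ *ᶜ z   ≈⟨ ℂ-Ring.distribʳ z halfᶜ halfᶜ ⟨
    (halfᶜ +ᶜ halfᶜ) *ᶜ z      ≈⟨ ℂ-Ring.*-congʳ (RingMorphisms.IsRingHomomorphism.+-homo realᶜ-rational-homo ½ ½) ⟨
    1ᶜ *ᶜ z                    ≈⟨ ℂ-Ring.*-identityˡ z ⟩
    z                          ∎
    where open SetoidReasoning ℂ-Ring.setoid

  realᶜ-re : ∀ z → realᶜ (re z) ≈ᶜ halfᶜ *ᶜ (z +ᶜ conj z)
  realᶜ-re z = ℂ-Ring.trans (ℂ-Ring.sym (halfᶜ-double (realᶜ (re z)))) (ℂ-Ring.*-congˡ {halfᶜ}
    (ℝ-Ring.refl ,ᶜ solve 1 (λ a → con 0ℤ :+ con 0ℤ := a :+ :- a) ℝ-Ring.refl (im z)))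

open Conjugation

-- Symmetric vectors lie near lattice points

module Approximation {ℓ d m} (K : RealNumberField ℓ (suc d)) (σ : Fin m → Embedding K)
  (distinct : ∀ i j → i ≢ j → ¬ σ i ≗ σ j)
  (bar : Fin m → Fin m) (σ-bar : ∀ i x → ⟦ σ (bar i) ⟧ x ≈ᶜ conj (⟦ σ i ⟧ x))
  where

  open RealNumberField K using (Element; basis)
  open NumberField K
  open Integrality K

  Symmetric : Vector ℂ m → Set
  Symmetric y = ∀ i → y (bar i) ≈ᶜ conj (y i)

  private
    -- N is a right inverse of M.
    M : Fin m → Fin (suc d) → ℂ
    M i k = ⟦ σ i ⟧ (basis k)

    N : Fin (suc d) → Fin m → ℂ
    N k j = ⟦ σ j ⟧ (dual k)

  module _ (y : Vector ℂ m) (y-symmetric : Symmetric y) where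

    coefficient : Fin (suc d) → ℂ
    coefficient k = ℂ-Sum.sum λ j → N k j *ᶜ y j

    interpolates : ∀ i → ℂ-Sum.sum (λ k → M i k *ᶜ coefficient k) ≈ᶜ y i
    interpolates = right-inverse-apply ℂ-commutativeRing M N
      (λ i → dual-orthonormal (σ i)) (λ {i} {j} i≢j → dual-orthogonal {σ i} {σ j} (distinct i j i≢j)) y

    -- Conjugate the equation at `bar i`: row `bar i` of `M` becomes row `i`, and by symmetry
    -- `y (bar i)` becomes `y i`.
    conj-interpolates : ∀ i → ℂ-Sum.sum (λ k → M i k *ᶜ conj (coefficient k)) ≈ᶜ y i
    conj-interpolates i = begin
      ℂ-Sum.sum (λ k → M i k *ᶜ conj (coefficient k))
        ≈⟨ ℂ-Sum.sum-cong-≋ (λ k → ℂ-Ring.*-congʳ {conj (coefficient k)} (ℂ-Ring.trans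
             (conj-cong (σ-bar i (basis k))) (conj-involutive (M i k)))) ⟨
      ℂ-Sum.sum (λ k → conj (M (bar i) k) *ᶜ conj (coefficient k))
        ≈⟨ ℂ-Sum.sum-cong-≋ (λ k → conj-* (M (bar i) k) (coefficient k)) ⟨
      ℂ-Sum.sum (λ k → conj (M (bar i) k *ᶜ coefficient k))
        ≈⟨ conj-sum (λ k → M (bar i) k *ᶜ coefficient k) ⟨
      conj (ℂ-Sum.sum (λ k → M (bar i) k *ᶜ coefficient k))
        ≈⟨ conj-cong (ℂ-Ring.trans (interpolates (bar i)) (y-symmetric i)) ⟩
      conj (conj (y i))
        ≈⟨ conj-involutive (y i) ⟩
      y i ∎
      where open SetoidReasoning ℂ-Ring.setoid

    -- The coefficients and their conjugates solve the same system, hence so do their means, which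
    -- are the real parts. No uniqueness of solutions is invoked.
    re-interpolates : ∀ i → ℂ-Sum.sum (λ k → M i k *ᶜ realᶜ (re (coefficient k))) ≈ᶜ y i
    re-interpolates i = begin
      ℂ-Sum.sum (λ k → M i k *ᶜ realᶜ (re (t k)))
        ≈⟨ ℂ-Sum.sum-cong-≋ (λ k → ℂ-Ring.trans (ℂ-Ring.*-congˡ {M i k} (realᶜ-re (t k)))
             (ℂ-Ring.trans (x∙yz≈y∙xz (M i k) halfᶜ (t k +ᶜ conj (t k)))
               (ℂ-Ring.*-congˡ {halfᶜ} (ℂ-Ring.distribˡ (M i k) (t k) (conj (t k)))))) ⟩
      ℂ-Sum.sum (λ k → halfᶜ *ᶜ (M i k *ᶜ t k +ᶜ M i k *ᶜ conj (t k)))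
        ≈⟨ ℂ-Sum.*-distribˡ-sum halfᶜ (λ k → M i k *ᶜ t k +ᶜ M i k *ᶜ conj (t k)) ⟨
      halfᶜ *ᶜ ℂ-Sum.sum (λ k → M i k *ᶜ t k +ᶜ M i k *ᶜ conj (t k))
        ≈⟨ ℂ-Ring.*-congˡ {halfᶜ} (ℂ-Ring.trans
             (ℂ-Sum.∑-distrib-+ (λ k → M i k *ᶜ t k) (λ k → M i k *ᶜ conj (t k)))
             (ℂ-Ring.+-cong (interpolates i) (conj-interpolates i))) ⟩
      halfᶜ *ᶜ (y i +ᶜ y i)
        ≈⟨ halfᶜ-double (y i) ⟩
      y i ∎
      where
      open SetoidReasoning ℂ-Ring.setoid
      open CommutativeSemigroupProperties ℂ-Ring.*-commutativeSemigroup using (x∙yz≈y∙xz)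
      t = coefficient

  embedding-rationalᶜ : ∀ i q → ⟦ σ i ⟧ (rationalᴷ q) ≈ᶜ realᶜ (rational q)
  embedding-rationalᶜ i = ℚ-homomorphism-unique ℂ-commutativeRing
    (isRingHomomorphism ℂ-Ring.trans rationalᴷ-homo (embedding-homo (σ i))) realᶜ-rational-homo

  embedding-lattice-point : ∀ i n →
    ⟦ σ i ⟧ (lattice-point n) ≈ᶜ ℂ-Sum.sum λ k → M i k *ᶜ realᶜ (rational (ι D ℚ.* fromℤ (n k)))
  embedding-lattice-point i n = ℂ-Ring.trans
    (Separability.homo-sum extension ℂ-commutativeRing (embedding-homo (σ i)) (λ k → rationalᴷ (ι D ℚ.* fromℤ (n k)) *ᴷ basis k))
    (ℂ-Sum.sum-cong-≋ λ k → ℂ-Ring.trans (embedding.*-homo (σ i) (rationalᴷ (ι D ℚ.* fromℤ (n k))) (basis k))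
      (ℂ-Ring.trans (ℂ-Ring.*-congʳ {M i k} (embedding-rationalᶜ i (ι D ℚ.* fromℤ (n k))))
        (ℂ-Ring.*-comm (realᶜ (rational (ι D ℚ.* fromℤ (n k)))) (M i k))))

  private
    basis-bound : ∃[ b ] 0ℚ ℚ.< b × ∀ i k → Boundedᶜ b (M i k)
    basis-bound = uniform-bound (λ i b → ∀ k → Boundedᶜ b (M i k))
      (λ i p≤q bounded k → boundedᶜ-mono {z = M i k} p≤q (bounded k))
      λ i → uniform-bound (λ k b → Boundedᶜ b (M i k)) (λ k → boundedᶜ-mono {z = M i k}) λ k → boundedᶜ-exists (M i k)

    -- `B` bounds the parts of all σᵢ(bₖ). `ρ` bounds the error of rounding a coefficient to a
    -- multiple of `D`: `ι D` from the floor and 1 from the rational approximation.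
    B ρ : ℚ
    B = proj₁ basis-bound
    ρ = ι D ℚ.+ 1ℚ

    0<ιD : 0ℚ ℚ.< ι D
    0<ιD = ℚ.positive⁻¹ (ι D)

    0<ρ : 0ℚ ℚ.< ρ
    0<ρ = +-pos {ι D} {1ℚ} 0<ιD (ℚ.positive⁻¹ 1ℚ)

    0<Bρ : 0ℚ ℚ.< B ℚ.* ρ ℚ.+ B ℚ.* ρ
    0<Bρ = +-pos {B ℚ.* ρ} {B ℚ.* ρ} (*-pos {B} {ρ} 0<B 0<ρ) (*-pos {B} {ρ} 0<B 0<ρ)
      where 0<B = proj₁ (proj₂ basis-bound)

    sum-nonNeg : ∀ n → 0ℚ ℚ.≤ ℚ-Sum.sum {n} λ _ → B ℚ.* ρ ℚ.+ B ℚ.* ρ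
    sum-nonNeg zero    = ℚ.≤-refl
    sum-nonNeg (suc n) = ℚ.+-mono-≤ {0ℚ} {B ℚ.* ρ ℚ.+ B ℚ.* ρ} (ℚ.<⇒≤ 0<Bρ) (sum-nonNeg n)

  -- The error vector is `M` applied to the rounding errors. Each of the `suc d` terms has parts at
  -- most `B * ρ + B * ρ`; the final 1 pays for one use of `boundedᶜ-cong`.
  covering-radius : ℚ
  covering-radius = ℚ-Sum.sum {suc d} (λ _ → B ℚ.* ρ ℚ.+ B ℚ.* ρ) ℚ.+ 1ℚ

  0<covering-radius : 0ℚ ℚ.< covering-radius
  0<covering-radius = ℚ.+-mono-≤-< {0ℚ} {ℚ-Sum.sum {suc d} (λ _ → B ℚ.* ρ ℚ.+ B ℚ.* ρ)} (sum-nonNeg (suc d)) (ℚ.positive⁻¹ 1ℚ)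

  covering : ∀ y → Symmetric y → Σ[ θ ∈ Element ] Multiplier (proj₁ θ) ×
    ∀ i → Boundedᶜ covering-radius (y i +ᶜ -ᶜ ⟦ σ i ⟧ θ)
  covering y y-symmetric = lattice-point n , lattice-multiplier n , λ i →
    boundedᶜ-cong (ℚ.positive⁻¹ 1ℚ) (error i) (boundedᶜ-sum {z = λ k → M i k *ᶜ realᶜ (e k)} λ k →
      boundedᶜ-* {z = M i k} {realᶜ (e k)} (proj₂ (proj₂ basis-bound) i k)
        (proj₂ (rounding k) , bounded-mono {x = 0ʳ} (ℚ.<⇒≤ 0<ρ) (bounded-rational 0ℚ)))
    where
    t = coefficient y y-symmetric
    rounding : ∀ k → ∃[ n ] Bounded ρ (re (t k) ⊕ ⊖ rational (ι D ℚ.* fromℤ n))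
    rounding k = round (re (t k)) (ι D) 1ℚ 0<ιD (ℚ.positive⁻¹ 1ℚ)
    n : Vector ℤ (suc d)
    n k = proj₁ (rounding k)
    u e : Fin (suc d) → ℝ
    u k = rational (ι D ℚ.* fromℤ (n k))
    e k = re (t k) ⊕ ⊖ u k
    error : ∀ i → ℂ-Sum.sum (λ k → M i k *ᶜ realᶜ (e k)) ≈ᶜ y i +ᶜ -ᶜ ⟦ σ i ⟧ (lattice-point n)
    error i = begin
      ℂ-Sum.sum (λ k → M i k *ᶜ realᶜ (e k))
        ≈⟨ ℂ-Sum.sum-cong-≋ (λ k → ℂ-Ring.trans
             (ℂ-Ring.*-congˡ {M i k} (ℂ-Ring.trans (realᶜ-+ (re (t k)) (⊖ u k)) (ℂ-Ring.+-congˡ {realᶜ (re (t k))} (realᶜ-neg (u k)))))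
             (ℂ-Ring.trans (ℂ-Ring.distribˡ (M i k) (realᶜ (re (t k))) (-ᶜ realᶜ (u k)))
               (ℂ-Ring.+-congˡ {M i k *ᶜ realᶜ (re (t k))} (ℂ-Ring.trans (ℂ-Ring.sym (-‿distribʳ-* (M i k) (realᶜ (u k))))
                 (ℂ-Ring.sym (-1*x≈-x (M i k *ᶜ realᶜ (u k)))))))) ⟩
      ℂ-Sum.sum (λ k → M i k *ᶜ realᶜ (re (t k)) +ᶜ (-ᶜ 1ᶜ) *ᶜ (M i k *ᶜ realᶜ (u k)))
        ≈⟨ ℂ-Sum.∑-distrib-+ (λ k → M i k *ᶜ realᶜ (re (t k))) (λ k → (-ᶜ 1ᶜ) *ᶜ (M i k *ᶜ realᶜ (u k))) ⟩
      ℂ-Sum.sum (λ k → M i k *ᶜ realᶜ (re (t k))) +ᶜ ℂ-Sum.sum (λ k → (-ᶜ 1ᶜ) *ᶜ (M i k *ᶜ realᶜ (u k)))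
        ≈⟨ ℂ-Ring.+-cong (re-interpolates y y-symmetric i)
             (ℂ-Ring.sym (ℂ-Sum.*-distribˡ-sum (-ᶜ 1ᶜ) (λ k → M i k *ᶜ realᶜ (u k)))) ⟩
      y i +ᶜ (-ᶜ 1ᶜ) *ᶜ ℂ-Sum.sum (λ k → M i k *ᶜ realᶜ (u k))
        ≈⟨ ℂ-Ring.+-congˡ {y i} (-1*x≈-x (ℂ-Sum.sum (λ k → M i k *ᶜ realᶜ (u k)))) ⟩
      y i +ᶜ -ᶜ ℂ-Sum.sum (λ k → M i k *ᶜ realᶜ (u k))
        ≈⟨ ℂ-Ring.+-congˡ {y i} (ℂ-Ring.-‿cong (embedding-lattice-point i n)) ⟨
      y i +ᶜ -ᶜ ⟦ σ i ⟧ (lattice-point n) ∎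
      where
      open SetoidReasoning ℂ-Ring.setoid
      open RingProperties ℂ-Ring.ring using (-‿distribʳ-*; -1*x≈-x)

-- Cells of a bounded set of reals

encode : ∀ {M} (n : ℤ) → ℤ.∣ n ∣ ℕ.< M → Fin (2 ℕ.* M)
encode n@(+ _)      <M = Fin.combine {2} zero (Fin.fromℕ< <M)
encode n@(ℤ.-[1+ _ ]) <M = Fin.combine {2} (suc zero) (Fin.fromℕ< <M)

encode-injective : ∀ {M} n n′ (p : ℤ.∣ n ∣ ℕ.< M) (p′ : ℤ.∣ n′ ∣ ℕ.< M) → encode n p ≡ encode n′ p′ → n ≡ n′
encode-injective (+ k) (+ l) p p′ eq =
  cong +_ (Fin.fromℕ<-injective k l p p′ (proj₂ (Fin.combine-injective {2} zero (Fin.fromℕ< p) zero (Fin.fromℕ< p′) eq)))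
encode-injective ℤ.-[1+ k ] ℤ.-[1+ l ] p p′ eq =
  cong (λ j → ℤ.- (+ j)) (Fin.fromℕ<-injective (suc k) (suc l) p p′
    (proj₂ (Fin.combine-injective {2} (suc zero) (Fin.fromℕ< p) (suc zero) (Fin.fromℕ< p′) eq)))
encode-injective (+ k) ℤ.-[1+ l ] p p′ eq
  with () ← proj₁ (Fin.combine-injective {2} zero (Fin.fromℕ< p) (suc zero) (Fin.fromℕ< p′) eq)
encode-injective ℤ.-[1+ k ] (+ l) p p′ eq
  with () ← proj₁ (Fin.combine-injective {2} (suc zero) (Fin.fromℕ< p) zero (Fin.fromℕ< p′) eq)

∣fromℤ∣ : ∀ n → ℚ.∣ fromℤ n ∣ ≡ ι ℤ.∣ n ∣
∣fromℤ∣ (+ n)       = ≡.refl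
∣fromℤ∣ ℤ.-[1+ n ]  = ≡.refl

opaque
  unfolding _⊕_ ⊖_ rational

  bounded-rational⁻¹ : ∀ {b q} → Bounded b (rational q) → ℚ.∣ q ∣ ℚ.≤ b
  bounded-rational⁻¹ = eventually-witness

  near-bounded : ∀ {b ρ q} x → Bounded b x → Bounded ρ (x ⊕ ⊖ rational q) → ℚ.∣ q ∣ ℚ.≤ b ℚ.+ ρ
  near-bounded {b} {ρ} {q} x ≤b ≤ρ = eventually-witness (eventually-zip
    (λ n ≤b ≤ρ → subst (λ p → ℚ.∣ p ∣ ℚ.≤ b ℚ.+ ρ)
      (+-*-Solver.solve 2 (λ x q → +-*-Solver._:-_ x (+-*-Solver._:-_ x q) +-*-Solver.:= q) ≡.refl (seq x n) q)
      (ℚ.≤-trans (ℚ.∣p-q∣≤∣p∣+∣q∣ (seq x n) (seq x n ℚ.- q)) (ℚ.+-mono-≤ ≤b ≤ρ))) ≤b ≤ρ)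

  both-near : ∀ {ρ q} x y → Bounded ρ (x ⊕ ⊖ rational q) → Bounded ρ (y ⊕ ⊖ rational q) → Bounded (ρ ℚ.+ ρ) (x ⊕ ⊖ y)
  both-near {ρ} {q} x y = eventually-zip λ n x≤ρ y≤ρ →
    ℚ.≤-trans (∣p-r∣≤ (seq x n) q (seq y n))
      (ℚ.+-mono-≤ x≤ρ (subst (ℚ._≤ ρ) (∣p-q∣≡∣q-p∣ (seq y n) q) y≤ρ))

-- A cell records which multiple of `δ` was found by `round`. This depends on the representing
-- sequence and is no function on the reals, but a shared index is all that bounds a difference.
module Cells (C δ : ℚ) (0<δ : 0ℚ ℚ.< δ) where

  private
    -- Rounding to multiples of `δ` errs by at most `ρ`, so an index `n` has δ |n| ≤ C + ρ, that is
    -- |n| ≤ `p`; `width` is a natural number above `p`.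
    ρ p : ℚ
    ρ = δ ℚ.+ δ
    p = scale δ (C ℚ.+ ρ) 0<δ

  width : ℕ
  width = suc ℤ.∣ ↥ p ∣

  private
    index : ∀ x → ∃[ n ] Bounded ρ (x ⊕ ⊖ rational (δ ℚ.* fromℤ n))
    index x = round x δ δ 0<δ 0<δ

    index-bounded : ∀ x → Bounded C x → ℤ.∣ proj₁ (index x) ∣ ℕ.< width
    index-bounded x x≤C = ℕ.≰⇒> λ width≤ → ℚ.<-irrefl ≡.refl
      (ℚ.<-≤-trans (archimedean p) (ℚ.≤-trans (ι-mono-≤ width≤) ι≤p))
      where
      n = proj₁ (index x)
      δι≤ : δ ℚ.* ι ℤ.∣ n ∣ ℚ.≤ C ℚ.+ ρ
      δι≤ = subst (ℚ._≤ C ℚ.+ ρ)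
        (≡.trans (ℚ.∣p*q∣≡∣p∣*∣q∣ δ (fromℤ n)) (cong₂ ℚ._*_ (ℚ.0≤p⇒∣p∣≡p (ℚ.<⇒≤ 0<δ)) (∣fromℤ∣ n)))
        (near-bounded x x≤C (proj₂ (index x)))
      ι≤p : ι ℤ.∣ n ∣ ℚ.≤ p
      ι≤p = ℚ.*-cancelˡ-≤-pos δ {{ℚ.positive 0<δ}}
        (subst (δ ℚ.* ι ℤ.∣ n ∣ ℚ.≤_) (≡.sym (scale-* {δ} {C ℚ.+ ρ} 0<δ)) δι≤)

  cell : ∀ x → Bounded C x → Fin (2 ℕ.* width)
  cell x x≤C = encode (proj₁ (index x)) (index-bounded x x≤C)

  cell-small : ∀ x y (x≤C : Bounded C x) (y≤C : Bounded C y) → cell x x≤C ≡ cell y y≤C → Bounded (ρ ℚ.+ ρ) (x ⊕ ⊖ y)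
  cell-small x y x≤C y≤C eq = both-near x y (proj₂ (index x))
    (subst (λ n → Bounded ρ (y ⊕ ⊖ rational (δ ℚ.* fromℤ n))) (≡.sym same) (proj₂ (index y)))
    where
    same : proj₁ (index x) ≡ proj₁ (index y)
    same = encode-injective (proj₁ (index x)) (proj₁ (index y)) (index-bounded x x≤C) (index-bounded y y≤C) eq

  cellᶜ : ∀ z → Boundedᶜ C z → Fin (2 ℕ.* width ℕ.* (2 ℕ.* width))
  cellᶜ z (r , i) = Fin.combine (cell (re z) r) (cell (im z) i)

  cellᶜ-small : ∀ z w (z≤C : Boundedᶜ C z) (w≤C : Boundedᶜ C w) → cellᶜ z z≤C ≡ cellᶜ w w≤C → Boundedᶜ (ρ ℚ.+ ρ) (z +ᶜ -ᶜ w)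
  cellᶜ-small z w (r , i) (r′ , i′) eq =
    let p , q = Fin.combine-injective (cell (re z) r) (cell (im z) i) (cell (re w) r′) (cell (im w) i′) eq
    in cell-small (re z) (re w) r r′ p , cell-small (im z) (im w) i i′ q

  pigeonhole : ∀ {m} (z : ℕ → Vector ℂ m) → (∀ k i → Boundedᶜ C (z k i)) →
    ∃[ k ] ∃[ l ] k ℕ.< l × ∀ i → Boundedᶜ (ρ ℚ.+ ρ) (z k i +ᶜ -ᶜ z l i)
  pigeonhole {m} z z≤C = toℕ k , toℕ l , k<l , λ i →
    cellᶜ-small (z (toℕ k) i) (z (toℕ l) i) (z≤C (toℕ k) i) (z≤C (toℕ l) i) (same i)
    where
    cells : ℕ → Fin m → Fin (2 ℕ.* width ℕ.* (2 ℕ.* width))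
    cells k i = cellᶜ (z k i) (z≤C k i)
    code : ℕ → Fin ((2 ℕ.* width ℕ.* (2 ℕ.* width)) ℕ.^ m)
    code k = Fin.funToFin (cells k)
    -- With N cells for a complex number, a vector of cells is one of N ^ m codes; the indices 0,
    -- ..., N ^ m are one too many.
    collision = Fin.pigeonhole (ℕ.n<1+n ((2 ℕ.* width ℕ.* (2 ℕ.* width)) ℕ.^ m)) (code ∘ toℕ)
    k = proj₁ collision
    l = proj₁ (proj₂ collision)
    k<l = proj₁ (proj₂ (proj₂ collision))
    same : ∀ i → cells (toℕ k) i ≡ cells (toℕ l) i
    same i = ≡.trans (≡.sym (Fin.finToFun-funToFin (cells (toℕ k)) i))
      (≡.trans (cong (λ c → Fin.finToFun c i) (proj₂ (proj₂ (proj₂ collision)))) (Fin.finToFun-funToFin (cells (toℕ l)) i))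

-- A nonzero integer small at all places but the first, and rescaling by it

module SmallElement {ℓ d m} (K : RealNumberField ℓ (suc d)) (σ : Fin (suc m) → Embedding K)
  (distinct : ∀ i j → i ≢ j → ¬ σ i ≗ σ j)
  (bar : Fin (suc m) → Fin (suc m)) (σ-bar : ∀ i x → ⟦ σ (bar i) ⟧ x ≈ᶜ conj (⟦ σ i ⟧ x))
  (bar-zero : bar zero ≡ zero) (bar-suc : ∀ i → ∃[ j ] bar (suc i) ≡ suc j)
  where

  open RealNumberField K using (Element; basis)
  open NumberField K
  open Integrality K
  open Approximation K σ distinct bar σ-bar
  open SetoidReasoning ℂ-Ring.setoid
  open RingProperties ℂ-Ring.ring using (-‿distribʳ-*)

  private
    C X : ℚ
    C = covering-radius
    -- Exceeds 2C, so that lattice points near multiples of X are distinct.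
    X = C ℚ.+ C ℚ.+ (1ℚ ℚ.+ 1ℚ)

    target : ℕ → Vector ℂ (suc m)
    target k zero    = realᶜ (rational (ι k ℚ.* X))
    target k (suc i) = 0ᶜ

    -- `bar` fixes index 0 and keeps the other indices away from it, so a vector supported at 0 with
    -- a real entry there is symmetric.
    target-symmetric : ∀ k → Symmetric (target k)
    target-symmetric k zero = ℂ-Ring.trans (ℂ-Ring.reflexive (cong (target k) bar-zero))
      (ℂ-Ring.sym (conj-realᶜ (rational (ι k ℚ.* X))))
    target-symmetric k (suc i) = ℂ-Ring.trans (ℂ-Ring.reflexive (cong (target k) (proj₂ (bar-suc i)))) (ℂ-Ring.sym conj-0)

    point : ℕ → Element
    point k = proj₁ (covering (target k) (target-symmetric k))

    point-multiplier : ∀ k → Multiplier (proj₁ (point k))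
    point-multiplier k = proj₁ (proj₂ (covering (target k) (target-symmetric k)))

    error : ℕ → Vector ℂ (suc m)
    error k i = target k i +ᶜ -ᶜ ⟦ σ i ⟧ (point k)

    error-bounded : ∀ k i → Boundedᶜ C (error k i)
    error-bounded k = proj₂ (proj₂ (covering (target k) (target-symmetric k)))

    difference : ℕ → ℕ → Element
    difference k l = point l +ᴷ -ᴷ point k

    regroup : ∀ a b u v → (a +ᶜ -ᶜ u) +ᶜ -ᶜ (b +ᶜ -ᶜ v) ≈ᶜ (a +ᶜ -ᶜ b) +ᶜ (v +ᶜ -ᶜ u)
    regroup a b u v = component (re a) (re b) (re u) (re v) ,ᶜ component (im a) (im b) (im u) (im v)
      where
      open ℝ-Int.Solver
      component : ∀ a b u v → (a ⊕ ⊖ u) ⊕ ⊖ (b ⊕ ⊖ v) ≈ (a ⊕ ⊖ b) ⊕ (v ⊕ ⊖ u)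
      component = solve 4 (λ a b u v → (a :- u) :- (b :- v) := (a :- b) :+ (v :- u)) ℝ-Ring.refl

    -- Used in two ways: at a successor index both targets are 0 and the difference of points has a
    -- small image; at index 0 the gap between the targets shows that the points differ.
    error-difference : ∀ k l i →
      error k i +ᶜ -ᶜ error l i ≈ᶜ (target k i +ᶜ -ᶜ target l i) +ᶜ ⟦ σ i ⟧ (difference k l)
    error-difference k l i = ℂ-Ring.trans (regroup (target k i) (target l i) (⟦ σ i ⟧ (point k)) (⟦ σ i ⟧ (point l)))
      (ℂ-Ring.+-congˡ {target k i +ᶜ -ᶜ target l i} (ℂ-Ring.sym (ℂ-Ring.trans
        (embedding.+-homo (σ i) (point l) (-ᴷ point k))
        (ℂ-Ring.+-congˡ {⟦ σ i ⟧ (point l)} (embedding.-‿homo (σ i) (point k))))))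

    -- If the points were equal, their errors at index 0 would differ by the gap (l - k) X ≥ X of
    -- the targets, although each error is at most C.
    difference-nonzero : ∀ k l → k ℕ.< l → ¬ proj₁ (difference k l) ≈ 0ʳ
    difference-nonzero k l k<l ≈0 = ℚ.<-irrefl ≡.refl (ℚ.<-≤-trans small large)
      where
      open +-*-Solver hiding (⟦_⟧)
      p q : ℚ
      p = ι k ℚ.* X
      q = ι l ℚ.* X
      gap : error k zero +ᶜ -ᶜ error l zero ≈ᶜ realᶜ (rational (p ℚ.- q))
      gap = begin
        error k zero +ᶜ -ᶜ error l zero
          ≈⟨ error-difference k l zero ⟩
        (realᶜ (rational p) +ᶜ -ᶜ realᶜ (rational q)) +ᶜ ⟦ σ zero ⟧ (difference k l)
          ≈⟨ ℂ-Ring.+-congˡ {realᶜ (rational p) +ᶜ -ᶜ realᶜ (rational q)}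
               (ℂ-Ring.trans (embedding.⟦⟧-cong (σ zero) {difference k l} {0ᴷ} (inK ≈0)) (embedding.0#-homo (σ zero))) ⟩
        (realᶜ (rational p) +ᶜ -ᶜ realᶜ (rational q)) +ᶜ 0ᶜ
          ≈⟨ ℂ-Ring.+-identityʳ (realᶜ (rational p) +ᶜ -ᶜ realᶜ (rational q)) ⟩
        realᶜ (rational p) +ᶜ -ᶜ realᶜ (rational q)
          ≈⟨ ℂ-Ring.trans (hom.+-homo p (ℚ.- q)) (ℂ-Ring.+-congˡ {realᶜ (rational p)} (hom.-‿homo q)) ⟨
        realᶜ (rational (p ℚ.- q)) ∎
        where module hom = RingMorphisms.IsRingHomomorphism realᶜ-rational-homo
      -- The 1 is the cost of `boundedᶜ-cong` along `gap`; the summand 2 in `X` exceeds it.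
      close : ℚ.∣ p ℚ.- q ∣ ℚ.≤ C ℚ.+ C ℚ.+ 1ℚ
      close = bounded-rational⁻¹ (proj₁ (boundedᶜ-cong (ℚ.positive⁻¹ 1ℚ) gap
        (boundedᶜ-+ {z = error k zero} {w = -ᶜ error l zero} (error-bounded k zero)
          (boundedᶜ-neg {z = error l zero} (error-bounded l zero)))))
      small : ℚ.∣ p ℚ.- q ∣ ℚ.< X
      small = ℚ.≤-<-trans close (ℚ.+-monoʳ-< (C ℚ.+ C) (subst (ℚ._< 1ℚ ℚ.+ 1ℚ) (ℚ.+-identityʳ 1ℚ) (ℚ.+-monoʳ-< 1ℚ (ℚ.positive⁻¹ 1ℚ))))
      0≤X : 0ℚ ℚ.≤ X
      0≤X = ℚ.≤-trans (ℚ.0≤∣p∣ (p ℚ.- q)) (ℚ.<⇒≤ small)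
      step : ι (suc k) ℚ.* X ℚ.≤ q
      step = ℚ.*-monoʳ-≤-nonNeg X {{ℚ.nonNegative 0≤X}} (ι-mono-≤ k<l)
      large : X ℚ.≤ ℚ.∣ p ℚ.- q ∣
      large = ℚ.≤-trans
        (subst₂ ℚ._≤_ (≡.trans (cong (λ j → j ℚ.* X ℚ.- p) (ι-suc k))
            (solve 2 (λ k x → (con 1ℚ :+ k) :* x :- k :* x := x) ≡.refl (ι k) X))
          (solve 2 (λ p q → q :- p := :- (p :- q)) ≡.refl p q)
          (ℚ.+-monoˡ-≤ (ℚ.- p) step))
        (-p≤∣p∣ (p ℚ.- q))

  small-element : ∀ η → 0ℚ ℚ.< η → Σ[ α ∈ Element ] Multiplier (proj₁ α) × (¬ proj₁ α ≈ 0ʳ) ×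
    ∀ i → Boundedᶜ η (⟦ σ (suc i) ⟧ α)
  small-element η 0<η =
    let k , l , k<l , close = pigeonhole (λ k i → error k (suc i)) (λ k i → error-bounded k (suc i))
    in difference k l , multiplier-+ (point-multiplier l) (multiplier-neg (point-multiplier k)) ,
       difference-nonzero k l k<l , λ i → subst (λ b → Boundedᶜ b (⟦ σ (suc i) ⟧ (difference k l))) total
         (boundedᶜ-cong (0<½* 0<η) (value k l i) (close i))
    where
    -- Vectors in one cell differ by at most four times the mesh, which is η / 2; the other half is
    -- spent on `boundedᶜ-cong`.
    mesh-size = ½ ℚ.* (½ ℚ.* (½ ℚ.* η))
    open Cells C mesh-size (0<½* {½ ℚ.* (½ ℚ.* η)} (0<½* {½ ℚ.* η} (0<½* {η} 0<η)))
    total : (mesh-size ℚ.+ mesh-size) ℚ.+ (mesh-size ℚ.+ mesh-size) ℚ.+ ½ ℚ.* η ≡ η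
    total = ≡.trans (cong (ℚ._+ ½ ℚ.* η) (≡.trans (cong₂ ℚ._+_ (½+½ (½ ℚ.* (½ ℚ.* η))) (½+½ (½ ℚ.* (½ ℚ.* η)))) (½+½ (½ ℚ.* η)))) (½+½ η)
    value : ∀ k l i → error k (suc i) +ᶜ -ᶜ error l (suc i) ≈ᶜ ⟦ σ (suc i) ⟧ (difference k l)
    value k l i = ℂ-Ring.trans (error-difference k l (suc i)) (ℂ-Ring.trans
      (ℂ-Ring.+-congʳ {⟦ σ (suc i) ⟧ (difference k l)} (ℂ-Ring.-‿inverseʳ 0ᶜ))
      (ℂ-Ring.+-identityˡ (⟦ σ (suc i) ⟧ (difference k l))))

  module Rescaling (α : Element) (α-multiplier : Multiplier (proj₁ α)) (β : Element) (αβ≈1 : α *ᴷ β ≈ᴷ 1ᴷ) where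

    -- Multiplication by σᵢ(β), with `β` the inverse of `α` in K, replaces division by σᵢ(α):
    -- nothing is inverted in `ℂ`, and symmetry persists.
    scaled : Vector ℂ (suc m) → Vector ℂ (suc m)
    scaled y i = ⟦ σ i ⟧ β *ᶜ y i
    scaled-symmetric : ∀ y → Symmetric y → Symmetric (scaled y)
    scaled-symmetric y y-symmetric i = ℂ-Ring.trans
      (ℂ-Ring.*-cong (σ-bar i β) (y-symmetric i)) (ℂ-Ring.sym (conj-* (⟦ σ i ⟧ β) (y i)))
    factor : ∀ y θ i → ⟦ σ i ⟧ α *ᶜ (scaled y i +ᶜ -ᶜ ⟦ σ i ⟧ θ) ≈ᶜ y i +ᶜ -ᶜ ⟦ σ i ⟧ (α *ᴷ θ)
    factor y θ i = begin
      ⟦ σ i ⟧ α *ᶜ (scaled y i +ᶜ -ᶜ ⟦ σ i ⟧ θ)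
        ≈⟨ ℂ-Ring.distribˡ (⟦ σ i ⟧ α) (scaled y i) (-ᶜ ⟦ σ i ⟧ θ) ⟩
      ⟦ σ i ⟧ α *ᶜ (⟦ σ i ⟧ β *ᶜ y i) +ᶜ ⟦ σ i ⟧ α *ᶜ (-ᶜ ⟦ σ i ⟧ θ)
        ≈⟨ ℂ-Ring.+-cong
             (ℂ-Ring.trans (ℂ-Ring.sym (ℂ-Ring.*-assoc (⟦ σ i ⟧ α) (⟦ σ i ⟧ β) (y i)))
               (ℂ-Ring.trans (ℂ-Ring.*-congʳ {y i} (ℂ-Ring.trans (ℂ-Ring.sym (embedding.*-homo (σ i) α β))
                 (ℂ-Ring.trans (embedding.⟦⟧-cong (σ i) {α *ᴷ β} {1ᴷ} αβ≈1) (embedding.1#-homo (σ i)))))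
                 (ℂ-Ring.*-identityˡ (y i))))
             (ℂ-Ring.trans (ℂ-Ring.sym (-‿distribʳ-* (⟦ σ i ⟧ α) (⟦ σ i ⟧ θ)))
               (ℂ-Ring.-‿cong (ℂ-Ring.sym (embedding.*-homo (σ i) α θ)))) ⟩
      y i +ᶜ -ᶜ ⟦ σ i ⟧ (α *ᴷ θ) ∎

    approximate-rescaled : ∀ {p q δ} → 0ℚ ℚ.< δ →
      Boundedᶜ p (⟦ σ zero ⟧ α) → (∀ i → Boundedᶜ q (⟦ σ (suc i) ⟧ α)) →
      ∀ y → Symmetric y → Σ[ θ ∈ Element ] Multiplier (proj₁ θ) ×
      Boundedᶜ (p ℚ.* C ℚ.+ p ℚ.* C ℚ.+ δ) (y zero +ᶜ -ᶜ ⟦ σ zero ⟧ θ) ×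
      ∀ i → Boundedᶜ (q ℚ.* C ℚ.+ q ℚ.* C ℚ.+ δ) (y (suc i) +ᶜ -ᶜ ⟦ σ (suc i) ⟧ θ)
    approximate-rescaled 0<δ α≤p α≤q y y-symmetric =
      let θ , θ-multiplier , close = covering (scaled y) (scaled-symmetric y y-symmetric)
      in α *ᴷ θ , multiplier-* α-multiplier θ-multiplier ,
         boundedᶜ-cong 0<δ (factor y θ zero)
           (boundedᶜ-* {z = ⟦ σ zero ⟧ α} {scaled y zero +ᶜ -ᶜ ⟦ σ zero ⟧ θ} α≤p (close zero)) ,
         λ i → boundedᶜ-cong 0<δ (factor y θ (suc i))
           (boundedᶜ-* {z = ⟦ σ (suc i) ⟧ α} {scaled y (suc i) +ᶜ -ᶜ ⟦ σ (suc i) ⟧ θ} (α≤q i) (close (suc i)))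

  -- The order of choices gives uniformity: `e` determines `α`, then `A` bounds its image at index
  -- 0, and `c = 2AC + e/2` is fixed before `y` appears.
  approximation : ∀ e → 0ℚ ℚ.< e → ∃[ c ] 0ℚ ℚ.< c × (∀ y → Symmetric y → Σ[ θ ∈ Element ] Multiplier (proj₁ θ) ×
    Boundedᶜ c (y zero +ᶜ -ᶜ ⟦ σ zero ⟧ θ) × ∀ i → Boundedᶜ e (y (suc i) +ᶜ -ᶜ ⟦ σ (suc i) ⟧ θ))
  approximation e 0<e = rescale (small-element η (scale-pos {C ℚ.+ C} {½ ℚ.* e} 0<C+C (0<½* 0<e)))
    where
    open +-*-Solver hiding (⟦_⟧)
    Approximant : ℚ → Vector ℂ (suc m) → Set ℓ
    Approximant c y = Σ[ θ ∈ Element ] Multiplier (proj₁ θ) ×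
      Boundedᶜ c (y zero +ᶜ -ᶜ ⟦ σ zero ⟧ θ) × ∀ i → Boundedᶜ e (y (suc i) +ᶜ -ᶜ ⟦ σ (suc i) ⟧ θ)
    0<C+C : 0ℚ ℚ.< C ℚ.+ C
    0<C+C = +-pos {C} {C} 0<covering-radius 0<covering-radius
    -- Chosen so that the rescaled covering error `2 C η` is e / 2; the slack uses the other half.
    η : ℚ
    η = scale (C ℚ.+ C) (½ ℚ.* e) 0<C+C
    total : η ℚ.* C ℚ.+ η ℚ.* C ℚ.+ ½ ℚ.* e ≡ e
    total = ≡.trans (cong (ℚ._+ ½ ℚ.* e) (≡.trans
      (solve 2 (λ η c → η :* c :+ η :* c := (c :+ c) :* η) ≡.refl η C) (scale-* {C ℚ.+ C} {½ ℚ.* e} 0<C+C))) (½+½ e)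
    0<c : ∀ A → 0ℚ ℚ.< A → 0ℚ ℚ.< A ℚ.* C ℚ.+ A ℚ.* C ℚ.+ ½ ℚ.* e
    0<c A 0<A = +-pos {A ℚ.* C ℚ.+ A ℚ.* C} {½ ℚ.* e} (+-pos {A ℚ.* C} {A ℚ.* C} 0<AC 0<AC) (0<½* 0<e)
      where
      0<AC : 0ℚ ℚ.< A ℚ.* C
      0<AC = *-pos {A} {C} 0<A 0<covering-radius
    rescale : (Σ[ α ∈ Element ] Multiplier (proj₁ α) × (¬ proj₁ α ≈ 0ʳ) × ∀ i → Boundedᶜ η (⟦ σ (suc i) ⟧ α)) →
      ∃[ c ] 0ℚ ℚ.< c × (∀ y → Symmetric y → Approximant c y)
    rescale (α , α-multiplier , α≉0 , α-small) = conclude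
      (FiniteExtension.inverse extension {α} λ α≈0 → α≉0 (inℝ α≈0)) (boundedᶜ-exists (⟦ σ zero ⟧ α))
      where
      conclude : (∃[ β ] α *ᴷ β ≈ᴷ 1ᴷ) → (∃[ A ] 0ℚ ℚ.< A × Boundedᶜ A (⟦ σ zero ⟧ α)) →
        ∃[ c ] 0ℚ ℚ.< c × (∀ y → Symmetric y → Approximant c y)
      conclude (β , αβ≈1) (A , 0<A , α≤A) = A ℚ.* C ℚ.+ A ℚ.* C ℚ.+ ½ ℚ.* e , 0<c A 0<A , λ y y-symmetric →
        refine y (Rescaling.approximate-rescaled α α-multiplier β αβ≈1 (0<½* 0<e) α≤A α-small y y-symmetric)
        where
        refine : ∀ {c} y → (Σ[ θ ∈ Element ] Multiplier (proj₁ θ) × Boundedᶜ c (y zero +ᶜ -ᶜ ⟦ σ zero ⟧ θ) ×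
          ∀ i → Boundedᶜ (η ℚ.* C ℚ.+ η ℚ.* C ℚ.+ ½ ℚ.* e) (y (suc i) +ᶜ -ᶜ ⟦ σ (suc i) ⟧ θ)) → Approximant c y
        refine y (θ , θ-multiplier , close₀ , close) = θ , θ-multiplier , close₀ ,
          λ i → boundedᶜ-mono {z = y (suc i) +ᶜ -ᶜ ⟦ σ (suc i) ⟧ θ} (ℚ.≤-reflexive total) (close i)

-- Comparison with the order and the modulus

sub-def : ∀ x y → x ⊕ ⊖ y ≡ x - y
sub-def x y = ≡.trans (cong (x ⊕_) (⊖-def y)) (⊕-def x (- y))

bounded⇒≤ˡ : ∀ {b} x y → Bounded b (x - y) → x - fromℚ b ≤ y
bounded⇒≤ˡ {b} x y x-y≤b ε 0<ε = eventually-map (λ n ≤b → subst (ℚ._< seq y n ℚ.+ ε)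
    (solve 3 (λ x y b → y :+ (x :- y :- b) := x :- b) ≡.refl (seq x n) (seq y n) b)
    (ℚ.+-monoʳ-< (seq y n) (ℚ.≤-<-trans
      (subst (seq x n ℚ.- seq y n ℚ.- b ℚ.≤_) (ℚ.+-inverseʳ b)
        (ℚ.+-monoˡ-≤ (ℚ.- b) (ℚ.≤-trans (p≤∣p∣ (seq x n ℚ.- seq y n)) ≤b))) 0<ε)))
  x-y≤b
  where open +-*-Solver

bounded⇒≤ʳ : ∀ {b} x y → Bounded b (x - y) → y ≤ x + fromℚ b
bounded⇒≤ʳ {b} x y x-y≤b ε 0<ε = eventually-map (λ n ≤b → ℚ.≤-<-trans
    (subst (ℚ._≤ seq x n ℚ.+ b) (solve 2 (λ x y → x :+ :- (x :- y) := y) ≡.refl (seq x n) (seq y n))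
      (ℚ.+-monoʳ-≤ (seq x n) (ℚ.≤-trans (-p≤∣p∣ (seq x n ℚ.- seq y n)) ≤b)))
    (subst (ℚ._< seq x n ℚ.+ b ℚ.+ ε) (ℚ.+-identityʳ (seq x n ℚ.+ b)) (ℚ.+-monoʳ-< (seq x n ℚ.+ b) 0<ε)))
  x-y≤b
  where open +-*-Solver

0<⇒0<fromℚ : ∀ {q} → 0ℚ ℚ.< q → 0ℝ < fromℚ q
0<⇒0<fromℚ {q} 0<q = ½ ℚ.* q , 0<½* 0<q , 0 , λ _ _ →
  subst₂ ℚ._<_ (≡.sym (ℚ.+-identityˡ (½ ℚ.* q)))
    (½+½ q)
    (subst (ℚ._< ½ ℚ.* q ℚ.+ ½ ℚ.* q) (ℚ.+-identityˡ (½ ℚ.* q)) (ℚ.+-monoˡ-< (½ ℚ.* q) (0<½* 0<q)))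

p*p≤ : ∀ {p b} → ℚ.∣ p ∣ ℚ.≤ b → p ℚ.* p ℚ.≤ b ℚ.* b
p*p≤ {p} {b} ∣p∣≤b = ℚ.≤-trans
  (subst (p ℚ.* p ℚ.≤_) (ℚ.∣p*q∣≡∣p∣*∣q∣ p p) (p≤∣p∣ (p ℚ.* p)))
  (*-mono-≤ {ℚ.∣ p ∣} {b} {ℚ.∣ p ∣} {b} (ℚ.0≤∣p∣ p) (ℚ.≤-trans (ℚ.0≤∣p∣ p) ∣p∣≤b) ∣p∣≤b ∣p∣≤b)

root≤ : ∀ {p q b} → 0ℚ ℚ.≤ p → p ≡ 0ℚ ⊎ p ℚ.* p ℚ.≤ q → 0ℚ ℚ.< b → q ℚ.≤ b ℚ.* b → p ℚ.≤ b
root≤ {b = b} _ (inj₁ p≡0) 0<b _ = subst (ℚ._≤ b) (≡.sym p≡0) (ℚ.<⇒≤ 0<b)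
root≤ {p} {b = b} 0≤p (inj₂ pp≤q) 0<b q≤bb = ℚ.≮⇒≥ λ b<p → ℚ.<-irrefl ≡.refl (ℚ.<-≤-trans
  (ℚ.<-≤-trans (ℚ.*-monoʳ-<-pos b {{ℚ.positive 0<b}} b<p)
    (ℚ.*-monoʳ-≤-nonNeg p {{ℚ.nonNegative 0≤p}} (ℚ.<⇒≤ b<p)))
  (ℚ.≤-trans pp≤q q≤bb))

-- The proof of `0ℝ < ε` carries a rational `e` that stays below `ε`. Parts of size at most e / 2
-- have squares summing to at most e² / 2 ≤ e², so the rational square roots stay below `e`, with no
-- need of √2.
modulus≤ : ∀ ε (0<ε : 0ℝ < ε) z → Bounded (½ ℚ.* proj₁ 0<ε) (re z) → Bounded (½ ℚ.* proj₁ 0<ε) (im z) → ∣ z ∣ ≤ ε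
modulus≤ ε (e , 0<e , N , e<ε) z re≤ im≤ η 0<η = eventually-zip
  (λ n root≤e e<ε → ℚ.≤-<-trans root≤e (ℚ.<-trans (subst (ℚ._< seq ε n) (ℚ.+-identityˡ e) e<ε)
    (subst (ℚ._< seq ε n ℚ.+ η) (ℚ.+-identityʳ (seq ε n)) (ℚ.+-monoʳ-< (seq ε n) 0<η))))
  (eventually-zip (λ n re≤ im≤ → let q = seq (re z) n ℚ.* seq (re z) n ℚ.+ seq (im z) n ℚ.* seq (im z) n in
    root≤ {rootℚ q n} {q} (0≤rootℚ q n) (rootℚ-lower q n) 0<e (ℚ.≤-trans
      (ℚ.+-mono-≤ (p*p≤ {seq (re z) n} {h} re≤) (p*p≤ {seq (im z) n} {h} im≤)) hh+hh≤ee)) re≤ im≤)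
  (N , e<ε)
  where
  open +-*-Solver
  h = ½ ℚ.* e
  0≤hh : 0ℚ ℚ.≤ h ℚ.* h
  0≤hh = *-nonNeg {h} {h} (ℚ.<⇒≤ (0<½* 0<e)) (ℚ.<⇒≤ (0<½* 0<e))
  hh+hh≤ee : h ℚ.* h ℚ.+ h ℚ.* h ℚ.≤ e ℚ.* e
  hh+hh≤ee = subst (h ℚ.* h ℚ.+ h ℚ.* h ℚ.≤_)
    (≡.trans (solve 1 (λ h → h :* h :+ h :* h :+ (h :* h :+ h :* h) := (h :+ h) :* (h :+ h)) ≡.refl h)
             (cong₂ ℚ._*_ (½+½ e) (½+½ e)))
    (p≤p+q {h ℚ.* h ℚ.+ h ℚ.* h} {h ℚ.* h ℚ.+ h ℚ.* h} (ℚ.+-mono-≤ {0ℚ} {h ℚ.* h} {0ℚ} {h ℚ.* h} 0≤hh 0≤hh))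

-- Labelled embeddings and the conclusion

module LabelledEmbeddings {ℓ} (r t : ℕ) (K : RealNumberField ℓ (suc r ℕ.+ (t ℕ.+ t))) (L : Labelling r t K) where

  open RealNumberField K using (Element)
  open Labelling L

  targets : Vector ℝ (suc r) → Vector ℂ t → Vector ℂ (suc r ℕ.+ (t ℕ.+ t))
  targets x z = (realᶜ ∘ x) Vector.++ (z Vector.++ (conj ∘ z))

  -- `_↑ˡ_` and `_↑ʳ_` are functions, not constructors; the view makes the three blocks of indices
  -- accessible to pattern matching.
  data View : Fin (suc r ℕ.+ (t ℕ.+ t)) → Set where
    real-view     : ∀ (j : Fin (suc r)) → View (j ↑ˡ (t ℕ.+ t))
    complex-view  : ∀ (k : Fin t) → View (suc r ↑ʳ (k ↑ˡ t))
    complex′-view : ∀ (k : Fin t) → View (suc r ↑ʳ (t ↑ʳ k))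

  view : ∀ i → View i
  view i = subst View (Fin.join-splitAt (suc r) (t ℕ.+ t) i) (outer (Fin.splitAt (suc r) i))
    where
    inner : (k : Fin t ⊎ Fin t) → View (suc r ↑ʳ Fin.join t t k)
    inner (inj₁ k) = complex-view k
    inner (inj₂ k) = complex′-view k
    outer : (i : Fin (suc r) ⊎ Fin (t ℕ.+ t)) → View (Fin.join (suc r) (t ℕ.+ t) i)
    outer (inj₁ j) = real-view j
    outer (inj₂ k) = subst (λ k → View (suc r ↑ʳ k)) (Fin.join-splitAt t t k) (inner (Fin.splitAt t k))

  targets-real : ∀ x z (j : Fin (suc r)) → targets x z (j ↑ˡ (t ℕ.+ t)) ≡ realᶜ (x j)
  targets-real x z j = Vector.lookup-++ˡ (realᶜ ∘ x) (z Vector.++ (conj ∘ z)) j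

  targets-complex : ∀ x z k → targets x z (suc r ↑ʳ (k ↑ˡ t)) ≡ z k
  targets-complex x z k = ≡.trans (Vector.lookup-++ʳ (realᶜ ∘ x) (z Vector.++ (conj ∘ z)) (k ↑ˡ t))
                                  (Vector.lookup-++ˡ z (conj ∘ z) k)

  targets-complex′ : ∀ x z k → targets x z (suc r ↑ʳ (t ↑ʳ k)) ≡ conj (z k)
  targets-complex′ x z k = ≡.trans (Vector.lookup-++ʳ (realᶜ ∘ x) (z Vector.++ (conj ∘ z)) (t ↑ʳ k))
                                   (Vector.lookup-++ʳ z (conj ∘ z) k)

  -- Everything required of the conjugate index, bundled so that one case analysis yields it all.
  -- The last two fields take an equation for `i`, since the indices in `View` are not in
  -- constructor form.
  record Conjugate (i : Fin (suc r ℕ.+ (t ℕ.+ t))) : Set ℓ where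
    field
      index          : Fin (suc r ℕ.+ (t ℕ.+ t))
      embedding-conj : ∀ x → ⟦ σ index ⟧ x ≈ᶜ conj (⟦ σ i ⟧ x)
      targets-conj   : ∀ x z → targets x z index ≈ᶜ conj (targets x z i)
      index-zero     : i ≡ zero → index ≡ zero
      index-suc      : ∀ {j} → i ≡ suc j → ∃[ j′ ] index ≡ suc j′

  open Conjugate

  private
    σ-complex′-conj : ∀ k x → ⟦ σ-complex′ k ⟧ x ≈ᶜ conj (⟦ σ-complex k ⟧ x)
    σ-complex′-conj k x = ℂ-Ring.trans (≃ᶜ⇒≈ᶜ (conjugates k x))
      (ℂ-Ring.reflexive (cong (re (⟦ σ-complex k ⟧ x) +i_) (≡.sym (⊖-def (im (⟦ σ-complex k ⟧ x))))))

    conj-real : ∀ {z} → im z ≈ 0ʳ → z ≈ᶜ conj z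
    conj-real im≈0 = ℝ-Ring.refl ,ᶜ ℝ-Ring.trans im≈0 (ℝ-Ring.trans (ℝ-Ring.sym (im-≈ conj-0)) (ℝ-Ring.-‿cong (ℝ-Ring.sym im≈0)))

    flip-conj : ∀ {z w} → w ≈ᶜ conj z → z ≈ᶜ conj w
    flip-conj {z} w≈ = ℂ-Ring.trans (ℂ-Ring.sym (conj-involutive z)) (conj-cong (ℂ-Ring.sym w≈))

    targets-complex-conj : ∀ x z k → targets x z (suc r ↑ʳ (t ↑ʳ k)) ≈ᶜ conj (targets x z (suc r ↑ʳ (k ↑ˡ t)))
    targets-complex-conj x z k = ℂ-Ring.reflexive
      (≡.trans (targets-complex′ x z k) (cong conj (≡.sym (targets-complex x z k))))

    im-real : ∀ (j : Fin (suc r)) x → im (⟦ σ (j ↑ˡ (t ℕ.+ t)) ⟧ x) ≈ 0ʳ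
    im-real j x = subst (im (⟦ σ (j ↑ˡ (t ℕ.+ t)) ⟧ x) ≈_) (≡.sym (rational-def 0ℚ))
      ⌊ Equivalence.from (real (j ↑ˡ (t ℕ.+ t)))
          (subst (ℕ._< suc r) (≡.sym (Fin.toℕ-↑ˡ j (t ℕ.+ t))) (Fin.toℕ<n j)) x ⌋

  conjugate-view : ∀ {i} → View i → Conjugate i
  conjugate-view (real-view j) = record
    { index          = j ↑ˡ (t ℕ.+ t)
    ; embedding-conj = λ x → conj-real (im-real j x)
    ; targets-conj   = λ x z → conj-real (ℝ-Ring.reflexive (cong im (targets-real x z j)))
    ; index-zero     = λ eq → eq
    ; index-suc      = λ {j′} eq → j′ , eq
    }
  conjugate-view (complex-view k) = record
    { index          = suc r ↑ʳ (t ↑ʳ k)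
    ; embedding-conj = σ-complex′-conj k
    ; targets-conj   = λ x z → targets-complex-conj x z k
    ; index-zero     = λ ()
    ; index-suc      = λ _ → r ↑ʳ (t ↑ʳ k) , ≡.refl
    }
  conjugate-view (complex′-view k) = record
    { index          = suc r ↑ʳ (k ↑ˡ t)
    ; embedding-conj = λ x → flip-conj (σ-complex′-conj k x)
    ; targets-conj   = λ x z → flip-conj (targets-complex-conj x z k)
    ; index-zero     = λ ()
    ; index-suc      = λ _ → r ↑ʳ (k ↑ˡ t) , ≡.refl
    }

  conjugate-index : ∀ i → Conjugate i
  conjugate-index i = conjugate-view (view i)

  bar : Fin (suc r ℕ.+ (t ℕ.+ t)) → Fin (suc r ℕ.+ (t ℕ.+ t))
  bar i = index (conjugate-index i)

  open SmallElement K σ distinct bar (λ i → embedding-conj (conjugate-index i))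
    (index-zero (conjugate-index zero) ≡.refl) (λ i → index-suc (conjugate-index (suc i)) ≡.refl) public
  open Integrality K using (Multiplier; multiplier-integral)

  Approximates : ℝ → ℝ → Vector ℝ r → Vector ℂ t → ℝ → Element → Set
  Approximates c ε x z x₁ θ = (x₁ - c ≤ proj₁ θ × proj₁ θ ≤ x₁ + c) ×
    IsAlgebraicInteger (proj₁ θ) ×
    (∀ j → ∣ fromℝ (x j) -ᶜ ⟦ σ-real j ⟧ θ ∣ ≤ ε) ×
    (∀ k → ∣ z k -ᶜ ⟦ σ-complex k ⟧ θ ∣ ≤ ε)

  approximates : ∀ {c ε} (0<ε : 0ℝ < ε) x z x₁ θ → Multiplier (proj₁ θ) →
    Boundedᶜ c (targets (x₁ Vector.∷ x) z zero +ᶜ -ᶜ ⟦ σ zero ⟧ θ) →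
    (∀ i → Boundedᶜ (½ ℚ.* proj₁ 0<ε) (targets (x₁ Vector.∷ x) z (suc i) +ᶜ -ᶜ ⟦ σ (suc i) ⟧ θ)) →
    Approximates (fromℚ (c ℚ.+ 1ℚ)) ε x z x₁ θ
  approximates {c} {ε} 0<ε x z x₁ θ θ-multiplier (close₀ , _) close =
    (bounded⇒≤ˡ x₁ (proj₁ θ) near , bounded⇒≤ʳ x₁ (proj₁ θ) near) , multiplier-integral θ-multiplier ,
    -- `suc j ↑ˡ n` reduces to `suc (j ↑ˡ n)`, and likewise for `_↑ʳ_`, so the remaining embeddings
    -- sit at the successor indices covered by `close`.
    (λ j → modulus≤ ε 0<ε (fromℝ (x j) -ᶜ ⟦ σ-real j ⟧ θ)
      (subst (Bounded e) (≡.trans (cong (λ w → re w ⊕ ⊖ re (⟦ σ-real j ⟧ θ)) (targets-real x′ z (suc j)))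
        (sub-def (x j) (re (⟦ σ-real j ⟧ θ)))) (proj₁ (close (j ↑ˡ (t ℕ.+ t)))))
      (subst (Bounded e) (≡.trans (cong (λ w → im w ⊕ ⊖ im (⟦ σ-real j ⟧ θ)) (targets-real x′ z (suc j)))
        (≡.trans (cong (_⊕ ⊖ im (⟦ σ-real j ⟧ θ)) (rational-def 0ℚ)) (sub-def 0ℝ (im (⟦ σ-real j ⟧ θ))))) (proj₂ (close (j ↑ˡ (t ℕ.+ t)))))) ,
    (λ k → modulus≤ ε 0<ε (z k -ᶜ ⟦ σ-complex k ⟧ θ)
      (subst (Bounded e) (≡.trans (cong (λ w → re w ⊕ ⊖ re (⟦ σ-complex k ⟧ θ)) (targets-complex x′ z k))
        (sub-def (re (z k)) (re (⟦ σ-complex k ⟧ θ)))) (proj₁ (close (r ↑ʳ (k ↑ˡ t)))))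
      (subst (Bounded e) (≡.trans (cong (λ w → im w ⊕ ⊖ im (⟦ σ-complex k ⟧ θ)) (targets-complex x′ z k))
        (sub-def (im (z k)) (im (⟦ σ-complex k ⟧ θ)))) (proj₂ (close (r ↑ʳ (k ↑ˡ t))))))
    where
    e = ½ ℚ.* proj₁ 0<ε
    x′ : Vector ℝ (suc r)
    x′ = x₁ Vector.∷ x
    -- The image of `θ` under σ₁ equals `θ` only up to `≃`; replacing one by the other costs the
    -- extra 1.
    near : Bounded (c ℚ.+ 1ℚ) (x₁ - proj₁ θ)
    near = subst (Bounded (c ℚ.+ 1ℚ)) (sub-def x₁ (proj₁ θ))
      (bounded-cong (ℚ.positive⁻¹ 1ℚ)
        (ℝ-Ring.+-cong (ℝ-Ring.reflexive (cong re (targets-real x′ z zero)))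
          (ℝ-Ring.-‿cong ⌊ proj₁ (inclusion θ) ⌋))
        close₀)

  private
    Target : ℚ → ℚ → Vector ℂ (suc r ℕ.+ (t ℕ.+ t)) → Set ℓ
    Target c e y = Σ[ θ ∈ Element ] Multiplier (proj₁ θ) ×
      Boundedᶜ c (y zero +ᶜ -ᶜ ⟦ σ zero ⟧ θ) × ∀ i → Boundedᶜ e (y (suc i) +ᶜ -ᶜ ⟦ σ (suc i) ⟧ θ)

    from-target : ∀ {c ε} (0<ε : 0ℝ < ε) x z x₁ → Target c (½ ℚ.* proj₁ 0<ε) (targets (x₁ Vector.∷ x) z) →
      Σ[ θ ∈ Element ] Approximates (fromℚ (c ℚ.+ 1ℚ)) ε x z x₁ θ
    from-target {c} {ε} 0<ε x z x₁ (θ , θ-multiplier , close₀ , close) =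
      θ , approximates {c} {ε} 0<ε x z x₁ θ θ-multiplier close₀ close

    from-approximation : ∀ {ε} (0<ε : 0ℝ < ε) →
      (∃[ c ] 0ℚ ℚ.< c × (∀ y → (∀ i → y (bar i) ≈ᶜ conj (y i)) → Target c (½ ℚ.* proj₁ 0<ε) y)) →
      ∃[ c ] 0ℝ < c × (∀ x z x₁ → Σ[ θ ∈ Element ] Approximates c ε x z x₁ θ)
    from-approximation {ε} 0<ε (c , 0<c , approximate) = fromℚ (c ℚ.+ 1ℚ) ,
      0<⇒0<fromℚ (+-pos 0<c (ℚ.positive⁻¹ 1ℚ)) , λ x z x₁ →
        from-target {c} {ε} 0<ε x z x₁ (approximate (targets (x₁ Vector.∷ x) z)
          λ i → targets-conj (conjugate-index i) (x₁ Vector.∷ x) z)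

  approximant : ∀ ε → 0ℝ < ε → ∃[ c ] 0ℝ < c × (∀ x z x₁ → Σ[ θ ∈ Element ] Approximates c ε x z x₁ θ)
  approximant ε 0<ε = from-approximation {ε} 0<ε
    (approximation (½ ℚ.* proj₁ 0<ε) (0<½* {proj₁ 0<ε} (proj₁ (proj₂ 0<ε))))

theorem1 : ∀ {ℓ} (r t : ℕ) (K : RealNumberField ℓ (suc r ℕ.+ (t ℕ.+ t))) →
    2 ℕ.≤ suc r ℕ.+ (t ℕ.+ t) →
    (L : Labelling r t K) →
    (ε : ℝ) → 0ℝ < ε →
    ∃[ c ] 0ℝ < c ×
    (∀ (x : Fin r → ℝ) (z : Fin t → ℂ) →
    (∀ j → ∣ fromℝ (x j) ∣ < 1ℝ) →
    (∀ k → ∣ z k ∣ < 1ℝ) →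
    (∀ j y → x j - ε ≤ y → y ≤ x j + ε → ∣ fromℝ y ∣ < 1ℝ) →
    (∀ k w → ∣ w -ᶜ z k ∣ ≤ ε → ∣ w ∣ < 1ℝ) →
    (x₁ : ℝ) →
    Σ[ θ ∈ RealNumberField.Element K ]
    (x₁ - c ≤ proj₁ θ × proj₁ θ ≤ x₁ + c) ×
    IsAlgebraicInteger (proj₁ θ) ×
    (∀ j → ∣ fromℝ (x j) -ᶜ ⟦ Labelling.σ-real L j ⟧ θ ∣ ≤ ε) ×
    (∀ k → ∣ z k -ᶜ ⟦ Labelling.σ-complex L k ⟧ θ ∣ ≤ ε))
theorem1 r t K _ L ε 0<ε = proj₁ result , proj₁ (proj₂ result) , λ x z _ _ _ _ x₁ → proj₂ (proj₂ result) x z x₁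
  where result = LabelledEmbeddings.approximant r t K L ε 0<ε
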